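{- There is an algorithm that, given a set $\mathcal{R}$ of rules on a finite ground set $Q$, computes the set of all critical rules of the antimatroid $\mathcal{A}(\mathcal{R})$ in time $O(l(\mathcal{R})^2)$.
   Context: A rule on $Q$ is a pair $(A,q)$ with $A\subseteq Q$, $q\in Q$; it accepts $X\subseteq Q$ if $q\in X$ implies $X\cap A\neq\emptyset$. For a set $\mathcal{R}$ of rules, $\mathcal{K}(\mathcal{R})$ is the family of subsets of $Q$ accepted by all rules in $\mathcal{R}$. A tight path from $\emptyset$ to $X$ in a family $\mathcal{K}$ is a sequence $\emptyset=Y_0\subseteq\dots\subseteq Y_k=X$ of members of $\mathcal{K}$ with $|Y_{i+1}\setminus Y_i|=1$. $\mathcal{A}(\mathcal{R})$ is the family of $K\in\mathcal{K}(\mathcal{R})$ such that there is a tight path from $\emptyset$ to $K$ in $\mathcal{K}(\mathcal{R})$; it is an antimatroid (union-closed, and every nonempty member $X$ has $x\in X$ with $X\setminus\{x\}$ a member). For an antimatroid $\mathcal{A}$ on $Q$, let $\mathcal{A}^*=\{Q\setminus X: X\in\mathcal{A}\}$ and let $\tau(X)=\bigcap\{Y\in\mathcal{A}^*: X\subseteq Y\}$ be its closure operator. A rule $(A,q)$ with $q\notin A$ is critical for $\mathcal{A}$ if, writing $C=A\cup\{q\}$, one has $\tau(C)\setminus\{q\}\notin\mathcal{A}^*$ and $\tau(C)\setminus\{q,s\}\in\mathcal{A}^*$ for every $s\in A$. The input size is $l(\mathcal{R})=\sum_{(A,q)\in\mathcal{R}}(|A|+1)$. -}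

module Defs where

open import Data.Bool using (Bool; true; false; not; if_then_else_)
open import Data.Fin using (Fin; toℕ)
open import Data.Fin.Subset
  using (Subset; _∈_; _∉_; _⊆_; _∩_; _∪_; _─_; _-_; ∁; ⊥; ⁅_⁆; ∣_∣; Nonempty)
open import Data.List using (List; []; _∷_; _++_; length; lookup; map)
import Data.List.Membership.Propositional as List
open import Data.List.Relation.Unary.All using (All)
open import Data.List.Relation.Unary.Unique.Propositional using (Unique)
open import Data.Nat using (ℕ; zero; suc; pred; _+_; _≤_; _≡ᵇ_; _<ᵇ_)
open import Data.Nat.ListAction using (sum)
open import Data.Product using (_×_; _,_; ∃-syntax)
open import Function.Bundles using (_⇔_)
open import Level using (0ℓ)
open import Relation.Binary.PropositionalEquality using (_≡_)
open import Relation.Nullary using (¬_)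
open import Relation.Unary using (Pred)

------------------------------------------------------------------------
-- Rules and antimatroids on the ground set Q = Fin n

Rule : ℕ → Set
Rule n = Subset n × Fin n

Family : ℕ → Set₁
Family n = Pred (Subset n) 0ℓ

-- A finite set, presented by a list without repetitions.
Enumerates : {X : Set} → List X → Pred X 0ℓ → Set
Enumerates xs P = Unique xs × (∀ x → (x List.∈ xs) ⇔ P x)

module _ {n : ℕ} where

  Accepts : Rule n → Subset n → Set
  Accepts (A , q) X = q ∈ X → Nonempty (X ∩ A)

  𝓚 : List (Rule n) → Family n
  𝓚 R X = All (λ ρ → Accepts ρ X) R

  data TightPath (𝒦 : Family n) : Subset n → Subset n → Set where
    stay : ∀ {X} → 𝒦 X → TightPath 𝒦 X X
    step : ∀ {X Y Z} → TightPath 𝒦 X Y → 𝒦 Z → Y ⊆ Z → ∣ Z ─ Y ∣ ≡ 1 →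
           TightPath 𝒦 X Z

  𝓐 : List (Rule n) → Family n
  𝓐 R X = 𝓚 R X × TightPath (𝓚 R) ⊥ X

  _* : Family n → Family n
  (𝒜 *) Y = ∃[ X ] 𝒜 X × Y ≡ ∁ X

  -- T = τ(X).  The graph of τ is used because an intersection over an
  -- arbitrary family is not computable as an element of Subset n.
  IsClosure : Family n → Subset n → Subset n → Set
  IsClosure 𝒜 X T = ∀ x → (x ∈ T) ⇔ (∀ Y → (𝒜 *) Y → X ⊆ Y → x ∈ Y)

  Critical : Family n → Rule n → Set
  Critical 𝒜 (A , q) =
    q ∉ A ×
    (∃[ T ] IsClosure 𝒜 (A ∪ ⁅ q ⁆) T ×
            ¬ (𝒜 *) (T - q) ×
            (∀ s → s ∈ A → (𝒜 *) (T ─ (⁅ q ⁆ ∪ ⁅ s ⁆))))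

  -- Equals Σ_{(A,q)∈R} (|A| + 1) when R has no repetitions.
  inputSize : List (Rule n) → ℕ
  inputSize R = sum (map (λ (A , q) → ∣ A ∣ + 1) R)

------------------------------------------------------------------------
-- Random access machines
--
-- Structured programs over natural-number registers and finitely many
-- zero-initialised, randomly accessible arrays.  Every node of an executed
-- expression, test, assignment or branch costs one unit of time.  The only
-- arithmetic is successor and predecessor, so stored numbers and addresses
-- exceed the constants of the program and the numbers of the input by at most
-- the running time, and unit cost cannot be abused by computing with long
-- words.

data Expr : Set where
  lit   : ℕ → Expr
  reg   : ℕ → Expr
  _[_]  : ℕ → Expr → Expr      -- array name, index
  succ′ : Expr → Expr
  pred′ : Expr → Expr

data Test : Set where
  _≐_ _≺_ : Expr → Expr → Test
  not′    : Test → Test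

infixr 4 _⨟_
infix  5 _≔_ _[_]≔_
infix  6 _≐_ _≺_

data Program : Set where
  skip          : Program
  _≔_           : ℕ → Expr → Program
  _[_]≔_        : ℕ → Expr → Expr → Program
  _⨟_           : Program → Program → Program
  if′_then_else_ : Test → Program → Program → Program
  while_loop_   : Test → Program → Program

record State : Set where
  constructor state
  field
    regs   : ℕ → ℕ
    arrays : ℕ → ℕ → ℕ

open State public

_[_↦_] : {V : Set} → (ℕ → V) → ℕ → V → ℕ → V
(f [ x ↦ v ]) y = if y ≡ᵇ x then v else f y

setReg : ℕ → ℕ → State → State
setReg x v σ = state (regs σ [ x ↦ v ]) (arrays σ)

setArray : ℕ → ℕ → ℕ → State → State
setArray a i v σ = state (regs σ) (arrays σ [ a ↦ arrays σ a [ i ↦ v ] ])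

eval : Expr → State → ℕ
eval (lit k)   σ = k
eval (reg x)   σ = regs σ x
eval (a [ e ]) σ = arrays σ a (eval e σ)
eval (succ′ e) σ = suc (eval e σ)
eval (pred′ e) σ = pred (eval e σ)

test : Test → State → Bool
test (e ≐ f)  σ = eval e σ ≡ᵇ eval f σ
test (e ≺ f)  σ = eval e σ <ᵇ eval f σ
test (not′ b) σ = not (test b σ)

costᴱ : Expr → ℕ
costᴱ (lit k)   = 1
costᴱ (reg x)   = 1
costᴱ (a [ e ]) = suc (costᴱ e)
costᴱ (succ′ e) = suc (costᴱ e)
costᴱ (pred′ e) = suc (costᴱ e)

costᵀ : Test → ℕ
costᵀ (e ≐ f)  = suc (costᴱ e + costᴱ f)
costᵀ (e ≺ f)  = suc (costᴱ e + costᴱ f)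
costᵀ (not′ b) = suc (costᵀ b)

-- Run p σ t σ′: started in σ, the program p halts in σ′ after time t.
data Run : Program → State → ℕ → State → Set where
  run-skip   : ∀ {σ} → Run skip σ 1 σ
  run-≔      : ∀ {x e σ} →
               Run (x ≔ e) σ (suc (costᴱ e)) (setReg x (eval e σ) σ)
  run-[]≔    : ∀ {a e f σ} →
               Run (a [ e ]≔ f) σ (suc (costᴱ e + costᴱ f))
                   (setArray a (eval e σ) (eval f σ) σ)
  run-⨟      : ∀ {p₁ p₂ σ₁ σ₂ σ₃ t₁ t₂} →
               Run p₁ σ₁ t₁ σ₂ → Run p₂ σ₂ t₂ σ₃ →
               Run (p₁ ⨟ p₂) σ₁ (t₁ + t₂) σ₃
  run-then   : ∀ {b p₁ p₂ σ σ′ t} → test b σ ≡ true → Run p₁ σ t σ′ →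
               Run (if′ b then p₁ else p₂) σ (suc (costᵀ b + t)) σ′
  run-else   : ∀ {b p₁ p₂ σ σ′ t} → test b σ ≡ false → Run p₂ σ t σ′ →
               Run (if′ b then p₁ else p₂) σ (suc (costᵀ b + t)) σ′
  run-exit   : ∀ {b p σ} → test b σ ≡ false →
               Run (while b loop p) σ (suc (costᵀ b)) σ
  run-repeat : ∀ {b p σ₁ σ₂ σ₃ t₁ t₂} → test b σ₁ ≡ true →
               Run p σ₁ t₁ σ₂ → Run (while b loop p) σ₂ t₂ σ₃ →
               Run (while b loop p) σ₁ (suc (costᵀ b + (t₁ + t₂))) σ₃

nth : List ℕ → ℕ → ℕ
nth []       i       = 0
nth (k ∷ ks) zero    = k
nth (k ∷ ks) (suc i) = nth ks i

-- The input word occupies an initial segment of array 0; the output word is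
-- read off an initial segment of array 1.
initial : List ℕ → State
initial w = state (λ _ → 0) ((λ _ _ → 0) [ 0 ↦ nth w ])

Outputs : State → List ℕ → Set
Outputs σ v = ∀ (i : Fin (length v)) → arrays σ 1 (toℕ i) ≡ lookup v i

------------------------------------------------------------------------
-- Words encoding sets of rules

module _ {n : ℕ} where

  -- A rule (A , q) is written as q, |A|, followed by the elements of A in an
  -- arbitrary order.
  data EncodesRules : List (Rule n) → List ℕ → Set where
    []  : EncodesRules [] []
    add : ∀ {A q xs R w} → Enumerates xs (_∈ A) → EncodesRules R w →
          EncodesRules ((A , q) ∷ R)
                       (toℕ q ∷ length xs ∷ map toℕ xs ++ w)

  -- The number of rules comes first, which makes words self-delimiting.
  data Encodes (R : List (Rule n)) : List ℕ → Set where
    encodes : ∀ {w} → EncodesRules R w → Encodes R (length R ∷ w)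

  -- Started on |Q| followed by a word for R, the program p halts within time
  -- b having written a word for a set of rules satisfying P.
  record ComputesWithin (p : Program) (R : List (Rule n)) (w : List ℕ)
                        (P : Pred (Rule n) 0ℓ) (b : ℕ) : Set where
    constructor computes
    field
      {final}    : State
      {time}     : ℕ
      {rules}    : List (Rule n)
      {word}     : List ℕ
      run        : Run p (initial (n ∷ w)) time final
      in-time    : time ≤ b
      outputs    : Outputs final word
      word-code  : Encodes rules word
      enumerates : Enumerates rules P

{-# OPTIONS --safe #-}
module Submission where

-- For a rule (B , q) of R with q ∉ B let T = τ(B), and let A be the set of
-- extreme points of T, that is, of all s ∈ B with s ∉ τ(T - s).  The rule (A , q)
-- is critical iff A ⊆ C for all rules (C , q) of R with q ∉ C ⊆ T, and every
-- critical rule arises in this way.  Since then τ(A) = τ(C) = T, it is listed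
-- exactly once if it is taken only from the first of these (C , q).
-- Forward chaining finds T, A and the rules with C ⊆ T in linear time: x leaves
-- the closure as soon as x ∉ B and every rule (C , x) with x ∉ C has lost an
-- element of C, so it suffices to count the intact rules of each head and to run
-- through the occurrences of each removed element.  Testing A ⊆ C for all C takes
-- one more linear scan for each s ∈ B, and these sets B have total size at most
-- the input size.

open import Defs
open import Data.Bool using (Bool; true; false; not; if_then_else_; _∧_; _∨_)
open import Data.Bool.Properties using (∧-conicalˡ; ∧-conicalʳ; ∨-conicalˡ; ∨-conicalʳ)
open import Data.Empty using (⊥-elim)
open import Data.Fin as Fin using (Fin; zero; suc; toℕ; fromℕ<)
import Data.Fin.Properties as Fin
open import Data.Fin.Subset
  using (Subset; outside; _∈_; _∉_; _⊆_; _∩_; _∪_; _─_; _-_; ∁; ⊥; ⁅_⁆; ∣_∣; Nonempty)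
open import Data.Fin.Subset.Properties
open import Data.List using (List; []; _∷_; _++_; length; lookup; map)
import Data.List.Membership.Propositional as List
import Data.List.Membership.Propositional.Properties as List
import Data.List.Properties as List
open import Data.List.Relation.Unary.All as All using (All; []; _∷_)
open import Data.List.Relation.Unary.AllPairs using ([]; _∷_)
open import Data.List.Relation.Unary.Any using (here; there; index)
import Data.List.Relation.Unary.Any.Properties as Any
open import Data.List.Relation.Unary.Unique.Propositional using (Unique)
import Data.List.Relation.Unary.Unique.Propositional.Properties as Unique
open import Data.Nat hiding (∣_-_∣)
open import Data.Nat.Properties
open import Data.Nat.Tactic.RingSolver using (solve-∀)
open import Data.Product using (_×_; _,_; proj₁; proj₂; ∃-syntax)
open import Data.Sum using (_⊎_; inj₁; inj₂)
open import Data.Unit using (⊤; tt)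
open import Data.Vec using (_∷_; here; there; tabulate)
import Data.Vec.Properties as Vec
open import Function.Bundles using (mk⇔; module Equivalence)
open import Level using (0ℓ)
open import Relation.Binary using (tri<; tri≈; tri>)
open import Relation.Binary.PropositionalEquality hiding ([_])
open import Relation.Nullary using (¬_; yes; no; does; proof; Reflects; ofʸ; ofⁿ)
open import Relation.Nullary.Decidable using (dec-true; ¬?; _×-dec_; _→-dec_; decidable-stable)
open import Relation.Unary using (Pred; Decidable)

-- Loop programs and their cost

-- Two obstacles shape the development. The ground set may be far larger than the input, so no loop
-- may run over all of it: tables are cleared, and described by invariants, only at elements that
-- occur in some rule. Moreover, forward chaining is linear only in the amortised sense, whereas a
-- run of the machine needs an explicit cost. The search is therefore cut into steps of constant
-- cost, and counting loops execute a fixed number of them, twice the number of cells plus the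
-- number of rules. A potential argument shows that the search is over by then; surplus steps idle.
-- Since the loops of `main` are bounded by two registers that never change, its cost is read off
-- the syntax: loop nests of depth two give the square. The combinatorial arguments rest on one
-- fact, `no-entry`: a feasible set avoids `T` if each of its elements in `T` is the head of a rule
-- with head outside and body inside `T`-style support, that is, of a rule `Valid` for `T`. It
-- yields the leastness of the closure, its generation by extreme points, and the completeness of
-- the search.

infixr 4 _,,_
infix  5 _:=_ _[_]:=_

data Code : Set where
  nop     : Code
  _:=_    : ℕ → Expr → Code
  _[_]:=_ : ℕ → Expr → Expr → Code
  _,,_    : Code → Code → Code
  cond    : Test → Code → Code → Code
  for     : ℕ → ℕ → Code → Code

compile : Code → Program
compile nop           = skip
compile (x := e)      = x ≔ e
compile (a [ e ]:= f) = a [ e ]≔ f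
compile (c ,, d)      = compile c ⨟ compile d
compile (cond b c d)  = if′ b then compile c else compile d
compile (for k b c)   =
  (k ≔ lit 0) ⨟ (while reg k ≺ reg b loop (compile c ⨟ k ≔ succ′ (reg k)))

iter : (State → State) → ℕ → State → State
iter f zero    σ = σ
iter f (suc r) σ = iter f r (f σ)

-- The 4 is one evaluation of the loop test, which is due once more on exit; the 3 is the increment
-- of the counter.
iterCost : (State → State) → (State → ℕ) → ℕ → State → ℕ
iterCost f g zero    σ = 4
iterCost f g (suc r) σ = 4 + ((g σ + 3) + iterCost f g r (f σ))

⟦_⟧  : Code → State → State
next : ℕ → Code → State → State

⟦ nop ⟧         σ = σ
⟦ x := e ⟧      σ = setReg x (eval e σ) σ
⟦ a [ e ]:= f ⟧ σ = setArray a (eval e σ) (eval f σ) σ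
⟦ c ,, d ⟧      σ = ⟦ d ⟧ (⟦ c ⟧ σ)
⟦ cond b c d ⟧  σ = if test b σ then ⟦ c ⟧ σ else ⟦ d ⟧ σ
⟦ for k b c ⟧   σ = iter (next k c) (regs σ b) (setReg k 0 σ)

next k c σ = setReg k (suc (regs σ k)) (⟦ c ⟧ σ)

cost : Code → State → ℕ
cost nop           σ = 1
cost (x := e)      σ = suc (costᴱ e)
cost (a [ e ]:= f) σ = suc (costᴱ e + costᴱ f)
cost (c ,, d)      σ = cost c σ + cost d (⟦ c ⟧ σ)
cost (cond b c d)  σ = suc (costᵀ b + (if test b σ then cost c σ else cost d σ))
cost (for k b c)   σ = 2 + iterCost (next k c) (cost c) (regs σ b) (setReg k 0 σ)

writesR : ℕ → Code → Bool
writesR r nop           = false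
writesR r (x := e)      = r ≡ᵇ x
writesR r (a [ e ]:= f) = false
writesR r (c ,, d)      = writesR r c ∨ writesR r d
writesR r (cond b c d)  = writesR r c ∨ writesR r d
writesR r (for k b c)   = (r ≡ᵇ k) ∨ writesR r c

writesA : ℕ → Code → Bool
writesA a nop            = false
writesA a (x := e)       = false
writesA a (a′ [ e ]:= f) = a ≡ᵇ a′
writesA a (c ,, d)       = writesA a c ∨ writesA a d
writesA a (cond b c d)   = writesA a c ∨ writesA a d
writesA a (for k b c)    = writesA a c

iter-frame : ∀ {V : Set} (v : State → V) f → (∀ τ → v (f τ) ≡ v τ) → ∀ r σ → v (iter f r σ) ≡ v σ
iter-frame v f p zero    σ = refl
iter-frame v f p (suc r) σ = trans (iter-frame v f p r (f σ)) (p σ)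

frameR : ∀ c r → writesR r c ≡ false → ∀ σ → regs (⟦ c ⟧ σ) r ≡ regs σ r
frameR nop r w σ = refl
frameR (x := e) r w σ rewrite w = refl
frameR (a [ e ]:= f) r w σ = refl
frameR (c ,, d) r w σ =
  trans (frameR d r (∨-conicalʳ (writesR r c) _ w) (⟦ c ⟧ σ))
        (frameR c r (∨-conicalˡ _ (writesR r d) w) σ)
frameR (cond b c d) r w σ with test b σ
... | true  = frameR c r (∨-conicalˡ _ (writesR r d) w) σ
... | false = frameR d r (∨-conicalʳ (writesR r c) _ w) σ
frameR (for k b c) r w σ = trans (iter-frame (λ τ → regs τ r) (next k c) each (regs σ b) _) (other σ)
  where
  r≠k = ∨-conicalˡ (r ≡ᵇ k) (writesR r c) w
  other : ∀ τ {v} → regs (setReg k v τ) r ≡ regs τ r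
  other τ rewrite r≠k = refl
  each : ∀ τ → regs (next k c τ) r ≡ regs τ r
  each τ = trans (other (⟦ c ⟧ τ)) (frameR c r (∨-conicalʳ (r ≡ᵇ k) _ w) τ)

frameA : ∀ c a → writesA a c ≡ false → ∀ σ → arrays (⟦ c ⟧ σ) a ≡ arrays σ a
frameA nop a w σ = refl
frameA (x := e) a w σ = refl
frameA (a′ [ e ]:= f) a w σ rewrite w = refl
frameA (c ,, d) a w σ =
  trans (frameA d a (∨-conicalʳ (writesA a c) _ w) (⟦ c ⟧ σ))
        (frameA c a (∨-conicalˡ _ (writesA a d) w) σ)
frameA (cond b c d) a w σ with test b σ
... | true  = frameA c a (∨-conicalˡ _ (writesA a d) w) σ
... | false = frameA d a (∨-conicalʳ (writesA a c) _ w) σ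
frameA (for k b c) a w σ = iter-frame (λ τ → arrays τ a) (next k c) (frameA c a w) (regs σ b) _

-- The compiled `while` loop compares counter and bound afresh in every round, whereas `⟦_⟧` fixes
-- the number of rounds on entry. The two agree if the body writes neither register and the
-- registers differ.
safe : Code → Bool
safe nop           = true
safe (x := e)      = true
safe (a [ e ]:= f) = true
safe (c ,, d)      = safe c ∧ safe d
safe (cond b c d)  = safe c ∧ safe d
safe (for k b c)   = not ((b ≡ᵇ k) ∨ (writesR b c ∨ writesR k c)) ∧ safe c

≡ᵇ-refl : ∀ x → (x ≡ᵇ x) ≡ true
≡ᵇ-refl zero    = refl
≡ᵇ-refl (suc x) = ≡ᵇ-refl x

<ᵇ-suc : ∀ i r → (i <ᵇ i + suc r) ≡ true
<ᵇ-suc zero    r = refl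
<ᵇ-suc (suc i) r = <ᵇ-suc i r

<ᵇ-irrefl : ∀ i → (i <ᵇ i + 0) ≡ false
<ᵇ-irrefl zero    = refl
<ᵇ-irrefl (suc i) = <ᵇ-irrefl i

not-true : ∀ {b} → not b ≡ true → b ≡ false
not-true {false} _ = refl

module _ (k b : ℕ) (c : Code) (b≠k : (b ≡ᵇ k) ≡ false) (wb : writesR b c ≡ false) where

  next-bound : ∀ τ → regs (next k c τ) b ≡ regs τ b
  next-bound τ rewrite b≠k = frameR c b wb τ

  next-counter : ∀ τ → regs (next k c τ) k ≡ suc (regs τ k)
  next-counter τ rewrite ≡ᵇ-refl k = refl

  next-remaining : ∀ {r} τ → regs τ b ≡ regs τ k + suc r →
                   regs (next k c τ) b ≡ regs (next k c τ) k + r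
  next-remaining {r} τ e rewrite next-bound τ | next-counter τ = trans e (+-suc _ r)

  -- Here `r` is the number of rounds still to come. Keeping bound = counter + `r` shows that the
  -- counter is below the bound in each round and equal to it at the end.
  iter-inv : (I : State → Set) →
             (∀ τ → regs τ k < regs τ b → I τ → I (next k c τ)) →
             ∀ r τ → regs τ b ≡ regs τ k + r → I τ →
             let σ′ = iter (next k c) r τ in I σ′ × regs σ′ k ≡ regs σ′ b
  iter-inv I s zero    τ e i = i , sym (trans e (+-identityʳ _))
  iter-inv I s (suc r) τ e i =
    iter-inv I s r (next k c τ) (next-remaining τ e)
      (s τ (subst (regs τ k <_) (sym e) (m<m+n (regs τ k) (s≤s z≤n))) i)

  for-start : ∀ σ → regs (setReg k 0 σ) b ≡ regs (setReg k 0 σ) k + regs σ b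
  for-start σ rewrite b≠k | ≡ᵇ-refl k = refl

  for-inv : (I : State → Set) →
            (∀ τ → regs τ k < regs τ b → I τ → I (next k c τ)) →
            ∀ σ → I (setReg k 0 σ) →
            let σ′ = ⟦ for k b c ⟧ σ in I σ′ × regs σ′ k ≡ regs σ′ b
  for-inv I s σ i = iter-inv I s (regs σ b) (setReg k 0 σ) (for-start σ) i

run : ∀ c → safe c ≡ true → ∀ σ → Run (compile c) σ (cost c σ) (⟦ c ⟧ σ)
run nop s σ = run-skip
run (x := e) s σ = run-≔
run (a [ e ]:= f) s σ = run-[]≔
run (c ,, d) s σ =
  run-⨟ (run c (∧-conicalˡ _ (safe d) s) σ) (run d (∧-conicalʳ (safe c) _ s) (⟦ c ⟧ σ))
run (cond b c d) s σ with test b σ in eq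
... | true  = run-then eq (run c (∧-conicalˡ _ (safe d) s) σ)
... | false = run-else eq (run d (∧-conicalʳ (safe c) _ s) σ)
run (for k b c) s σ = run-⨟ run-≔ (loops (regs σ b) (setReg k 0 σ) (for-start k b c b≠k wb σ))
  where
  g   = not-true (∧-conicalˡ _ (safe c) s)
  b≠k = ∨-conicalˡ (b ≡ᵇ k) _ g
  g′  = ∨-conicalʳ (b ≡ᵇ k) _ g
  wb  = ∨-conicalˡ (writesR b c) (writesR k c) g′
  wk  = ∨-conicalʳ (writesR b c) (writesR k c) g′
  once : ∀ τ → Run (compile c ⨟ k ≔ succ′ (reg k)) τ (cost c τ + 3) (next k c τ)
  once τ = run-⨟ (run c (∧-conicalʳ (not ((b ≡ᵇ k) ∨ (writesR b c ∨ writesR k c))) _ s) τ)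
    -- `next` increments the value that `k` has before the body, the program the value after it;
    -- they coincide because the body does not write `k`.
    (subst (λ v → Run (k ≔ succ′ (reg k)) (⟦ c ⟧ τ) 3 (setReg k (suc v) (⟦ c ⟧ τ)))
           (frameR c k wk τ) run-≔)
  loops : ∀ r τ → regs τ b ≡ regs τ k + r →
          Run (while reg k ≺ reg b loop (compile c ⨟ k ≔ succ′ (reg k))) τ
              (iterCost (next k c) (cost c) r τ) (iter (next k c) r τ)
  loops zero τ e = run-exit (trans (cong (regs τ k <ᵇ_) e) (<ᵇ-irrefl (regs τ k)))
  loops (suc r) τ e = run-repeat (trans (cong (regs τ k <ᵇ_) e) (<ᵇ-suc (regs τ k) r))
    (once τ) (loops r (next k c τ) (next-remaining k b c b≠k wb τ e))

-- Weakest preconditions and loop invariants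

Holds : Test → State → Set
Holds (e ≐ f)  σ = eval e σ ≡ eval f σ
Holds (e ≺ f)  σ = eval e σ < eval f σ
Holds (not′ b) σ = ¬ Holds b σ

holds? : ∀ b σ → Reflects (Holds b σ) (test b σ)
holds? (e ≐ f)  σ = proof (eval e σ ≟ eval f σ)
holds? (e ≺ f)  σ = proof (eval e σ <? eval f σ)
holds? (not′ b) σ with test b σ | holds? b σ
... | true  | ofʸ h = ofⁿ (λ ¬h → ¬h h)
... | false | ofⁿ h = ofʸ h

-- A conditional becomes a pair of implications, so a proof about straight-line code has the shape
-- of its decision tree. Loops are left unexpanded; `for-wp` treats them by an invariant.
wp : Code → (State → Set) → State → Set
wp nop           P σ = P σ
wp (x := e)      P σ = P (setReg x (eval e σ) σ)
wp (a [ e ]:= f) P σ = P (setArray a (eval e σ) (eval f σ) σ)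
wp (c ,, d)      P σ = wp c (wp d P) σ
wp (cond b c d)  P σ = (Holds b σ → wp c P σ) × (¬ Holds b σ → wp d P σ)
wp (for k b c)   P σ = P (⟦ for k b c ⟧ σ)

wp-sound : ∀ c P σ → wp c P σ → P (⟦ c ⟧ σ)
wp-sound nop P σ p = p
wp-sound (x := e) P σ p = p
wp-sound (a [ e ]:= f) P σ p = p
wp-sound (c ,, d) P σ p = wp-sound d P (⟦ c ⟧ σ) (wp-sound c (wp d P) σ p)
wp-sound (cond b c d) P σ (p , q) with test b σ | holds? b σ
... | true  | ofʸ h = wp-sound c P σ (p h)
... | false | ofⁿ h = wp-sound d P σ (q h)
wp-sound (for k b c) P σ p = p

for-wp : ∀ k b c (I : State → Set) → (b ≡ᵇ k) ≡ false → writesR b c ≡ false →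
         (∀ τ → regs τ k < regs τ b → I τ → wp c (λ s → I (setReg k (suc (regs τ k)) s)) τ) →
         ∀ σ → I (setReg k 0 σ) →
         let σ′ = ⟦ for k b c ⟧ σ in I σ′ × regs σ′ k ≡ regs σ′ b
for-wp k b c I b≠k wb s = for-inv k b c b≠k wb I
  (λ τ lt i → wp-sound c (λ s → I (setReg k (suc (regs τ k)) s)) τ (s τ lt i))

-- Polynomial cost bounds from loop depth

degree coeff : Code → ℕ
degree nop           = 0
degree (x := e)      = 0
degree (a [ e ]:= f) = 0
degree (c ,, d)      = degree c ⊔ degree d
degree (cond b c d)  = degree c ⊔ degree d
degree (for k b c)   = suc (degree c)

coeff nop           = 1
coeff (x := e)      = suc (costᴱ e)
coeff (a [ e ]:= f) = suc (costᴱ e + costᴱ f)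
coeff (c ,, d)      = coeff c + coeff d
coeff (cond b c d)  = suc (costᵀ b) + (coeff c + coeff d)
-- 13 = 6 + 7: resetting the counter and the final test cost 2 + 4, and each round costs 4 + 3
-- besides its body.
coeff (for k b c)   = 13 + coeff c

-- Registers 0 and 1 will be `nRules` and `nCells`, both at most the input size, so each loop of a
-- uniform code contributes one factor of that size.
uniform : Code → Bool
uniform nop           = true
uniform (x := e)      = true
uniform (a [ e ]:= f) = true
uniform (c ,, d)      = uniform c ∧ uniform d
uniform (cond b c d)  = uniform c ∧ uniform d
uniform (for k b c)   = (b <ᵇ 2) ∧ uniform c

module _ (s : ℕ) where

  1≤pow : ∀ d → 1 ≤ suc s ^ d
  1≤pow d = m^n>0 (suc s) d

  const-pow : ∀ a d → a ≤ a * suc s ^ d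
  const-pow a d = ≤-trans (≤-reflexive (sym (*-identityʳ a))) (*-monoʳ-≤ a (1≤pow d))

  max-powˡ : ∀ a d e → a * suc s ^ d ≤ a * suc s ^ (d ⊔ e)
  max-powˡ a d e = *-monoʳ-≤ a (^-monoʳ-≤ (suc s) (m≤m⊔n d e))

  max-powʳ : ∀ a d e → a * suc s ^ e ≤ a * suc s ^ (d ⊔ e)
  max-powʳ a d e = *-monoʳ-≤ a (^-monoʳ-≤ (suc s) (m≤n⊔m d e))

  -- Registers 0 and 1 keep their values, so every loop, at whatever depth, has at most `s` rounds.
  -- The powers are those of `suc s` rather than of `s`, hence at least 1, and absorb all additive
  -- constants.
  cost-bound : ∀ c → uniform c ≡ true → writesR 0 c ≡ false → writesR 1 c ≡ false →
               ∀ σ → regs σ 0 ≤ s → regs σ 1 ≤ s → cost c σ ≤ coeff c * suc s ^ degree c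
  cost-bound nop u w0 w1 σ b0 b1 = ≤-refl
  cost-bound (x := e) u w0 w1 σ b0 b1 = const-pow _ 0
  cost-bound (a [ e ]:= f) u w0 w1 σ b0 b1 = const-pow _ 0
  cost-bound (c ,, d) u w0 w1 σ b0 b1 = begin
    cost c σ + cost d (⟦ c ⟧ σ)
      ≤⟨ +-mono-≤ (cost-bound c (∧-conicalˡ _ (uniform d) u) l0 l1 σ b0 b1)
                  (cost-bound d (∧-conicalʳ (uniform c) _ u)
                    (∨-conicalʳ (writesR 0 c) _ w0) (∨-conicalʳ (writesR 1 c) _ w1) (⟦ c ⟧ σ)
                    (≤-trans (≤-reflexive (frameR c 0 l0 σ)) b0)
                    (≤-trans (≤-reflexive (frameR c 1 l1 σ)) b1)) ⟩
    coeff c * suc s ^ degree c + coeff d * suc s ^ degree d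
      ≤⟨ +-mono-≤ (max-powˡ (coeff c) (degree c) (degree d)) (max-powʳ (coeff d) (degree c) (degree d)) ⟩
    coeff c * suc s ^ (degree c ⊔ degree d) + coeff d * suc s ^ (degree c ⊔ degree d)
      ≡⟨ sym (*-distribʳ-+ (suc s ^ (degree c ⊔ degree d)) (coeff c) (coeff d)) ⟩
    (coeff c + coeff d) * suc s ^ (degree c ⊔ degree d) ∎
    where
    open ≤-Reasoning
    l0 = ∨-conicalˡ _ (writesR 0 d) w0
    l1 = ∨-conicalˡ _ (writesR 1 d) w1
  cost-bound (cond b c d) u w0 w1 σ b0 b1 = begin
    suc (costᵀ b) + (if test b σ then cost c σ else cost d σ)
      ≤⟨ +-mono-≤ (const-pow (suc (costᵀ b)) D) branch ⟩
    suc (costᵀ b) * suc s ^ D + (coeff c + coeff d) * suc s ^ D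
      ≡⟨ sym (*-distribʳ-+ (suc s ^ D) (suc (costᵀ b)) (coeff c + coeff d)) ⟩
    coeff (cond b c d) * suc s ^ D ∎
    where
    open ≤-Reasoning
    D = degree c ⊔ degree d
    branch : (if test b σ then cost c σ else cost d σ) ≤ (coeff c + coeff d) * suc s ^ D
    branch with test b σ
    ... | true  = ≤-trans (cost-bound c (∧-conicalˡ _ (uniform d) u)
                            (∨-conicalˡ _ (writesR 0 d) w0) (∨-conicalˡ _ (writesR 1 d) w1) σ b0 b1)
                    (≤-trans (max-powˡ (coeff c) (degree c) (degree d))
                      (*-monoˡ-≤ (suc s ^ D) (m≤m+n (coeff c) (coeff d))))
    ... | false = ≤-trans (cost-bound d (∧-conicalʳ (uniform c) _ u)
                            (∨-conicalʳ (writesR 0 c) _ w0) (∨-conicalʳ (writesR 1 c) _ w1) σ b0 b1)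
                    (≤-trans (max-powʳ (coeff d) (degree c) (degree d))
                      (*-monoˡ-≤ (suc s ^ D) (m≤n+m (coeff d) (coeff c))))
  cost-bound (for k b c) u w0 w1 σ b0 b1 = begin
    2 + iterCost (next k c) (cost c) (regs σ b) (setReg k 0 σ)
      ≤⟨ +-monoʳ-≤ 2 (iterated (regs σ b) (setReg k 0 σ) (kept 0 w0 {τ = σ} b0) (kept 1 w1 {τ = σ} b1)) ⟩
    2 + (4 + regs σ b * (7 + Z))
      ≤⟨ +-monoʳ-≤ 6 (*-monoˡ-≤ (7 + Z) (bound b (∧-conicalˡ (b <ᵇ 2) _ u))) ⟩
    6 + s * (7 + Z)
      ≤⟨ +-mono-≤ (const-pow 6 (suc (degree c))) (*-monoʳ-≤ s (+-monoˡ-≤ Z (const-pow 7 (degree c)))) ⟩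
    6 * (suc s * P) + s * (7 * P + coeff c * P)
      -- One more round is added as slack, which makes every term a multiple of `suc s * P`.
      ≤⟨ m≤m+n _ _ ⟩
    6 * (suc s * P) + s * (7 * P + coeff c * P) + (7 * P + coeff c * P)
      ≡⟨ regroup s P (coeff c) ⟩
    (13 + coeff c) * (suc s * P) ∎
    where
    open ≤-Reasoning
    P = suc s ^ degree c
    Z = coeff c * P
    regroup : ∀ s P x → 6 * (suc s * P) + s * (7 * P + x * P) + (7 * P + x * P) ≡ (13 + x) * (suc s * P)
    regroup = solve-∀
    kept : ∀ r → (r ≡ᵇ k) ∨ writesR r c ≡ false → ∀ {v τ} → regs τ r ≤ s → regs (setReg k v τ) r ≤ s
    kept r w le rewrite ∨-conicalˡ (r ≡ᵇ k) _ w = le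
    bound : ∀ b → (b <ᵇ 2) ≡ true → regs σ b ≤ s
    bound 0 _ = b0
    bound 1 _ = b1
    iterated : ∀ r τ → regs τ 0 ≤ s → regs τ 1 ≤ s →
               iterCost (next k c) (cost c) r τ ≤ 4 + r * (7 + Z)
    iterated zero τ e0 e1 = ≤-refl
    iterated (suc r) τ e0 e1 = begin
      4 + ((cost c τ + 3) + iterCost (next k c) (cost c) r (next k c τ))
        ≤⟨ +-monoʳ-≤ 4 (+-mono-≤ (+-monoˡ-≤ 3 (cost-bound c (∧-conicalʳ (b <ᵇ 2) _ u) v0 v1 τ e0 e1))
             (iterated r (next k c τ)
               (kept 0 w0 {τ = ⟦ c ⟧ τ} (≤-trans (≤-reflexive (frameR c 0 v0 τ)) e0))
               (kept 1 w1 {τ = ⟦ c ⟧ τ} (≤-trans (≤-reflexive (frameR c 1 v1 τ)) e1)))) ⟩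
      4 + ((Z + 3) + (4 + r * (7 + Z)))
        ≡⟨ regroup₂ Z r ⟩
      4 + (suc r * (7 + Z)) ∎
      where
      v0 = ∨-conicalʳ (0 ≡ᵇ k) _ w0
      v1 = ∨-conicalʳ (1 ≡ᵇ k) _ w1
      regroup₂ : ∀ Z r → 4 + ((Z + 3) + (4 + r * (7 + Z))) ≡ 4 + (suc r * (7 + Z))
      regroup₂ = solve-∀

-- Case analysis on updated entries

upd : ∀ {V : Set} (P : V → Set) (f : ℕ → V) x {v} y → (y ≡ x → P v) → (y ≢ x → P (f y)) → P ((f [ x ↦ v ]) y)
upd P f x y p q with y ≡ᵇ x | proof (y ≟ x)
... | true  | ofʸ e = p e
... | false | ofⁿ e = q e

upd-eq : ∀ {V : Set} (f : ℕ → V) {x v y} → y ≡ x → (f [ x ↦ v ]) y ≡ v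
upd-eq f {x} {v} {y} e = upd (_≡ v) f x y (λ _ → refl) (λ n → ⊥-elim (n e))

upd-neq : ∀ {V : Set} (f : ℕ → V) {x v y} → y ≢ x → (f [ x ↦ v ]) y ≡ f y
upd-neq f {x} {v} {y} n = upd (_≡ f y) f x y (λ e → ⊥-elim (n e)) (λ _ → refl)

-- Finite sums

Σ< : ℕ → (ℕ → ℕ) → ℕ
Σ< zero    f = 0
Σ< (suc b) f = f b + Σ< b f

Σ<-cong : ∀ b {f g} → (∀ {j} → j < b → f j ≡ g j) → Σ< b f ≡ Σ< b g
Σ<-cong zero    e = refl
Σ<-cong (suc b) e = cong₂ _+_ (e (n<1+n b)) (Σ<-cong b (λ lt → e (m<n⇒m<1+n lt)))

Σ<-+ : ∀ b f g → Σ< b (λ j → f j + g j) ≡ Σ< b f + Σ< b g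
Σ<-+ zero    f g = refl
Σ<-+ (suc b) f g = trans (cong (f b + g b +_) (Σ<-+ b f g)) (regroup (f b) (g b) _ _)
  where
  regroup : ∀ a b c d → (a + b) + (c + d) ≡ (a + c) + (b + d)
  regroup = solve-∀

Σ<-≤ : ∀ b {f} → (∀ j → f j ≤ 1) → Σ< b f ≤ b
Σ<-≤ zero    le = z≤n
Σ<-≤ (suc b) le = +-mono-≤ (le b) (Σ<-≤ b le)

Σ<-pick : ∀ b {f j} → j < b → f j ≤ Σ< b f
Σ<-pick (suc b) {f} {j} lt with j ≟ b
... | yes refl = m≤m+n (f b) _
... | no j≢b   = ≤-trans (Σ<-pick b (≤∧≢⇒< (≤-pred lt) j≢b)) (m≤n+m _ (f b))

Σ<-zero : ∀ b {f} → (∀ {j} → j < b → f j ≡ 0) → Σ< b f ≡ 0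
Σ<-zero zero    e = refl
Σ<-zero (suc b) e = cong₂ _+_ (e (n<1+n b)) (Σ<-zero b (λ lt → e (m<n⇒m<1+n lt)))

Σ<-drop : ∀ b {f g i} → i < b → f i ≡ suc (g i) → (∀ {j} → j < b → j ≢ i → f j ≡ g j) →
          Σ< b f ≡ suc (Σ< b g)
Σ<-drop (suc b) {f} {g} {i} lt e same with i ≟ b
... | yes refl = cong₂ _+_ e (Σ<-cong b (λ lt′ → same (m<n⇒m<1+n lt′) (<⇒≢ lt′)))
... | no i≢b   = trans (cong₂ _+_ (same (n<1+n b) (λ e′ → i≢b (sym e′)))
                          (Σ<-drop b (≤∧≢⇒< (≤-pred lt) i≢b) e (λ lt′ → same (m<n⇒m<1+n lt′))))
                       (+-suc (g b) _)

δ : ℕ → ℕ → ℕ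
δ a b = if a ≡ᵇ b then 1 else 0

δ-yes : ∀ {a b} → a ≡ b → δ a b ≡ 1
δ-yes {a} {b} e with a ≡ᵇ b | proof (a ≟ b)
... | true  | _      = refl
... | false | ofⁿ ne = ⊥-elim (ne e)

δ-no : ∀ {a b} → a ≢ b → δ a b ≡ 0
δ-no {a} {b} ne with a ≡ᵇ b | proof (a ≟ b)
... | true  | ofʸ e = ⊥-elim (ne e)
... | false | _     = refl

-- Pointers are shifted by one, with 0 as the null pointer: v points to the last
-- k below b with e k ≡ x.
Latest : (ℕ → ℕ) → ℕ → ℕ → ℕ → Set
Latest e x b v = (∀ {k} → k < b → e k ≡ x → k < v) × v ≤ b × (v ≢ 0 → e (pred v) ≡ x)

-- No entry from `v` up to `b` equals `x`, so these summands vanish. Hence the count below a pointer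
-- is the length of the chain that remains to be followed.
latest-count : ∀ {e x b v} → Latest e x b v → Σ< b (λ k → δ (e k) x) ≡ Σ< v (λ k → δ (e k) x)
latest-count {e} {x} {b} {v} (last , v≤b , _) = go b v≤b last
  where
  go : ∀ b → v ≤ b → (∀ {k} → k < b → e k ≡ x → k < v) → Σ< b (λ k → δ (e k) x) ≡ Σ< v (λ k → δ (e k) x)
  go b v≤b last with v ≟ b
  ... | yes refl = refl
  go zero z≤n last | no v≢b = ⊥-elim (v≢b refl)
  go (suc b) v≤b last | no v≢b =
    trans (cong (_+ Σ< b (λ k → δ (e k) x)) (δ-no (λ eq → <⇒≱ (last (n<1+n b) eq) v≤b′)))
          (go b v≤b′ (λ lt → last (m<n⇒m<1+n lt)))
    where v≤b′ = ≤-pred (≤∧≢⇒< v≤b v≢b)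

-- Forward chaining

-- The pairs of a rule and an element of its body are called cells: cell k
-- belongs to rule ownᵃ[k] and holds the element elemᵃ[k].  Registers carry the
-- superscript ʳ, arrays the superscript ᵃ.
nRules nCells jʳ kʳ iʳ frontʳ backʳ ptrʳ eltʳ cellʳ ruleʳ newʳ : ℕ
nRules = 0
nCells = 1
jʳ     = 2
kʳ     = 3
iʳ     = 4
frontʳ = 5
backʳ  = 6
ptrʳ   = 7
eltʳ   = 8
cellʳ  = 9
ruleʳ  = 10
newʳ   = 11

-- For rule iʳ, closure computes in hitᵃ which rules (C , q) have q ∈ C or
-- C ⊈ τ(B), where B is the body of iʳ, and in cntᵃ how many of the other rules
-- have a given head.  The cells holding the same element are chained through
-- prevᵃ, starting at lastᵃ.  An entry of addedᵃ is 1 once the element has left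
-- the closure and waits in the queue, 2 once it is popped.
inputᵃ outputᵃ headᵃ elemᵃ ownᵃ lastᵃ prevᵃ inᵃ cntᵃ hitᵃ addedᵃ queueᵃ : ℕ
inputᵃ  = 0
outputᵃ = 1
headᵃ   = 2
elemᵃ   = 3
ownᵃ    = 4
lastᵃ   = 5
prevᵃ   = 6
inᵃ     = 7
cntᵃ    = 8
hitᵃ    = 9
addedᵃ  = 10
queueᵃ  = 11

-- It is applied to heads and to elements of bodies only, which keeps the cost independent of the
-- size of the ground set. The invariants accordingly speak of elements satisfying `Occ`.
clear : Expr → Code
clear e = inᵃ [ e ]:= lit 0 ,, cntᵃ [ e ]:= lit 0 ,, addedᵃ [ e ]:= lit 0 ,, lastᵃ [ e ]:= lit 0

clearHead clearCell link markBody markTrivial countHead : Code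
clearHead   = clear (headᵃ [ reg jʳ ]) ,, hitᵃ [ reg jʳ ]:= lit 0
clearCell   = clear (elemᵃ [ reg kʳ ])
link        = prevᵃ [ reg kʳ ]:= lastᵃ [ elemᵃ [ reg kʳ ] ] ,, lastᵃ [ elemᵃ [ reg kʳ ] ]:= succ′ (reg kʳ)
markBody    = cond (ownᵃ [ reg kʳ ] ≐ reg iʳ) (inᵃ [ elemᵃ [ reg kʳ ] ]:= lit 1) nop
markTrivial = cond (elemᵃ [ reg kʳ ] ≐ headᵃ [ ownᵃ [ reg kʳ ] ]) (hitᵃ [ ownᵃ [ reg kʳ ] ]:= lit 1) nop
countHead   = cond (hitᵃ [ reg jʳ ] ≐ lit 0)
                   (cntᵃ [ headᵃ [ reg jʳ ] ]:= succ′ (cntᵃ [ headᵃ [ reg jʳ ] ])) nop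

push seed advance strike pop visit : Code
push    = addedᵃ [ reg newʳ ]:= lit 1 ,, queueᵃ [ reg backʳ ]:= reg newʳ ,, backʳ := succ′ (reg backʳ)
seed    = newʳ := elemᵃ [ reg kʳ ] ,,
          cond (inᵃ [ reg newʳ ] ≐ lit 0)
            (cond (cntᵃ [ reg newʳ ] ≐ lit 0)
              (cond (addedᵃ [ reg newʳ ] ≐ lit 0) push nop) nop) nop
advance = cellʳ := pred′ (reg ptrʳ) ,, ruleʳ := ownᵃ [ reg cellʳ ] ,, ptrʳ := prevᵃ [ reg cellʳ ]
strike  = hitᵃ [ reg ruleʳ ]:= lit 1 ,, newʳ := headᵃ [ reg ruleʳ ] ,,
          cntᵃ [ reg newʳ ]:= pred′ (cntᵃ [ reg newʳ ])
pop     = eltʳ := queueᵃ [ reg frontʳ ] ,, frontʳ := succ′ (reg frontʳ) ,,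
          -- The invariant does not keep queue entries distinct; the test prevents a repeated entry
          -- from starting its chain a second time.
          cond (addedᵃ [ reg eltʳ ] ≐ lit 1)
            (addedᵃ [ reg eltʳ ]:= lit 2 ,, ptrʳ := lastᵃ [ reg eltʳ ]) nop
visit   = advance ,,
          cond (hitᵃ [ reg ruleʳ ] ≐ lit 0)
            (strike ,,
             cond (cntᵃ [ reg newʳ ] ≐ lit 0) (cond (inᵃ [ reg newʳ ] ≐ lit 0) push nop) nop)
            nop

opaque
  -- One step of bounded cost in place of a loop over the queue with a loop over chains inside: a
  -- null pointer asks for the next element of the queue, any other pointer is followed by one link.
  -- When queue and chain are exhausted the step does nothing, so it may safely be executed too
  -- often.
  search : Code
  search = cond (reg ptrʳ ≐ lit 0) (cond (reg frontʳ ≺ reg backʳ) pop nop) visit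

  search-keeps-nRules : writesR nRules search ≡ false
  search-keeps-nRules = refl

  search-keeps-nCells : writesR nCells search ≡ false
  search-keeps-nCells = refl

setup saturate : Code
setup    = for jʳ nRules clearHead ,, for kʳ nCells clearCell ,, for kʳ nCells link ,,
           for kʳ nCells markBody ,, for kʳ nCells markTrivial ,, for jʳ nRules countHead
saturate = (frontʳ := lit 0 ,, backʳ := lit 0 ,, ptrʳ := lit 0) ,,
           for kʳ nCells seed ,, for kʳ nCells (search ,, search) ,, for jʳ nRules search

opaque
  closure : Code
  closure = setup ,, saturate

  closure-def : closure ≡ (setup ,, saturate)
  closure-def = refl

sequence : ∀ c d (P : State → Set) σ → P (⟦ d ⟧ (⟦ c ⟧ σ)) → P (⟦ c ,, d ⟧ σ)
sequence c d P σ p = p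

-- Invariants of the search

Occ : (m N : ℕ) (H E : ℕ → ℕ) → ℕ → Set
Occ m N H E x = (∃[ k ] k < N × E k ≡ x) ⊎ (∃[ j ] j < m × H j ≡ x)

Body : (N i : ℕ) (E O : ℕ → ℕ) → ℕ → Set
Body N i E O x = ∃[ k ] k < N × O k ≡ i × E k ≡ x

isZero : ℕ → ℕ
isZero zero    = 1
isZero (suc _) = 0

isZero≤1 : ∀ v → isZero v ≤ 1
isZero≤1 zero    = ≤-refl
isZero≤1 (suc v) = z≤n

unpopped : ℕ → ℕ
unpopped 2 = 0
unpopped _ = 1

unpopped≤1 : ∀ v → unpopped v ≤ 1
unpopped≤1 0 = ≤-refl
unpopped≤1 1 = ≤-refl
unpopped≤1 2 = z≤n
unpopped≤1 (suc (suc (suc _))) = ≤-refl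

unhit : (H hit : ℕ → ℕ) → ℕ → ℕ → ℕ
unhit H hit x j = δ (H j) x * isZero (hit j)

module _ (S : ℕ → Set) where

  -- `S` stands for lying outside the closure. Soundness of the search uses only `closed`, so the
  -- invariants can be proved on numbers alone, before any antimatroid is in sight.
  record Tables (m N i : ℕ) (H E O : ℕ → ℕ) : Set where
    field
      own<   : ∀ {k} → k < N → O k < m
      closed : ∀ {x} → Occ m N H E x → ¬ Body N i E O x →
               (∀ {j} → j < m → H j ≡ x → (∀ {k} → k < N → O k ≡ j → E k ≢ H j) →
                ∃[ k ] k < N × O k ≡ j × S (E k)) → S x

  record Core (m N i front back ptr elt : ℕ) (H E O last prev inB cnt hit added queue : ℕ → ℕ) : Set where
    field
      tables    : Tables m N i H E O
      prev-ok   : ∀ {k} → k < N → Latest E (E k) k (prev k)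
      last-ok   : ∀ {x} → Occ m N H E x → Latest E x N (last x)
      in⁻       : ∀ {x} → Occ m N H E x → inB x ≢ 0 → Body N i E O x
      in⁺       : ∀ {k} → k < N → O k ≡ i → inB (E k) ≢ 0
      trivial   : ∀ {k} → k < N → E k ≡ H (O k) → hit (O k) ≢ 0
      hit-why   : ∀ {j} → j < m → hit j ≢ 0 → ∃[ k ] k < N × O k ≡ j × (E k ≡ H j ⊎ added (E k) ≢ 0)
      -- Once queue and chain are empty, the first and third alternatives are impossible, which
      -- leaves that every rule with a removed body element has been hit.
      seen      : ∀ {k} → k < N → added (E k) ≢ 0 → added (E k) ≡ 1 ⊎ hit (O k) ≢ 0 ⊎ (E k ≡ elt × k < ptr)
      count     : ∀ {x} → Occ m N H E x → cnt x ≡ Σ< m (unhit H hit x)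
      sound     : ∀ {x} → Occ m N H E x → added x ≢ 0 → inB x ≡ 0 × cnt x ≡ 0 × S x
      queued    : ∀ {k} → k < N → added (E k) ≡ 1 → ∃[ q ] front ≤ q × q < back × queue q ≡ E k
      queue-occ : ∀ {q} → front ≤ q → q < back → Occ m N H E (queue q)
      front≤    : front ≤ back
      ptr≤      : ptr ≤ N
      ptr-elt   : ptr ≢ 0 → E (pred ptr) ≡ elt × added elt ≢ 0

  -- Kept apart from `Core` because it fails temporarily: seeding establishes it cell by cell, and a
  -- strike that brings a count to zero breaks it until the head is pushed.
  record Pending (K : ℕ) (E inB cnt added : ℕ → ℕ) : Set where
    field
      found : ∀ {k} → k < K → inB (E k) ≡ 0 → cnt (E k) ≡ 0 → added (E k) ≢ 0

  -- Each step of the search follows a pointer or pops the queue, so it pays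
  -- one unit of this load unless the search is over.
  load : (m N back ptr elt : ℕ) (E hit added : ℕ → ℕ) → ℕ
  load m N back ptr elt E hit added =
    Σ< ptr (λ k → δ (E k) elt) + (back + (Σ< N (λ k → unpopped (added (E k))) + Σ< m (λ j → isZero (hit j))))

  -- `e` counts the steps made, and `N + N + m` bounds the load after seeding. Putting `front` on
  -- the right lets each pop pay for itself. The chain of a popped element is paid by its cells
  -- ceasing to be unpopped, and a push by the rule that has just been hit.
  record Budget (e m N front back ptr elt : ℕ) (E hit added : ℕ → ℕ) : Set where
    constructor budget
    field
      left : (ptr ≡ 0 × back ≤ front) ⊎ load m N back ptr elt E hit added + e ≤ front + (N + N + m)

  OccOf : State → ℕ → Set
  OccOf σ = Occ (regs σ nRules) (regs σ nCells) (arrays σ headᵃ) (arrays σ elemᵃ)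

  TablesOf : State → Set
  TablesOf σ = Tables (regs σ nRules) (regs σ nCells) (regs σ iʳ) (arrays σ headᵃ) (arrays σ elemᵃ) (arrays σ ownᵃ)

  CoreOf : State → Set
  CoreOf σ = Core (regs σ nRules) (regs σ nCells) (regs σ iʳ) (regs σ frontʳ) (regs σ backʳ) (regs σ ptrʳ) (regs σ eltʳ)
    (arrays σ headᵃ) (arrays σ elemᵃ) (arrays σ ownᵃ) (arrays σ lastᵃ) (arrays σ prevᵃ) (arrays σ inᵃ)
    (arrays σ cntᵃ) (arrays σ hitᵃ) (arrays σ addedᵃ) (arrays σ queueᵃ)

  PendingOf : ℕ → State → Set
  PendingOf K σ = Pending K (arrays σ elemᵃ) (arrays σ inᵃ) (arrays σ cntᵃ) (arrays σ addedᵃ)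

  BudgetOf : ℕ → State → Set
  BudgetOf e σ = Budget e (regs σ nRules) (regs σ nCells) (regs σ frontʳ) (regs σ backʳ) (regs σ ptrʳ) (regs σ eltʳ)
    (arrays σ elemᵃ) (arrays σ hitᵃ) (arrays σ addedᵃ)

  Inv : ℕ → State → Set
  Inv e σ = CoreOf σ × PendingOf (regs σ nCells) σ × BudgetOf e σ

  ≢0-upd : ∀ (f : ℕ → ℕ) {x v y} → v ≢ 0 → f y ≢ 0 → (f [ x ↦ v ]) y ≢ 0
  ≢0-upd f {x} {v} {y} v≢0 fy≢0 = upd (_≢ 0) f x y (λ _ → v≢0) (λ _ → fy≢0)

  upd-same≢0 : ∀ (f : ℕ → ℕ) x {v} → v ≢ 0 → (f [ x ↦ v ]) x ≢ 0
  upd-same≢0 f x {v} v≢0 = upd (_≢ 0) f x {v} x (λ _ → v≢0) (λ ne → ⊥-elim (ne refl))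

  unhit≡0 : ∀ {H hit x j} → H j ≡ x → unhit H hit x j ≡ 0 → hit j ≢ 0
  unhit≡0 {H} {hit} {x} {j} e z h0 rewrite δ-yes e | h0 with z
  ... | ()

  no-unhit : ∀ {m H hit x} → Σ< m (unhit H hit x) ≡ 0 → ∀ {j} → j < m → H j ≡ x → hit j ≢ 0
  no-unhit {m} {H} {hit} {x} z lt e =
    unhit≡0 {H} {hit} e (n≤0⇒n≡0 (≤-trans (Σ<-pick m {unhit H hit x} lt) (≤-reflexive z)))

  -- Count zero means that all rules with head `x` are hit. By `hit-why` a hit rule either contains
  -- its head or has a body element in the queue or already popped, which lies in `S` by `sound`; so
  -- `closed` applies.
  derived : ∀ σ → CoreOf σ → ∀ {x} → OccOf σ x → arrays σ inᵃ x ≡ 0 → arrays σ cntᵃ x ≡ 0 → S x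
  derived σ c {x} o i0 c0 = Tables.closed tables o
    (λ { (k , lt , e , refl) → in⁺ lt e i0 }) witness
    where
    open Core c
    witness : ∀ {j} → j < regs σ nRules → arrays σ headᵃ j ≡ x →
              (∀ {k} → k < regs σ nCells → arrays σ ownᵃ k ≡ j → arrays σ elemᵃ k ≢ arrays σ headᵃ j) →
              ∃[ k ] k < regs σ nCells × arrays σ ownᵃ k ≡ j × S (arrays σ elemᵃ k)
    witness {j} lt e nt with hit-why lt (no-unhit {H = arrays σ headᵃ} {arrays σ hitᵃ} (trans (sym (count o)) c0) lt e)
    ... | k , kl , ko , inj₁ t = ⊥-elim (nt kl ko t)
    ... | k , kl , ko , inj₂ a = k , kl , ko , proj₂ (proj₂ (sound (inj₁ (k , kl , refl)) a))

  push-ok : ∀ σ → CoreOf σ → let y = regs σ newʳ in OccOf σ y → arrays σ inᵃ y ≡ 0 → arrays σ cntᵃ y ≡ 0 →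
            arrays σ addedᵃ y ≡ 0 → wp push CoreOf σ
  push-ok σ c o i0 c0 a0 = record
    { tables = tables; prev-ok = prev-ok; last-ok = last-ok; in⁻ = in⁻; in⁺ = in⁺; trivial = trivial
    ; hit-why = λ lt h → let k , kl , ko , w = hit-why lt h in k , kl , ko , why k w
    ; seen = seen′
    ; count = count
    ; sound = λ {x} ox → upd (λ a → a ≢ 0 → arrays σ inᵃ x ≡ 0 × arrays σ cntᵃ x ≡ 0 × S x) added y x
                 (λ { refl _ → i0 , c0 , derived σ c o i0 c0 }) (λ _ → sound ox)
    ; queued = queued′
    ; queue-occ = λ {q} f≤ q< → upd (OccOf σ) queue back q (λ _ → o)
                    (λ ne → queue-occ f≤ (≤∧≢⇒< (≤-pred q<) ne))
    ; front≤ = m≤n⇒m≤1+n front≤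
    ; ptr≤ = ptr≤
    ; ptr-elt = λ p → let e , a = ptr-elt p in e , ≢0-upd added (λ ()) a
    }
    where
    open Core c
    y     = regs σ newʳ
    added = arrays σ addedᵃ
    queue = arrays σ queueᵃ
    back  = regs σ backʳ
    E     = arrays σ elemᵃ
    why : ∀ {h} k → (E k ≡ h ⊎ added (E k) ≢ 0) → E k ≡ h ⊎ (added [ y ↦ 1 ]) (E k) ≢ 0
    why k (inj₁ e) = inj₁ e
    why k (inj₂ a) = inj₂ (≢0-upd added (λ ()) a)
    seen′ : ∀ {k} → k < regs σ nCells → (added [ y ↦ 1 ]) (E k) ≢ 0 →
            (added [ y ↦ 1 ]) (E k) ≡ 1 ⊎ arrays σ hitᵃ (arrays σ ownᵃ k) ≢ 0 ⊎ (E k ≡ regs σ eltʳ × k < regs σ ptrʳ)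
    seen′ {k} lt = upd (λ a → a ≢ 0 → a ≡ 1 ⊎ arrays σ hitᵃ (arrays σ ownᵃ k) ≢ 0 ⊎ (E k ≡ regs σ eltʳ × k < regs σ ptrʳ))
                     added y (E k) (λ _ _ → inj₁ refl) (λ _ → seen lt)
    queued′ : ∀ {k} → k < regs σ nCells → (added [ y ↦ 1 ]) (E k) ≡ 1 →
              ∃[ q ] regs σ frontʳ ≤ q × q < suc back × (queue [ back ↦ y ]) q ≡ E k
    queued′ {k} lt with E k ≟ y
    ... | yes e = λ _ → back , front≤ , n<1+n back , trans (upd-eq queue refl) (sym e)
    ... | no ne = λ a → let q , f≤ , q< , qe = queued lt (trans (sym (upd-neq added ne)) a) in
                  q , f≤ , m<n⇒m<1+n q< , trans (upd-neq queue (<⇒≢ q<)) qe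

  module _ (σ : State) (c : CoreOf σ) (p≢0 : regs σ ptrʳ ≢ 0) where
    open Core c
    private
      E   = arrays σ elemᵃ
      O   = arrays σ ownᵃ
      k   = pred (regs σ ptrʳ)
      j   = O k
      y   = arrays σ headᵃ j
      hit = arrays σ hitᵃ
      cnt = arrays σ cntᵃ
      kp : suc k ≡ regs σ ptrʳ
      kp = suc-pred (regs σ ptrʳ) ⦃ ≢-nonZero p≢0 ⦄
      k<N : k < regs σ nCells
      k<N = ≤-trans (≤-reflexive kp) ptr≤
      elt-eq = proj₁ (ptr-elt p≢0)
      j<m : j < regs σ nRules
      j<m = Tables.own< tables k<N
      latest : Latest E (regs σ eltʳ) k (arrays σ prevᵃ k)
      latest = subst (λ x → Latest E x k (arrays σ prevᵃ k)) elt-eq (prev-ok k<N)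

      ptr-elt′ : arrays σ prevᵃ k ≢ 0 → E (pred (arrays σ prevᵃ k)) ≡ regs σ eltʳ × arrays σ addedᵃ (regs σ eltʳ) ≢ 0
      ptr-elt′ p = proj₂ (proj₂ latest) p , proj₂ (ptr-elt p≢0)

      ptr≤′ : arrays σ prevᵃ k ≤ regs σ nCells
      ptr≤′ = ≤-trans (proj₁ (proj₂ latest)) (<⇒≤ k<N)

      seen-next : ∀ {hit′ : ℕ → ℕ} → (∀ {j} → hit j ≢ 0 → hit′ j ≢ 0) → hit′ j ≢ 0 →
                  ∀ {k′} → k′ < regs σ nCells → arrays σ addedᵃ (E k′) ≢ 0 →
                  arrays σ addedᵃ (E k′) ≡ 1 ⊎ hit′ (O k′) ≢ 0 ⊎ (E k′ ≡ regs σ eltʳ × k′ < arrays σ prevᵃ k)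
      seen-next mono hj {k′} lt a with seen lt a
      ... | inj₁ q        = inj₁ q
      ... | inj₂ (inj₁ q) = inj₂ (inj₁ (mono q))
      ... | inj₂ (inj₂ (e , k′<p)) with k′ ≟ k
      ...   | yes refl = inj₂ (inj₁ hj)
      ...   | no ne    = inj₂ (inj₂ (e , proj₁ latest (≤∧≢⇒< (≤-pred (≤-trans k′<p (≤-reflexive (sym kp)))) ne) e))

    ptr-load : Σ< (regs σ ptrʳ) (λ k → δ (E k) (regs σ eltʳ)) ≡ suc (Σ< (arrays σ prevᵃ k) (λ k → δ (E k) (regs σ eltʳ)))
    ptr-load = trans (cong (λ p → Σ< p (λ k → δ (E k) (regs σ eltʳ))) (sym kp))
                     (cong₂ _+_ (δ-yes elt-eq) (latest-count {E} latest))

    advance-ok : hit j ≢ 0 → wp advance CoreOf σ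
    advance-ok hj = record
      { tables = tables; prev-ok = prev-ok; last-ok = last-ok; in⁻ = in⁻; in⁺ = in⁺; trivial = trivial
      ; hit-why = hit-why; seen = seen-next (λ h → h) hj; count = count; sound = sound
      ; queued = queued; queue-occ = queue-occ; front≤ = front≤; ptr≤ = ptr≤′; ptr-elt = ptr-elt′ }

    cnt-strike : hit j ≡ 0 → cnt y ≡ suc (Σ< (regs σ nRules) (unhit (arrays σ headᵃ) (hit [ j ↦ 1 ]) y))
    cnt-strike h0 = trans (count (inj₂ (j , j<m , refl)))
      (Σ<-drop (regs σ nRules) j<m drop same)
      where
      drop : unhit (arrays σ headᵃ) hit y j ≡ suc (unhit (arrays σ headᵃ) (hit [ j ↦ 1 ]) y j)
      drop = trans (cong₂ _*_ (δ-yes {y} refl) (cong isZero h0))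
        (cong suc (sym (trans (cong (λ v → δ y y * isZero v) (upd-eq hit refl)) (*-zeroʳ (δ y y)))))
      same : ∀ {j′} → j′ < regs σ nRules → j′ ≢ j →
             unhit (arrays σ headᵃ) hit y j′ ≡ unhit (arrays σ headᵃ) (hit [ j ↦ 1 ]) y j′
      same {j′} _ ne = cong (λ v → δ (arrays σ headᵃ j′) y * isZero v) (sym (upd-neq hit ne))

    strike-ok : hit j ≡ 0 → wp (advance ,, strike) CoreOf σ
    strike-ok h0 = record
      { tables = tables; prev-ok = prev-ok; last-ok = last-ok; in⁻ = in⁻; in⁺ = in⁺
      ; trivial = λ lt e → ≢0-upd hit (λ ()) (trivial lt e)
      ; hit-why = λ {j′} lt → upd (λ h → h ≢ 0 → ∃[ k ] k < regs σ nCells × O k ≡ j′ ×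
                                     (E k ≡ arrays σ headᵃ j′ ⊎ arrays σ addedᵃ (E k) ≢ 0)) hit j j′
          (λ e _ → k , k<N , sym e , inj₂ (subst (λ x → arrays σ addedᵃ x ≢ 0) (sym elt-eq) (proj₂ (ptr-elt p≢0))))
          (λ _ → hit-why lt)
      ; seen = seen-next {hit [ j ↦ 1 ]} (≢0-upd hit {j} (λ ()))
                 (upd-same≢0 hit j (λ ()))
      ; count = count′
      ; sound = λ {x} o a → let i0 , c0 , s = sound o a in
          i0 , upd (_≡ 0) cnt y x (λ e → cong pred (subst (λ x → cnt x ≡ 0) e c0)) (λ _ → c0) , s
      ; queued = queued; queue-occ = queue-occ; front≤ = front≤; ptr≤ = ptr≤′; ptr-elt = ptr-elt′ }
      where
      count′ : ∀ {x} → OccOf σ x → (cnt [ y ↦ pred (cnt y) ]) x ≡ Σ< (regs σ nRules) (unhit (arrays σ headᵃ) (hit [ j ↦ 1 ]) x)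
      count′ {x} o with x ≟ y
      ... | yes refl = trans (upd-eq cnt refl) (cong pred (cnt-strike h0))
      ... | no ne = trans (upd-neq cnt ne) (trans (count o) (Σ<-cong (regs σ nRules) same))
        where
        same : ∀ {j′} → j′ < regs σ nRules → unhit (arrays σ headᵃ) hit x j′ ≡ unhit (arrays σ headᵃ) (hit [ j ↦ 1 ]) x j′
        same {j′} _ with j′ ≟ j
        ... | yes refl = trans (cong (λ v → v * isZero (hit j)) z) (sym (cong (λ v → v * isZero ((hit [ j ↦ 1 ]) j)) z))
          where z = δ-no {y} {x} (λ e → ne (sym e))
        ... | no ne′ = cong (λ v → δ (arrays σ headᵃ j′) x * isZero v) (sym (upd-neq hit ne′))

    hit-load : hit j ≡ 0 → Σ< (regs σ nRules) (λ j → isZero (hit j)) ≡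
               suc (Σ< (regs σ nRules) (λ j′ → isZero ((hit [ j ↦ 1 ]) j′)))
    hit-load h0 = Σ<-drop (regs σ nRules) j<m drop same
      where
      drop : isZero (hit j) ≡ suc (isZero ((hit [ j ↦ 1 ]) j))
      drop = trans (cong isZero h0) (cong suc (sym (cong isZero (upd-eq hit refl))))
      same : ∀ {j′} → j′ < regs σ nRules → j′ ≢ j → isZero (hit j′) ≡ isZero ((hit [ j ↦ 1 ]) j′)
      same _ ne = cong isZero (sym (upd-neq hit ne))

  -- A push turns the mark 0 into 1, and both marks count as unpopped.
  push-load : ∀ N (E added : ℕ → ℕ) y → added y ≡ 0 →
              Σ< N (λ k → unpopped ((added [ y ↦ 1 ]) (E k))) ≡ Σ< N (λ k → unpopped (added (E k)))
  push-load N E added y a0 = Σ<-cong N each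
    where
    each : ∀ {k} → k < N → unpopped ((added [ y ↦ 1 ]) (E k)) ≡ unpopped (added (E k))
    each {k} _ with E k ≟ y
    ... | yes e = trans (cong unpopped (upd-eq added e)) (sym (cong unpopped (trans (cong added e) a0)))
    ... | no ne = cong unpopped (upd-neq added ne)

  pop-load : ∀ N (E added : ℕ → ℕ) y → added y ≡ 1 →
             Σ< N (λ k → unpopped (added (E k))) ≡
             Σ< N (λ k → δ (E k) y) + Σ< N (λ k → unpopped ((added [ y ↦ 2 ]) (E k)))
  pop-load N E added y a1 = trans (Σ<-cong N each) (Σ<-+ N (λ k → δ (E k) y) _)
    where
    each : ∀ {k} → k < N → unpopped (added (E k)) ≡ δ (E k) y + unpopped ((added [ y ↦ 2 ]) (E k))
    each {k} _ with E k ≟ y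
    ... | yes e = trans (cong unpopped (trans (cong added e) a1))
                        (sym (cong₂ _+_ (δ-yes e) (cong unpopped (upd-eq added e))))
    ... | no ne = sym (cong₂ _+_ (δ-no ne) (cong unpopped (upd-neq added ne)))

  module _ {e : ℕ} (σ : State) (c : CoreOf σ) (pend : PendingOf (regs σ nCells) σ) (b : BudgetOf e σ) where
    open Core c
    open Pending pend
    private
      E     = arrays σ elemᵃ
      hit   = arrays σ hitᵃ
      cnt   = arrays σ cntᵃ
      added = arrays σ addedᵃ
      N     = regs σ nCells
      m     = regs σ nRules
      C     = N + N + m

    visit-ok : regs σ ptrʳ ≢ 0 → wp visit (Inv (suc e)) σ
    visit-ok p≢0 = struck , λ h≢0 → advance-ok σ c p≢0 h≢0 , pend , budget (inj₂ (pay 0 (Σ< m (λ j → isZero (hit j))) refl))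
      where
      k = pred (regs σ ptrʳ)
      j = arrays σ ownᵃ k
      y = arrays σ headᵃ j
      A = Σ< (arrays σ prevᵃ k) (λ k → δ (E k) (regs σ eltʳ))
      B = regs σ backʳ
      P = Σ< N (λ k → unpopped (added (E k)))
      start : suc A + (B + (P + Σ< m (λ j → isZero (hit j)))) + e ≤ regs σ frontʳ + C
      start with Budget.left b
      ... | inj₁ (p0 , _) = ⊥-elim (p≢0 p0)
      ... | inj₂ le = subst (λ a → a + (B + (P + Σ< m (λ j → isZero (hit j)))) + e ≤ regs σ frontʳ + C) (ptr-load σ c p≢0) le
      -- `d` is 1 if the step hits a rule. The link that is followed pays for the step, and the hit
      -- rule for a possible push.
      pay : ∀ d Z → Σ< m (λ j → isZero (hit j)) ≡ d + Z → A + ((d + B) + (P + Z)) + suc e ≤ regs σ frontʳ + C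
      pay d Z eq = subst (_≤ regs σ frontʳ + C) (trans (cong (λ z → suc A + (B + (P + z)) + e) eq) (move A B P Z d e)) start
        where
        move : ∀ A B P Z d e → suc A + (B + (P + (d + Z))) + e ≡ A + ((d + B) + (P + Z)) + suc e
        move = solve-∀
      Z′ = Σ< m (λ j′ → isZero ((hit [ j ↦ 1 ]) j′))
      struck : hit j ≡ 0 → _
      struck h0 = (λ c0 → (λ i0 → pushed c0 i0) , (λ i≢0 → core , record { found = found-in i≢0 } , light))
                , (λ c≢0 → core , record { found = found-cnt c≢0 } , light)
        where
        core = strike-ok σ c p≢0 h0
        open Core c using () renaming (count to count₀)
        j<m : j < m
        j<m = Tables.own< tables (≤-trans (≤-reflexive (suc-pred (regs σ ptrʳ) ⦃ ≢-nonZero p≢0 ⦄)) ptr≤)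
        y-occ : OccOf σ y
        y-occ = inj₂ (j , j<m , refl)
        cnt′ = cnt [ y ↦ pred (cnt y) ]
        -- Before the strike rule `j` itself is intact and has head `y`, so the count of `y` is
        -- positive, whereas added elements have count zero. Hence `visit` can push without testing
        -- the mark.
        a0 : added y ≡ 0
        a0 with added y ≟ 0
        ... | yes z = z
        ... | no nz with trans (sym (proj₁ (proj₂ (sound y-occ nz)))) (cnt-strike σ c p≢0 h0)
        ...   | ()
        found-else : ∀ {x} → x ≢ y → cnt′ x ≡ 0 → cnt x ≡ 0
        found-else ne z = trans (sym (upd-neq cnt ne)) z
        found-in : arrays σ inᵃ y ≢ 0 → ∀ {k} → k < N → arrays σ inᵃ (E k) ≡ 0 → cnt′ (E k) ≡ 0 → added (E k) ≢ 0
        found-in i≢0 {k} lt i0 c0 = found lt i0 (found-else (λ e → i≢0 (subst (λ x → arrays σ inᵃ x ≡ 0) e i0)) c0)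
        found-cnt : cnt′ y ≢ 0 → ∀ {k} → k < N → arrays σ inᵃ (E k) ≡ 0 → cnt′ (E k) ≡ 0 → added (E k) ≢ 0
        found-cnt c≢0 {k} lt i0 c0 = found lt i0 (found-else (λ e → c≢0 (subst (λ x → cnt′ x ≡ 0) e c0)) c0)
        light : Budget (suc e) m N (regs σ frontʳ) B (arrays σ prevᵃ k) (regs σ eltʳ) E (hit [ j ↦ 1 ]) added
        light = budget (inj₂ (≤-trans (+-monoˡ-≤ (suc e) (+-monoʳ-≤ A (+-monoˡ-≤ (P + Z′) (n≤1+n B))))
                                      (pay 1 Z′ (hit-load σ c p≢0 h0))))
        pushed : cnt′ y ≡ 0 → arrays σ inᵃ y ≡ 0 → _
        pushed c0 i0 = push-ok (⟦ advance ,, strike ⟧ σ) core y-occ i0 c0 a0 ,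
          record { found = λ {k} lt i0 c0 → upd (_≢ 0) added y (E k) (λ _ ()) (λ ne → found lt i0 (found-else ne c0)) } ,
          budget (inj₂ (subst (λ P → A + (suc B + (P + Z′)) + suc e ≤ regs σ frontʳ + C) (sym (push-load N E added y a0))
                          (pay 1 Z′ (hit-load σ c p≢0 h0))))

    -- For a fresh element the length of its chain is exactly the number of cells that cease to be
    -- unpopped, so the load stays the same and the growth of `front` pays for the step. A stale
    -- entry changes nothing but `front`.
    pop-ok : regs σ ptrʳ ≡ 0 → regs σ frontʳ < regs σ backʳ → wp pop (Inv (suc e)) σ
    pop-ok p0 f<b = fresh , stale
      where
      F = regs σ frontʳ
      x = arrays σ queueᵃ F
      B = regs σ backʳ
      Z = Σ< m (λ j → isZero (hit j))
      not-front : ∀ {q z} → added z ≡ 1 → (z ≡ x → added z ≢ 1) → F ≤ q → arrays σ queueᵃ q ≡ z → suc F ≤ q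
      not-front {q} a ne F≤q e with q ≟ F
      ... | yes refl = ⊥-elim (ne (sym e) a)
      ... | no q≢F   = ≤∧≢⇒< F≤q (λ e → q≢F (sym e))
      start : B + (Σ< N (λ k → unpopped (added (E k))) + Z) + e ≤ F + C
      start with Budget.left b
      ... | inj₁ (_ , b≤f) = ⊥-elim (<⇒≱ f<b b≤f)
      ... | inj₂ le rewrite p0 = le
      absurd : ∀ {v} → v < regs σ ptrʳ → ∀ {A : Set} → A
      absurd lt rewrite p0 with lt
      ... | ()
      fresh : added x ≡ 1 → _
      fresh a1 = record
        { tables = tables; prev-ok = prev-ok; last-ok = last-ok; in⁻ = in⁻; in⁺ = in⁺; trivial = trivial
        ; hit-why = λ lt h → let k , kl , ko , w = hit-why lt h in k , kl , ko , why k w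
        ; seen = seen′
        ; count = count
        ; sound = λ {z} o → upd (λ a → a ≢ 0 → arrays σ inᵃ z ≡ 0 × cnt z ≡ 0 × S z) added x z
                     (λ { refl _ → sound o (subst (_≢ 0) (sym a1) (λ ())) }) (λ _ → sound o)
        ; queued = queued′
        ; queue-occ = λ f≤ q< → queue-occ (<⇒≤ f≤) q<
        ; front≤ = f<b
        ; ptr≤ = proj₁ (proj₂ last-x)
        ; ptr-elt = λ p → proj₂ (proj₂ last-x) p , upd-same≢0 added x (λ ()) } ,
        record { found = λ {k} lt i0 c0 → upd (_≢ 0) added x (E k) (λ _ ()) (λ _ → found lt i0 c0) } ,
        budget (inj₂ (subst (_≤ suc F + C) (sym paid) (s≤s start)))
        where
        last-x : Latest E x N (arrays σ lastᵃ x)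
        last-x = last-ok (queue-occ ≤-refl f<b)
        why : ∀ {h} k → (E k ≡ h ⊎ added (E k) ≢ 0) → E k ≡ h ⊎ (added [ x ↦ 2 ]) (E k) ≢ 0
        why k (inj₁ e) = inj₁ e
        why k (inj₂ a) = inj₂ (≢0-upd added (λ ()) a)
        seen′ : ∀ {k} → k < N → (added [ x ↦ 2 ]) (E k) ≢ 0 →
                (added [ x ↦ 2 ]) (E k) ≡ 1 ⊎ hit (arrays σ ownᵃ k) ≢ 0 ⊎ (E k ≡ x × k < arrays σ lastᵃ x)
        seen′ {k} lt = upd (λ a → a ≢ 0 → a ≡ 1 ⊎ hit (arrays σ ownᵃ k) ≢ 0 ⊎ (E k ≡ x × k < arrays σ lastᵃ x)) added x (E k)
          (λ e _ → inj₂ (inj₂ (e , proj₁ last-x lt e)))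
          (λ _ a → old (seen lt a))
          where
          old : added (E k) ≡ 1 ⊎ hit (arrays σ ownᵃ k) ≢ 0 ⊎ (E k ≡ regs σ eltʳ × k < regs σ ptrʳ) → _
          old (inj₁ q) = inj₁ q
          old (inj₂ (inj₁ q)) = inj₂ (inj₁ q)
          old (inj₂ (inj₂ (_ , lt))) = absurd lt
        queued′ : ∀ {k} → k < N → (added [ x ↦ 2 ]) (E k) ≡ 1 → ∃[ q ] suc F ≤ q × q < B × arrays σ queueᵃ q ≡ E k
        queued′ {k} lt = upd (λ a → a ≡ 1 → ∃[ q ] suc F ≤ q × q < B × arrays σ queueᵃ q ≡ E k) added x (E k)
          (λ _ ())
          (λ ne a → let q , f≤ , q< , qe = queued lt a in q , not-front a (λ e → ⊥-elim (ne e)) f≤ qe , q< , qe)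
        U = Σ< N (λ k → unpopped ((added [ x ↦ 2 ]) (E k)))
        L = Σ< (arrays σ lastᵃ x) (λ k → δ (E k) x)
        paid : L + (B + (U + Z)) + suc e ≡ suc (B + (Σ< N (λ k → unpopped (added (E k))) + Z) + e)
        paid = trans (move L B U Z e)
          (cong (λ u → suc (B + (u + Z) + e)) (sym (trans (pop-load N E added x a1) (cong (_+ U) (latest-count {E} last-x)))))
          where
          move : ∀ L B U Z e → L + (B + (U + Z)) + suc e ≡ suc (B + ((L + U) + Z) + e)
          move = solve-∀
      stale : added x ≢ 1 → _
      stale a≢1 = record
        { tables = tables; prev-ok = prev-ok; last-ok = last-ok; in⁻ = in⁻; in⁺ = in⁺; trivial = trivial
        ; hit-why = hit-why
        ; seen = λ lt a → old (seen lt a)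
        ; count = count ; sound = sound
        ; queued = λ lt a → let q , f≤ , q< , qe = queued lt a in
            q , not-front a (λ e → subst (λ z → added z ≢ 1) (sym e) a≢1) f≤ qe , q< , qe
        ; queue-occ = λ f≤ q< → queue-occ (<⇒≤ f≤) q<
        ; front≤ = f<b
        ; ptr≤ = ptr≤
        ; ptr-elt = λ p → ⊥-elim (p p0) } ,
        pend , budget (inj₂ (subst (_≤ suc F + C) (sym (paid p0)) (s≤s start)))
        where
        old : ∀ {k} {E′ : Set} → added (E k) ≡ 1 ⊎ hit (arrays σ ownᵃ k) ≢ 0 ⊎ (E′ × k < regs σ ptrʳ) →
              added (E k) ≡ 1 ⊎ hit (arrays σ ownᵃ k) ≢ 0 ⊎ (E k ≡ x × k < regs σ ptrʳ)
        old (inj₁ q) = inj₁ q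
        old (inj₂ (inj₁ q)) = inj₂ (inj₁ q)
        old (inj₂ (inj₂ (_ , lt))) = absurd lt
        paid : ∀ {p} → p ≡ 0 → Σ< p (λ k → δ (E k) x) + (B + (Σ< N (λ k → unpopped (added (E k))) + Z)) + suc e ≡
               suc (B + (Σ< N (λ k → unpopped (added (E k))) + Z) + e)
        paid refl = +-suc _ e

    opaque
      unfolding search
      search-ok : wp search (Inv (suc e)) σ
      search-ok = (λ p0 → pop-ok p0 , λ f≮b → c , pend , budget (inj₁ (p0 , ≮⇒≥ f≮b))) , visit-ok

  -- Initialising the tables of the search

  record Vanish (m N : ℕ) (H E f : ℕ → ℕ) : Set where
    constructor vanish
    field
      at : ∀ {x} → Occ m N H E x → f x ≡ 0
  open Vanish

  record ZeroOn (b : ℕ) (X f : ℕ → ℕ) : Set where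
    constructor zeroOn
    field
      on : ∀ {j} → j < b → f (X j) ≡ 0
  open ZeroOn

  zeroOn-suc : ∀ {b X f} → ZeroOn b X f → ZeroOn (suc b) X (f [ X b ↦ 0 ])
  on (zeroOn-suc {b} {X} {f} z) {j} lt = upd (_≡ 0) f (X b) (X j) (λ _ → refl)
    (λ ne → on z (≤∧≢⇒< (≤-pred lt) (λ e → ne (cong X e))))

  zeroOn-upd : ∀ {b X f x} → ZeroOn b X f → ZeroOn b X (f [ x ↦ 0 ])
  on (zeroOn-upd {X = X} {f} {x} z) {j} lt = upd (_≡ 0) f x (X j) (λ _ → refl) (λ _ → on z lt)

  zeroOn-occ : ∀ {m N H E f} → ZeroOn m H f → ZeroOn N E f → Vanish m N H E f
  at (zeroOn-occ zh ze) (inj₁ (k , lt , refl)) = on ze lt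
  at (zeroOn-occ zh ze) (inj₂ (j , lt , refl)) = on zh lt

  HeadsCleared : ℕ → State → Set
  HeadsCleared b σ = ZeroOn b (arrays σ headᵃ) (arrays σ lastᵃ) × ZeroOn b (arrays σ headᵃ) (arrays σ inᵃ) ×
    ZeroOn b (arrays σ headᵃ) (arrays σ cntᵃ) × ZeroOn b (arrays σ headᵃ) (arrays σ addedᵃ) ×
    ZeroOn b (λ x → x) (arrays σ hitᵃ)

  CellsCleared : ℕ → State → Set
  CellsCleared b σ = ZeroOn b (arrays σ elemᵃ) (arrays σ lastᵃ) × ZeroOn b (arrays σ elemᵃ) (arrays σ inᵃ) ×
    ZeroOn b (arrays σ elemᵃ) (arrays σ cntᵃ) × ZeroOn b (arrays σ elemᵃ) (arrays σ addedᵃ)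

  none : ∀ {X f} → ZeroOn 0 X f
  on none ()

  clearHead-ok : ∀ σ → TablesOf σ →
    let τ = ⟦ for jʳ nRules clearHead ⟧ σ in (TablesOf τ × HeadsCleared (regs τ jʳ) τ) × regs τ jʳ ≡ regs τ nRules
  clearHead-ok σ t = for-wp jʳ nRules clearHead (λ τ → TablesOf τ × HeadsCleared (regs τ jʳ) τ) refl refl
    (λ { τ _ (t , a , b , c , d , e) → t , zeroOn-suc a , zeroOn-suc b , zeroOn-suc c , zeroOn-suc d , zeroOn-suc e })
    σ (t , none , none , none , none , none)

  clearCell-ok : ∀ σ → TablesOf σ → HeadsCleared (regs σ nRules) σ →
    let τ = ⟦ for kʳ nCells clearCell ⟧ σ in
    (TablesOf τ × HeadsCleared (regs τ nRules) τ × CellsCleared (regs τ kʳ) τ) × regs τ kʳ ≡ regs τ nCells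
  clearCell-ok σ t (a , b , c , d , e) =
    for-wp kʳ nCells clearCell (λ τ → TablesOf τ × HeadsCleared (regs τ nRules) τ × CellsCleared (regs τ kʳ) τ) refl refl
    (λ { τ _ (t , (a , b , c , d , e) , (a′ , b′ , c′ , d′)) → t ,
          (zeroOn-upd a , zeroOn-upd b , zeroOn-upd c , zeroOn-upd d , e) ,
          (zeroOn-suc a′ , zeroOn-suc b′ , zeroOn-suc c′ , zeroOn-suc d′) })
    σ (t , (a , b , c , d , e) , none , none , none , none)

  record Links (m N K : ℕ) (H E last prev : ℕ → ℕ) : Set where
    field
      prevs : ∀ {k} → k < K → Latest E (E k) k (prev k)
      lasts : ∀ {x} → Occ m N H E x → Latest E x K (last x)

  record Marks (m N K i : ℕ) (H E O inB : ℕ → ℕ) : Set where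
    field
      mark⁻ : ∀ {x} → Occ m N H E x → inB x ≢ 0 → ∃[ k ] k < K × O k ≡ i × E k ≡ x
      mark⁺ : ∀ {k} → k < K → O k ≡ i → inB (E k) ≢ 0

  record Trivials (m K : ℕ) (H E O hit : ℕ → ℕ) : Set where
    field
      triv⁻ : ∀ {j} → j < m → hit j ≢ 0 → ∃[ k ] k < K × O k ≡ j × E k ≡ H j
      triv⁺ : ∀ {k} → k < K → E k ≡ H (O k) → hit (O k) ≢ 0

  record Counts (m N M : ℕ) (H E cnt hit : ℕ → ℕ) : Set where
    field
      counted : ∀ {x} → Occ m N H E x → cnt x ≡ Σ< M (unhit H hit x)

  VanishOf : ℕ → State → Set
  VanishOf a σ = Vanish (regs σ nRules) (regs σ nCells) (arrays σ headᵃ) (arrays σ elemᵃ) (arrays σ a)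

  LinksOf MarksOf TrivialsOf CountsOf : ℕ → State → Set
  LinksOf K σ    = Links (regs σ nRules) (regs σ nCells) K (arrays σ headᵃ) (arrays σ elemᵃ) (arrays σ lastᵃ) (arrays σ prevᵃ)
  MarksOf K σ    = Marks (regs σ nRules) (regs σ nCells) K (regs σ iʳ) (arrays σ headᵃ) (arrays σ elemᵃ) (arrays σ ownᵃ) (arrays σ inᵃ)
  TrivialsOf K σ = Trivials (regs σ nRules) K (arrays σ headᵃ) (arrays σ elemᵃ) (arrays σ ownᵃ) (arrays σ hitᵃ)
  CountsOf M σ   = Counts (regs σ nRules) (regs σ nCells) M (arrays σ headᵃ) (arrays σ elemᵃ) (arrays σ cntᵃ) (arrays σ hitᵃ)

  Linked : ℕ → State → Set
  Linked K σ = TablesOf σ × VanishOf inᵃ σ × VanishOf cntᵃ σ × VanishOf addedᵃ σ ×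
    ZeroOn (regs σ nRules) (λ x → x) (arrays σ hitᵃ) × LinksOf K σ

  link-ok : ∀ σ → Linked 0 σ →
    let τ = ⟦ for kʳ nCells link ⟧ σ in Linked (regs τ kʳ) τ × regs τ kʳ ≡ regs τ nCells
  link-ok σ l = for-wp kʳ nCells link (λ τ → Linked (regs τ kʳ) τ) refl refl
    (λ { τ lt (t , a , b , c , d , l) → t , a , b , c , d , record { prevs = prevs′ τ lt l ; lasts = lasts′ τ l } }) σ l
    where
    module _ (τ : State) where
      k = regs τ kʳ
      E = arrays τ elemᵃ
      prevs′ : regs τ kʳ < regs τ nCells → LinksOf k τ → ∀ {k′} → k′ < suc k →
               Latest E (E k′) k′ ((arrays τ prevᵃ [ k ↦ arrays τ lastᵃ (E k) ]) k′)
      prevs′ k<N l {k′} lt = upd (Latest E (E k′) k′) (arrays τ prevᵃ) k k′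
        (λ { refl → Links.lasts l (inj₁ (k , k<N , refl)) })
        (λ ne → Links.prevs l (≤∧≢⇒< (≤-pred lt) ne))
      lasts′ : LinksOf k τ → ∀ {x} → OccOf τ x → Latest E x (suc k) ((arrays τ lastᵃ [ E k ↦ suc k ]) x)
      lasts′ l {x} o = upd (Latest E x (suc k)) (arrays τ lastᵃ) (E k) x
        (λ e → (λ lt _ → lt) , ≤-refl , (λ _ → sym e))
        (λ ne → let a , b , c = Links.lasts l o in
          (λ lt e → a (≤∧≢⇒< (≤-pred lt) (λ { refl → ne (sym e) })) e) , m≤n⇒m≤1+n b , c)

  Marked : ℕ → State → Set
  Marked K σ = TablesOf σ × VanishOf cntᵃ σ × VanishOf addedᵃ σ ×
    ZeroOn (regs σ nRules) (λ x → x) (arrays σ hitᵃ) × LinksOf (regs σ nCells) σ × MarksOf K σ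

  markBody-ok : ∀ σ → Marked 0 σ →
    let τ = ⟦ for kʳ nCells markBody ⟧ σ in Marked (regs τ kʳ) τ × regs τ kʳ ≡ regs τ nCells
  markBody-ok σ l = for-wp kʳ nCells markBody (λ τ → Marked (regs τ kʳ) τ) refl refl
    (λ { τ lt (t , b , c , d , l , ms) →
         (λ e → t , b , c , d , l , record { mark⁻ = mark⁻′ τ ms e ; mark⁺ = mark⁺′ τ ms }) ,
         (λ ne → t , b , c , d , l , record { mark⁻ = λ o h → weaken τ (Marks.mark⁻ ms o h)
                                            ; mark⁺ = λ lt e → Marks.mark⁺ ms (≤∧≢⇒< (≤-pred lt) (λ { refl → ne e })) e }) }) σ l
    where
    module _ (τ : State) where
      k = regs τ kʳ
      E = arrays τ elemᵃ
      O = arrays τ ownᵃ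
      i = regs τ iʳ
      weaken : ∀ {x} → (∃[ k′ ] k′ < k × O k′ ≡ i × E k′ ≡ x) → ∃[ k′ ] k′ < suc k × O k′ ≡ i × E k′ ≡ x
      weaken (k′ , lt , r) = k′ , m<n⇒m<1+n lt , r
      mark⁻′ : MarksOf k τ → O k ≡ i → ∀ {x} → OccOf τ x → (arrays τ inᵃ [ E k ↦ 1 ]) x ≢ 0 →
               ∃[ k′ ] k′ < suc k × O k′ ≡ i × E k′ ≡ x
      mark⁻′ ms e {x} o = upd (λ v → v ≢ 0 → ∃[ k′ ] k′ < suc k × O k′ ≡ i × E k′ ≡ x) (arrays τ inᵃ) (E k) x
        (λ ex _ → k , n<1+n k , e , sym ex) (λ _ h → weaken (Marks.mark⁻ ms o h))
      mark⁺′ : MarksOf k τ → ∀ {k′} → k′ < suc k → O k′ ≡ i → (arrays τ inᵃ [ E k ↦ 1 ]) (E k′) ≢ 0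
      mark⁺′ ms {k′} lt e = upd (_≢ 0) (arrays τ inᵃ) (E k) (E k′) (λ _ ())
        (λ ne → Marks.mark⁺ ms (≤∧≢⇒< (≤-pred lt) (λ e → ne (cong E e))) e)

  Prepared : ℕ → State → Set
  Prepared K σ = TablesOf σ × VanishOf cntᵃ σ × VanishOf addedᵃ σ ×
    LinksOf (regs σ nCells) σ × MarksOf (regs σ nCells) σ × TrivialsOf K σ

  markTrivial-ok : ∀ σ → Prepared 0 σ →
    let τ = ⟦ for kʳ nCells markTrivial ⟧ σ in Prepared (regs τ kʳ) τ × regs τ kʳ ≡ regs τ nCells
  markTrivial-ok σ l = for-wp kʳ nCells markTrivial (λ τ → Prepared (regs τ kʳ) τ) refl refl
    (λ { τ lt (t , b , c , l , ms , ts) →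
         (λ e → t , b , c , l , ms , record { triv⁻ = triv⁻′ τ ts e ; triv⁺ = triv⁺′ τ ts }) ,
         (λ ne → t , b , c , l , ms , record { triv⁻ = λ j< h → weaken τ (Trivials.triv⁻ ts j< h)
                                            ; triv⁺ = λ lt e → Trivials.triv⁺ ts (≤∧≢⇒< (≤-pred lt) (λ { refl → ne e })) e }) }) σ l
    where
    module _ (τ : State) where
      k = regs τ kʳ
      H = arrays τ headᵃ
      E = arrays τ elemᵃ
      O = arrays τ ownᵃ
      weaken : ∀ {j} → (∃[ k′ ] k′ < k × O k′ ≡ j × E k′ ≡ H j) → ∃[ k′ ] k′ < suc k × O k′ ≡ j × E k′ ≡ H j
      weaken (k′ , lt , r) = k′ , m<n⇒m<1+n lt , r
      triv⁻′ : TrivialsOf k τ → E k ≡ H (O k) → ∀ {j} → j < regs τ nRules → (arrays τ hitᵃ [ O k ↦ 1 ]) j ≢ 0 →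
               ∃[ k′ ] k′ < suc k × O k′ ≡ j × E k′ ≡ H j
      triv⁻′ ts e {j} o = upd (λ v → v ≢ 0 → ∃[ k′ ] k′ < suc k × O k′ ≡ j × E k′ ≡ H j) (arrays τ hitᵃ) (O k) j
        (λ { refl _ → k , n<1+n k , refl , e }) (λ _ h → weaken (Trivials.triv⁻ ts o h))
      triv⁺′ : TrivialsOf k τ → ∀ {k′} → k′ < suc k → E k′ ≡ H (O k′) → (arrays τ hitᵃ [ O k ↦ 1 ]) (O k′) ≢ 0
      triv⁺′ ts {k′} lt e = upd (_≢ 0) (arrays τ hitᵃ) (O k) (O k′) (λ _ ())
        (λ ne → Trivials.triv⁺ ts (≤∧≢⇒< (≤-pred lt) (λ e → ne (cong O e))) e)

  Counted : ℕ → State → Set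
  Counted M σ = TablesOf σ × VanishOf addedᵃ σ ×
    LinksOf (regs σ nCells) σ × MarksOf (regs σ nCells) σ × TrivialsOf (regs σ nCells) σ × CountsOf M σ

  countHead-ok : ∀ σ → Counted 0 σ →
    let τ = ⟦ for jʳ nRules countHead ⟧ σ in Counted (regs τ jʳ) τ × regs τ jʳ ≡ regs τ nRules
  countHead-ok σ l = for-wp jʳ nRules countHead (λ τ → Counted (regs τ jʳ) τ) refl refl
    (λ { τ lt (t , c , l , ms , ts , cs) →
         (λ e → t , c , l , ms , ts , record { counted = tally τ cs e }) ,
         (λ ne → t , c , l , ms , ts , record { counted = skip′ τ cs ne }) }) σ l
    where
    module _ (τ : State) where
      j   = regs τ jʳ
      H   = arrays τ headᵃ
      hit = arrays τ hitᵃ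
      cnt = arrays τ cntᵃ
      tally : CountsOf j τ → hit j ≡ 0 → ∀ {x} → OccOf τ x →
              (cnt [ H j ↦ suc (cnt (H j)) ]) x ≡ unhit H hit x j + Σ< j (unhit H hit x)
      tally cs h0 {x} o = upd (_≡ unhit H hit x j + Σ< j (unhit H hit x)) cnt (H j) x
        (λ { refl → cong₂ _+_ (sym (cong₂ _*_ (δ-yes {H j} refl) (cong isZero h0))) (Counts.counted cs o) })
        (λ ne → trans (Counts.counted cs o) (cong (_+ Σ< j (unhit H hit x))
                  (sym (cong (λ v → v * isZero (hit j)) (δ-no (λ e → ne (sym e)))))))
      skip′ : CountsOf j τ → hit j ≢ 0 → ∀ {x} → OccOf τ x → cnt x ≡ unhit H hit x j + Σ< j (unhit H hit x)
      skip′ cs h≢0 {x} o = trans (Counts.counted cs o) (cong (_+ Σ< j (unhit H hit x)) (sym (nonzero (hit j) h≢0)))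
        where
        nonzero : ∀ v → v ≢ 0 → δ (H j) x * isZero v ≡ 0
        nonzero zero    h = ⊥-elim (h refl)
        nonzero (suc v) h = *-zeroʳ (δ (H j) x)

  -- Seeding and running the search

  Seeding : ℕ → State → Set
  Seeding K σ = CoreOf σ × PendingOf K σ × (regs σ frontʳ ≡ 0 × regs σ ptrʳ ≡ 0 × regs σ backʳ ≤ K)

  seed-ok : ∀ σ → Seeding 0 σ →
    let τ = ⟦ for kʳ nCells seed ⟧ σ in Seeding (regs τ kʳ) τ × regs τ kʳ ≡ regs τ nCells
  seed-ok σ s = for-wp kʳ nCells seed (λ τ → Seeding (regs τ kʳ) τ) refl refl (λ τ lt s → body τ lt s) σ s
    where
    body : ∀ τ → regs τ kʳ < regs τ nCells → Seeding (regs τ kʳ) τ →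
           wp seed (λ s → Seeding (suc (regs s kʳ)) (setReg kʳ (suc (regs s kʳ)) s)) τ
    body τ lt (c , p , f0 , p0 , b≤) =
      (λ i0 → (λ c0 → (λ a0 → push-ok (setReg newʳ (E k) τ) c (inj₁ (k , lt , refl)) i0 c0 a0 ,
                              record { found = found′ } , f0 , p0 , s≤s b≤) ,
                      (λ a≢0 → c , grow (λ _ _ → a≢0) , f0 , p0 , m≤n⇒m≤1+n b≤)) ,
              (λ c≢0 → c , grow (λ _ c0 → ⊥-elim (c≢0 c0)) , f0 , p0 , m≤n⇒m≤1+n b≤)) ,
      (λ i≢0 → c , grow (λ i0 _ → ⊥-elim (i≢0 i0)) , f0 , p0 , m≤n⇒m≤1+n b≤)
      where
      k     = regs τ kʳ
      E     = arrays τ elemᵃ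
      added = arrays τ addedᵃ
      grow : (arrays τ inᵃ (E k) ≡ 0 → arrays τ cntᵃ (E k) ≡ 0 → added (E k) ≢ 0) → PendingOf (suc k) τ
      grow new = record { found = go }
        where
        go : ∀ {k′} → k′ < suc k → arrays τ inᵃ (E k′) ≡ 0 → arrays τ cntᵃ (E k′) ≡ 0 → added (E k′) ≢ 0
        go {k′} lt with k′ ≟ k
        ... | yes refl = new
        ... | no ne    = Pending.found p (≤∧≢⇒< (≤-pred lt) ne)
      found′ : ∀ {k′} → k′ < suc k → arrays τ inᵃ (E k′) ≡ 0 → arrays τ cntᵃ (E k′) ≡ 0 →
               (added [ E k ↦ 1 ]) (E k′) ≢ 0
      found′ {k′} lt i0 c0 = upd (_≢ 0) added (E k) (E k′) (λ _ ())
        (λ ne → Pending.found p (≤∧≢⇒< (≤-pred lt) (λ e → ne (cong E e))) i0 c0)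

  setup-ok : ∀ σ → TablesOf σ → let τ = ⟦ setup ⟧ σ in Counted (regs τ nRules) τ
  setup-ok σ t = subst (λ M → Counted M σ₆) (proj₂ r₆) (proj₁ r₆)
    where
    σ₁ = ⟦ for jʳ nRules clearHead ⟧ σ
    σ₂ = ⟦ for kʳ nCells clearCell ⟧ σ₁
    σ₃ = ⟦ for kʳ nCells link ⟧ σ₂
    σ₄ = ⟦ for kʳ nCells markBody ⟧ σ₃
    σ₅ = ⟦ for kʳ nCells markTrivial ⟧ σ₄
    σ₆ = ⟦ for jʳ nRules countHead ⟧ σ₅
    r₁ = clearHead-ok σ t
    r₂ = clearCell-ok σ₁ (proj₁ (proj₁ r₁)) (subst (λ b → HeadsCleared b σ₁) (proj₂ r₁) (proj₂ (proj₁ r₁)))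
    start₃ : (TablesOf σ₂ × HeadsCleared (regs σ₂ nRules) σ₂ × CellsCleared (regs σ₂ kʳ) σ₂) × regs σ₂ kʳ ≡ regs σ₂ nCells →
             Linked 0 σ₂
    start₃ ((t , (hl , hi , hc , ha , hh) , cc) , e) with subst (λ b → CellsCleared b σ₂) e cc
    ... | el , ei , ec , ea = t , zeroOn-occ hi ei , zeroOn-occ hc ec , zeroOn-occ ha ea , hh , record
      { prevs = λ ()
      ; lasts = λ o → let z = at (zeroOn-occ hl el) o in
          (λ ()) , ≤-reflexive z , (λ ne → ⊥-elim (ne z)) }
    r₃ = link-ok σ₂ (start₃ r₂)
    start₄ : Linked (regs σ₃ kʳ) σ₃ × regs σ₃ kʳ ≡ regs σ₃ nCells → Marked 0 σ₃
    start₄ ((t , vi , vc , va , vh , l) , e) = t , vc , va , vh , subst (λ K → LinksOf K σ₃) e l ,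
      record { mark⁻ = λ o ne → ⊥-elim (ne (at vi o)) ; mark⁺ = λ () }
    r₄ = markBody-ok σ₃ (start₄ r₃)
    start₅ : Marked (regs σ₄ kʳ) σ₄ × regs σ₄ kʳ ≡ regs σ₄ nCells → Prepared 0 σ₄
    start₅ ((t , vc , va , vh , l , ms) , e) = t , vc , va , l , subst (λ K → MarksOf K σ₄) e ms ,
      record { triv⁻ = λ lt ne → ⊥-elim (ne (on vh lt)) ; triv⁺ = λ () }
    r₅ = markTrivial-ok σ₄ (start₅ r₄)
    start₆ : Prepared (regs σ₅ kʳ) σ₅ × regs σ₅ kʳ ≡ regs σ₅ nCells → Counted 0 σ₅
    start₆ ((t , vc , va , l , ms , ts) , e) = t , va , l , ms , subst (λ K → TrivialsOf K σ₅) e ts ,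
      record { counted = at vc }
    r₆ = countHead-ok σ₅ (start₆ r₅)

  initialise : Code
  initialise = frontʳ := lit 0 ,, backʳ := lit 0 ,, ptrʳ := lit 0

  initialise-ok : ∀ σ → Counted (regs σ nRules) σ → wp initialise (Seeding 0) σ
  initialise-ok σ (t , va , l , ms , ts , cs) = core₀ , record { found = λ () } , refl , refl , z≤n
    where
    zero≢one : ¬ (0 ≡ 1)
    zero≢one ()
    core₀ : wp initialise CoreOf σ
    core₀ = record
      { tables = t; prev-ok = Links.prevs l; last-ok = Links.lasts l
      ; in⁻ = Marks.mark⁻ ms; in⁺ = Marks.mark⁺ ms; trivial = Trivials.triv⁺ ts
      ; hit-why = λ lt h → let k , kl , ko , e = Trivials.triv⁻ ts lt h in k , kl , ko , inj₁ e
      ; seen = λ lt a → ⊥-elim (a (at va (inj₁ (_ , lt , refl))))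
      ; count = Counts.counted cs
      ; sound = λ o a → ⊥-elim (a (at va o))
      ; queued = λ lt a → ⊥-elim (zero≢one (trans (sym (at va (inj₁ (_ , lt , refl)))) a))
      ; queue-occ = λ _ ()
      ; front≤ = z≤n; ptr≤ = z≤n
      ; ptr-elt = λ ne → ⊥-elim (ne refl) }

  -- The origin of the number of search steps: seeding pushes at most once for each cell, at most
  -- `N` cells are unpopped, and at most `m` rules are intact.
  initial-load : ∀ m N back elt E hit added → back ≤ N → load m N back 0 elt E hit added ≤ N + N + m
  initial-load m N back elt E hit added b≤ =
    ≤-trans (+-mono-≤ b≤ (+-mono-≤ (Σ<-≤ N (λ k → unpopped≤1 (added (E k)))) (Σ<-≤ m (λ j → isZero≤1 (hit j)))))
            (≤-reflexive (sym (+-assoc N N m)))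

  seeded : ∀ σ → Seeding (regs σ nCells) σ → Inv 0 σ
  seeded σ (c , p , f0 , p0 , b≤) = c , p , budget (inj₂ (≤-trans (≤-reflexive (+-identityʳ _)) start))
    where
    start : load (regs σ nRules) (regs σ nCells) (regs σ backʳ) (regs σ ptrʳ) (regs σ eltʳ) (arrays σ elemᵃ) (arrays σ hitᵃ) (arrays σ addedᵃ)
            ≤ regs σ frontʳ + (regs σ nCells + regs σ nCells + regs σ nRules)
    start rewrite f0 | p0 =
      initial-load (regs σ nRules) (regs σ nCells) (regs σ backʳ) (regs σ eltʳ) (arrays σ elemᵃ) (arrays σ hitᵃ) (arrays σ addedᵃ) b≤

  search-denotes : ∀ e σ → Inv e σ → Inv (suc e) (⟦ search ⟧ σ)
  search-denotes e σ (c , p , b) = wp-sound search (Inv (suc e)) σ (search-ok σ c p b)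

  first-searches : ∀ σ → Inv 0 σ → let τ = ⟦ for kʳ nCells (search ,, search) ⟧ σ in
                   Inv (regs τ kʳ + regs τ kʳ) τ × regs τ kʳ ≡ regs τ nCells
  first-searches σ inv = for-inv kʳ nCells (search ,, search) refl
    (cong₂ _∨_ search-keeps-nCells search-keeps-nCells) (λ τ → Inv (regs τ kʳ + regs τ kʳ) τ) twice σ inv
    where
    twice : ∀ τ → regs τ kʳ < regs τ nCells → Inv (regs τ kʳ + regs τ kʳ) τ →
            Inv (suc (regs τ kʳ) + suc (regs τ kʳ)) (next kʳ (search ,, search) τ)
    twice τ _ inv = subst (λ e → Inv e (next kʳ (search ,, search) τ)) (cong suc (sym (+-suc k k)))
      (search-denotes (suc (k + k)) (⟦ search ⟧ τ) (search-denotes (k + k) τ inv))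
      where k = regs τ kʳ

  Rest : State → Set
  Rest τ = Inv (regs τ nCells + regs τ nCells + regs τ jʳ) τ

  last-searches : ∀ σ → Inv (regs σ nCells + regs σ nCells) σ → let τ = ⟦ for jʳ nRules search ⟧ σ in
                  Rest τ × regs τ jʳ ≡ regs τ nRules
  last-searches σ inv = for-inv jʳ nRules search refl search-keeps-nRules Rest once σ
    (subst (λ e → Inv e σ) (sym (+-identityʳ _)) inv)
    where
    once : ∀ τ → regs τ jʳ < regs τ nRules → Rest τ → Rest (next jʳ search τ)
    once τ _ inv = subst (λ e → Inv e (next jʳ search τ))
      (trans (sym (+-suc (N + N) (regs τ jʳ)))
             (cong (λ N → N + N + suc (regs τ jʳ)) (sym (frameR search nCells search-keeps-nCells τ))))
      (search-denotes (N + N + regs τ jʳ) τ inv)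
      where N = regs τ nCells

  Finished : State → Set
  Finished τ = CoreOf τ × PendingOf (regs τ nCells) τ × (regs τ ptrʳ ≡ 0 × regs τ backʳ ≤ regs τ frontʳ)

  -- After all steps the budget reads load ≤ `front`. Since `back` is part of the load and `front` ≤
  -- `back`, the queue is empty; a pointer that is not null would add a unit for its own cell and
  -- make the load exceed `front`.
  finished : ∀ σ → Rest σ → regs σ jʳ ≡ regs σ nRules → Finished σ
  finished σ (c , p , budget (inj₁ idle)) e = c , p , idle
  finished σ (c , p , budget (inj₂ le)) e = c , p , p0 , ≤-trans (≤-trans (m≤m+n B _) (m≤n+m _ A)) spent
    where
    A = Σ< (regs σ ptrʳ) (λ k → δ (arrays σ elemᵃ k) (regs σ eltʳ))
    B = regs σ backʳ
    C = regs σ nCells + regs σ nCells + regs σ nRules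
    W = Σ< (regs σ nCells) (λ k → unpopped (arrays σ addedᵃ (arrays σ elemᵃ k))) + Σ< (regs σ nRules) (λ j → isZero (arrays σ hitᵃ j))
    spent : A + (B + W) ≤ regs σ frontʳ
    spent = +-cancelʳ-≤ C (A + (B + W)) (regs σ frontʳ)
      (subst (λ j → A + (B + W) + (regs σ nCells + regs σ nCells + j) ≤ regs σ frontʳ + C) e le)
    p0 : regs σ ptrʳ ≡ 0
    p0 with regs σ ptrʳ ≟ 0
    ... | yes z = z
    ... | no nz = ⊥-elim (<⇒≱ (≤-trans one (≤-trans (+-monoʳ-≤ A (m≤m+n B W)) spent)) (Core.front≤ c))
      where
      one : suc B ≤ A + B
      one = +-monoˡ-≤ B (≤-trans (≤-reflexive (sym (δ-yes (proj₁ (Core.ptr-elt c nz)))))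
        (Σ<-pick (regs σ ptrʳ) {λ k → δ (arrays σ elemᵃ k) (regs σ eltʳ)} (≤-reflexive (suc-pred (regs σ ptrʳ) ⦃ ≢-nonZero nz ⦄))))

  saturate-ok : ∀ σ → Counted (regs σ nRules) σ → Finished (⟦ saturate ⟧ σ)
  saturate-ok σ s = finished σ₃ (proj₁ r₃) (proj₂ r₃)
    where
    σ₀ = ⟦ initialise ⟧ σ
    σ₁ = ⟦ for kʳ nCells seed ⟧ σ₀
    σ₂ = ⟦ for kʳ nCells (search ,, search) ⟧ σ₁
    σ₃ = ⟦ for jʳ nRules search ⟧ σ₂
    r₁ : Seeding (regs σ₁ kʳ) σ₁ × regs σ₁ kʳ ≡ regs σ₁ nCells
    r₁ = seed-ok σ₀ (initialise-ok σ s)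
    r₂ : Inv (regs σ₂ kʳ + regs σ₂ kʳ) σ₂ × regs σ₂ kʳ ≡ regs σ₂ nCells
    r₂ = first-searches σ₁ (seeded σ₁ (subst (λ K → Seeding K σ₁) (proj₂ r₁) (proj₁ r₁)))
    r₃ : Rest σ₃ × regs σ₃ jʳ ≡ regs σ₃ nRules
    r₃ = last-searches σ₂ (subst (λ k → Inv (k + k) σ₂) (proj₂ r₂) (proj₁ r₂))

  -- The interface to the antimatroid, with queue and chains forgotten. `hit-cause` carries
  -- soundness. Completeness is in `unhit-blocked`: the intact rules support one another, which
  -- forbids that any of their body elements leaves the closure.
  record Saturated (m N i : ℕ) (H E O cnt hit : ℕ → ℕ) : Set where
    field
      unhit-nontrivial : ∀ {j k} → k < N → O k ≡ j → hit j ≡ 0 → E k ≢ H j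
      unhit-blocked    : ∀ {j k} → k < N → O k ≡ j → hit j ≡ 0 →
                         Body N i E O (E k) ⊎ (∃[ j′ ] j′ < m × H j′ ≡ E k × hit j′ ≡ 0)
      hit-cause        : ∀ {j} → j < m → hit j ≢ 0 → ∃[ k ] k < N × O k ≡ j × (E k ≡ H j ⊎ S (E k))
      cnt-zero         : ∀ {k} → k < N → cnt (E k) ≡ 0 → ∀ {j} → j < m → H j ≡ E k → hit j ≢ 0
      cnt-nonzero      : ∀ {k} → k < N → cnt (E k) ≢ 0 → ∃[ j ] j < m × H j ≡ E k × hit j ≡ 0

  SaturatedOf : State → Set
  SaturatedOf σ = Saturated (regs σ nRules) (regs σ nCells) (regs σ iʳ)
    (arrays σ headᵃ) (arrays σ elemᵃ) (arrays σ ownᵃ) (arrays σ cntᵃ) (arrays σ hitᵃ)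

  some-unhit : ∀ m {H hit x} → Σ< m (unhit H hit x) ≢ 0 → ∃[ j ] j < m × H j ≡ x × hit j ≡ 0
  some-unhit zero ne = ⊥-elim (ne refl)
  some-unhit (suc m) {H} {hit} {x} ne with H m ≟ x | hit m ≟ 0
  ... | yes e | yes h = m , n<1+n m , e , h
  ... | no ne′ | _ = let j , lt , r = some-unhit m {H} {hit} (λ z → ne (cong₂ _+_ (cong (λ v → v * isZero (hit m)) (δ-no ne′)) z)) in
                    j , m<n⇒m<1+n lt , r
  ... | yes _ | no h≢0 = let j , lt , r = some-unhit m {H} {hit} (λ z → ne (cong₂ _+_ (nonzero (hit m) h≢0) z)) in
                        j , m<n⇒m<1+n lt , r
    where
    nonzero : ∀ v → v ≢ 0 → δ (H m) x * isZero v ≡ 0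
    nonzero zero    h = ⊥-elim (h refl)
    nonzero (suc v) h = *-zeroʳ (δ (H m) x)

  saturated : ∀ τ → Finished τ → SaturatedOf τ
  saturated τ (c , p , p0 , b≤f) = record
    { unhit-nontrivial = λ { lt refl h0 e → trivial lt e h0 }
    ; unhit-blocked = λ { lt refl h0 → blocked lt h0 }
    ; hit-cause = λ lt h → let k , kl , ko , w = hit-why lt h in k , kl , ko , cause kl w
    ; cnt-zero = λ lt c0 → no-unhit {H = arrays τ headᵃ} {arrays τ hitᵃ} (trans (sym (count (inj₁ (_ , lt , refl)))) c0)
    ; cnt-nonzero = λ lt c≢0 → some-unhit (regs τ nRules) {arrays τ headᵃ} {arrays τ hitᵃ}
                                 (λ z → c≢0 (trans (count (inj₁ (_ , lt , refl))) z))
    }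
    where
    open Core c
    E = arrays τ elemᵃ
    O = arrays τ ownᵃ
    added = arrays τ addedᵃ
    cause : ∀ {k h} → k < regs τ nCells → E k ≡ h ⊎ added (E k) ≢ 0 → E k ≡ h ⊎ S (E k)
    cause lt (inj₁ e) = inj₁ e
    cause lt (inj₂ a) = inj₂ (proj₂ (proj₂ (sound (inj₁ (_ , lt , refl)) a)))
    not-added : ∀ {k} → k < regs τ nCells → arrays τ hitᵃ (O k) ≡ 0 → ¬ (added (E k) ≢ 0)
    not-added lt h0 a with seen lt a
    ... | inj₁ a1 = let q , f≤ , q< , _ = queued lt a1 in <⇒≱ q< (≤-trans b≤f f≤)
    ... | inj₂ (inj₁ h) = h h0
    ... | inj₂ (inj₂ (_ , k<p)) = <⇒≱ k<p (≤-trans (≤-reflexive p0) z≤n)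
    blocked : ∀ {k} → k < regs τ nCells → arrays τ hitᵃ (O k) ≡ 0 →
              Body (regs τ nCells) (regs τ iʳ) E O (E k) ⊎
              (∃[ j ] j < regs τ nRules × arrays τ headᵃ j ≡ E k × arrays τ hitᵃ j ≡ 0)
    blocked {k} lt h0 with arrays τ inᵃ (E k) ≟ 0 | arrays τ cntᵃ (E k) ≟ 0
    ... | no i≢0 | _ = inj₁ (in⁻ (inj₁ (k , lt , refl)) i≢0)
    ... | yes _  | no c≢0 = inj₂ (some-unhit (regs τ nRules) {arrays τ headᵃ} {arrays τ hitᵃ}
                                    (λ z → c≢0 (trans (count (inj₁ (k , lt , refl))) z)))
    ... | yes i0 | yes c0 = ⊥-elim (not-added lt h0 (Pending.found p lt i0 c0))

  closure-ok : ∀ σ → TablesOf σ → SaturatedOf (⟦ closure ⟧ σ)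
  closure-ok σ t = subst (λ c → SaturatedOf (⟦ c ⟧ σ)) (sym closure-def)
    (sequence setup saturate SaturatedOf σ
      (saturated (⟦ saturate ⟧ (⟦ setup ⟧ σ)) (saturate-ok (⟦ setup ⟧ σ) (setup-ok σ t))))

-- Reading the input

At : (ℕ → ℕ) → ℕ → List ℕ → Set
At f o []      = ⊤
At f o (x ∷ v) = f o ≡ x × At f (suc o) v

at-nth : ∀ v {f o} → (∀ i → f (o + i) ≡ nth v i) → At f o v
at-nth []      e = tt
at-nth (x ∷ v) {f} {o} e = trans (cong f (sym (+-identityʳ o))) (e 0) ,
  at-nth v (λ i → trans (cong f (sym (+-suc o i))) (e (suc i)))

at-++⁻ : ∀ u {v f o} → At f o (u ++ v) → At f o u × At f (o + length u) v
at-++⁻ [] {v} {f} {o} a = tt , subst (λ o → At f o v) (sym (+-identityʳ o)) a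
at-++⁻ (x ∷ u) {v} {f} {o} (e , a) with at-++⁻ u a
... | b , c = (e , b) , subst (λ o → At f o v) (sym (+-suc o (length u))) c

at-++⁺ : ∀ u {v f o} → At f o u → At f (o + length u) v → At f o (u ++ v)
at-++⁺ [] {v} {f} {o} _ a = subst (λ o → At f o v) (+-identityʳ o) a
at-++⁺ (x ∷ u) {v} {f} {o} (e , b) c = e , at-++⁺ u b (subst (λ o → At f o v) (+-suc o (length u)) c)

at-cong : ∀ v {f g o} → (∀ {i} → o ≤ i → i < o + length v → f i ≡ g i) → At f o v → At g o v
at-cong [] e a = tt
at-cong (x ∷ v) {o = o} e (p , a) = trans (sym (e ≤-refl (m<m+n o (s≤s z≤n)))) p ,
  at-cong v (λ le lt → e (<⇒≤ le) (≤-trans lt (≤-reflexive (sym (+-suc o (length v)))))) a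

at-lookup : ∀ {A : Set} (h : A → ℕ) xs {f o k} → At f o (map h xs) → o ≤ k → k < o + length xs →
            ∃[ i ] k ≡ o + toℕ i × f k ≡ h (lookup xs i)
at-lookup h [] {o = o} a le lt = ⊥-elim (<⇒≱ lt (≤-trans (≤-reflexive (+-identityʳ o)) le))
at-lookup h (x ∷ xs) {f} {o} {k} (e , a) le lt with o ≟ k
... | yes refl = zero , sym (+-identityʳ o) , e
... | no ne with at-lookup h xs a (≤∧≢⇒< le ne) (≤-trans lt (≤-reflexive (+-suc o (length xs))))
...   | i , p , q = suc i , trans p (sym (+-suc o (toℕ i))) , q

at-lookup⁺ : ∀ {A : Set} (h : A → ℕ) xs {f o} → At f o (map h xs) → ∀ i → f (o + toℕ i) ≡ h (lookup xs i)
at-lookup⁺ h (x ∷ xs) {f} {o} (e , a) zero    = trans (cong f (+-identityʳ o)) e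
at-lookup⁺ h (x ∷ xs) {f} {o} (e , a) (suc i) = trans (cong f (+-suc o (toℕ i))) (at-lookup⁺ h xs a i)

unique-lookup : ∀ {A : Set} {xs : List A} → Unique xs → ∀ {i j} → lookup xs i ≡ lookup xs j → i ≡ j
unique-lookup (_ ∷ _) {zero}  {zero}  _ = refl
unique-lookup (a ∷ _) {zero}  {suc j} e = ⊥-elim (All.lookup a (List.∈-lookup j) e)
unique-lookup (a ∷ _) {suc i} {zero}  e = ⊥-elim (All.lookup a (List.∈-lookup i) (sym e))
unique-lookup (_ ∷ u) {suc i} {suc j} e = cong suc (unique-lookup u e)

unique-length : ∀ {n} {xs : List (Fin n)} {A : Subset n} → Unique xs → (∀ {x} → x List.∈ xs → x ∈ A) → length xs ≤ ∣ A ∣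
unique-length [] f = z≤n
unique-length {xs = x ∷ xs} {A} (a ∷ u) f =
  ≤-trans (s≤s (unique-length {A = A - x} u (λ m → x∈p∧x≢y⇒x∈p-y (f (there m)) (λ e → All.lookup a m (sym e)))))
          (x∈p⇒∣p-x∣<∣p∣ (f (here refl)))

readʳ lenʳ tʳ : ℕ
readʳ = 12
lenʳ  = 13
tʳ    = 14

-- Address 0 of the input holds the size of the ground set, so the number of rules stands at address
-- 1 and the first rule begins at address 2.
parseCell parseRule parse : Code
parseCell = elemᵃ [ reg nCells ]:= inputᵃ [ reg readʳ ] ,, ownᵃ [ reg nCells ]:= reg jʳ ,,
            nCells := succ′ (reg nCells) ,, readʳ := succ′ (reg readʳ)
parseRule = (headᵃ [ reg jʳ ]:= inputᵃ [ reg readʳ ] ,, lenʳ := inputᵃ [ succ′ (reg readʳ) ] ,,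
             readʳ := succ′ (succ′ (reg readʳ))) ,,
            for tʳ lenʳ parseCell
parse     = (nRules := inputᵃ [ lit 1 ] ,, nCells := lit 0 ,, readʳ := lit 2) ,, for jʳ nRules parseRule

record RowRead (σ τ : State) (v : List ℕ) : Set where
  field
    elems  : At (arrays τ elemᵃ) (regs σ nCells) v
    owners : ∀ {k} → regs σ nCells ≤ k → k < regs τ nCells → arrays τ ownᵃ k ≡ regs σ jʳ
    elemsˢ : ∀ {k} → k < regs σ nCells → arrays τ elemᵃ k ≡ arrays σ elemᵃ k
    ownsˢ  : ∀ {k} → k < regs σ nCells → arrays τ ownᵃ k ≡ arrays σ ownᵃ k
    count  : regs τ nCells ≡ regs σ nCells + length v
    read   : regs τ readʳ ≡ regs σ readʳ + length v

parseCells-ok : ∀ v σ → At (arrays σ inputᵃ) (regs σ readʳ) v → RowRead σ (iter (next tʳ parseCell) (length v) σ) v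
parseCells-ok [] σ a = record
  { elems = tt ; owners = λ le lt → ⊥-elim (<⇒≱ lt le) ; elemsˢ = λ _ → refl ; ownsˢ = λ _ → refl
  ; count = sym (+-identityʳ _) ; read = sym (+-identityʳ _) }
parseCells-ok (x ∷ v) σ (e , a) = record
  { elems = trans (R.elemsˢ (n<1+n N)) (trans (upd-eq (arrays σ elemᵃ) refl) e) , R.elems
  ; owners = owners
  ; elemsˢ = λ lt → trans (R.elemsˢ (m<n⇒m<1+n lt)) (upd-neq (arrays σ elemᵃ) (<⇒≢ lt))
  ; ownsˢ = λ lt → trans (R.ownsˢ (m<n⇒m<1+n lt)) (upd-neq (arrays σ ownᵃ) (<⇒≢ lt))
  ; count = trans R.count (sym (+-suc N (length v)))
  ; read = trans R.read (sym (+-suc (regs σ readʳ) (length v))) }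
  where
  N = regs σ nCells
  σ₁ = next tʳ parseCell σ
  τ = iter (next tʳ parseCell) (length v) σ₁
  module R = RowRead (parseCells-ok v σ₁ a)
  owners : ∀ {k} → N ≤ k → k < regs τ nCells → arrays τ ownᵃ k ≡ regs σ jʳ
  owners {k} le lt with k ≟ N
  ... | yes refl = trans (R.ownsˢ (n<1+n N)) (upd-eq (arrays σ ownᵃ) refl)
  ... | no ne    = R.owners (≤∧≢⇒< le (λ e → ne (sym e))) lt

record RuleRead (σ τ : State) (q : ℕ) (v : List ℕ) : Set where
  field
    elems  : At (arrays τ elemᵃ) (regs σ nCells) v
    owners : ∀ {k} → regs σ nCells ≤ k → k < regs τ nCells → arrays τ ownᵃ k ≡ regs σ jʳ
    elemsˢ : ∀ {k} → k < regs σ nCells → arrays τ elemᵃ k ≡ arrays σ elemᵃ k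
    ownsˢ  : ∀ {k} → k < regs σ nCells → arrays τ ownᵃ k ≡ arrays σ ownᵃ k
    count  : regs τ nCells ≡ regs σ nCells + length v
    read   : regs τ readʳ ≡ suc (suc (regs σ readʳ)) + length v
    input  : arrays τ inputᵃ ≡ arrays σ inputᵃ
    heads  : arrays τ headᵃ ≡ arrays σ headᵃ [ regs σ jʳ ↦ q ]

parseRule-ok : ∀ q v σ → At (arrays σ inputᵃ) (regs σ readʳ) (q ∷ length v ∷ v) →
               RuleRead σ (next jʳ parseRule σ) q v
parseRule-ok q v σ (e , l , a) = go (regs σ₁ lenʳ) l
  where
  σ₁ = setReg tʳ 0 (⟦ headᵃ [ reg jʳ ]:= inputᵃ [ reg readʳ ] ,, lenʳ := inputᵃ [ succ′ (reg readʳ) ] ,,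
                      readʳ := succ′ (succ′ (reg readʳ)) ⟧ σ)
  go : ∀ r → r ≡ length v → RuleRead σ (setReg jʳ (suc (regs σ jʳ)) (iter (next tʳ parseCell) r σ₁)) q v
  go _ refl = record
    { elems = R.elems ; owners = R.owners ; elemsˢ = R.elemsˢ ; ownsˢ = R.ownsˢ ; count = R.count ; read = R.read
    ; input = iter-frame (λ τ → arrays τ inputᵃ) (next tʳ parseCell) (λ _ → refl) (length v) σ₁
    ; heads = trans (iter-frame (λ τ → arrays τ headᵃ) (next tʳ parseCell) (λ _ → refl) (length v) σ₁)
                    (cong (λ q → arrays σ headᵃ [ regs σ jʳ ↦ q ]) e)
    }
    where module R = RowRead (parseCells-ok v σ₁ a)

-- Tables of rules

module _ {n : ℕ} where

  -- The offsets `j₀` and `k₀` make the table of the remaining rules a part of the whole table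
  -- without renumbering. `separated` expresses that bodies are listed without repetition; it is
  -- what keeps the output free of repetitions within a body.
  record Table (j₀ k₀ N : ℕ) (H E O : ℕ → ℕ) (R : List (Rule n)) : Set where
    field
      ordered   : k₀ ≤ N
      heads     : ∀ j → H (j₀ + toℕ j) ≡ toℕ (proj₂ (lookup R j))
      cells⁻    : ∀ {k} → k₀ ≤ k → k < N →
                  ∃[ j ] O k ≡ j₀ + toℕ j × (∃[ x ] E k ≡ toℕ x × x ∈ proj₁ (lookup R j))
      cells⁺    : ∀ j {x} → x ∈ proj₁ (lookup R j) →
                  ∃[ k ] k₀ ≤ k × k < N × O k ≡ j₀ + toℕ j × E k ≡ toℕ x
      separated : ∀ {k k′} → k₀ ≤ k → k < N → k₀ ≤ k′ → k′ < N → O k ≡ O k′ → E k ≡ E k′ → k ≡ k′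

  nil-table : ∀ {j k H E O} → Table j k k H E O []
  nil-table = record
    { ordered = ≤-refl ; heads = λ () ; cells⁻ = λ le lt → ⊥-elim (<⇒≱ lt le) ; cells⁺ = λ ()
    ; separated = λ le lt → ⊥-elim (<⇒≱ lt le) }

  cons-table : ∀ {j₀ k₀ N H E O A q R xs} → Enumerates xs (_∈ A) → H j₀ ≡ toℕ q →
               At E k₀ (map toℕ xs) → (∀ {k} → k₀ ≤ k → k < k₀ + length xs → O k ≡ j₀) →
               Table (suc j₀) (k₀ + length xs) N H E O R → Table j₀ k₀ N H E O ((A , q) ∷ R)
  cons-table {j₀} {k₀} {N} {H} {E} {O} {A} {q} {R} {xs} (u , members) hq a own t = record
    { ordered = ≤-trans (m≤m+n k₀ (length xs)) T.ordered
    ; heads = heads ; cells⁻ = cells⁻ ; cells⁺ = cells⁺ ; separated = separated }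
    where
    module T = Table t
    k₁ = k₀ + length xs
    heads : ∀ j → H (j₀ + toℕ j) ≡ toℕ (proj₂ (lookup ((A , q) ∷ R) j))
    heads zero    = trans (cong H (+-identityʳ j₀)) hq
    heads (suc j) = trans (cong H (+-suc j₀ (toℕ j))) (T.heads j)
    cells⁻ : ∀ {k} → k₀ ≤ k → k < N →
             ∃[ j ] O k ≡ j₀ + toℕ j × (∃[ x ] E k ≡ toℕ x × x ∈ proj₁ (lookup ((A , q) ∷ R) j))
    cells⁻ {k} le lt with k <? k₁
    ... | yes lt₁ = let i , _ , e = at-lookup toℕ xs a le lt₁ in
      zero , trans (own le lt₁) (sym (+-identityʳ j₀)) , lookup xs i , e ,
      Equivalence.to (members (lookup xs i)) (List.∈-lookup i)
    ... | no ¬lt₁ = let j , e , r = T.cells⁻ (≮⇒≥ ¬lt₁) lt in suc j , trans e (sym (+-suc j₀ (toℕ j))) , r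
    cells⁺ : ∀ j {x} → x ∈ proj₁ (lookup ((A , q) ∷ R) j) → ∃[ k ] k₀ ≤ k × k < N × O k ≡ j₀ + toℕ j × E k ≡ toℕ x
    cells⁺ zero {x} m = k₀ + toℕ i , m≤m+n k₀ (toℕ i) , ≤-trans inside T.ordered ,
      trans (own (m≤m+n k₀ (toℕ i)) inside) (sym (+-identityʳ j₀)) ,
      trans (at-lookup⁺ toℕ xs a i) (cong toℕ (sym (Any.lookup-index x∈)))
      where
      x∈ = Equivalence.from (members x) m
      i  = index x∈
      inside : k₀ + toℕ i < k₁
      inside = +-monoʳ-< k₀ (Fin.toℕ<n i)
    cells⁺ (suc j) m = let k , le , lt , o , e = T.cells⁺ j m in
      k , ≤-trans (m≤m+n k₀ (length xs)) le , lt , trans o (sym (+-suc j₀ (toℕ j))) , e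
    apart : ∀ {k k′} → k₀ ≤ k → k < k₁ → k₁ ≤ k′ → k′ < N → O k ≢ O k′
    apart le lt le′ lt′ e with T.cells⁻ le′ lt′
    ... | j , o , _ = <⇒≢ (m≤m+n (suc j₀) (toℕ j)) (trans (sym (own le lt)) (trans e o))
    separated : ∀ {k k′} → k₀ ≤ k → k < N → k₀ ≤ k′ → k′ < N → O k ≡ O k′ → E k ≡ E k′ → k ≡ k′
    separated {k} {k′} le lt le′ lt′ o e with k <? k₁ | k′ <? k₁
    ... | no a    | no b    = T.separated (≮⇒≥ a) lt (≮⇒≥ b) lt′ o e
    ... | yes lt₁ | no b    = ⊥-elim (apart le lt₁ (≮⇒≥ b) lt′ o)
    ... | no b    | yes lt₁ = ⊥-elim (apart le′ lt₁ (≮⇒≥ b) lt (sym o))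
    ... | yes lt₁ | yes lt₂ with at-lookup toℕ xs a le lt₁ | at-lookup toℕ xs a le′ lt₂
    ...   | i , p , r | i′ , p′ , r′ = trans p (trans (cong (λ i → k₀ + toℕ i) same) (sym p′))
      where same = unique-lookup u {i} {i′} (Fin.toℕ-injective (trans (sym r) (trans e r′)))

  iterCost-const : ∀ f (g : State → ℕ) {c} → (∀ τ → g τ ≡ c) → ∀ r σ → iterCost f g r σ ≡ 4 + r * (7 + c)
  iterCost-const f g e zero    σ = refl
  iterCost-const f g {c} e (suc r) σ = trans (cong₂ (λ a b → 4 + ((a + 3) + b)) (e σ) (iterCost-const f g e r (f σ)))
    (regroup c r)
    where
    regroup : ∀ c r → 4 + ((c + 3) + (4 + r * (7 + c))) ≡ 4 + (suc r * (7 + c))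
    regroup = solve-∀

  -- 18 is made up of 12 for the three assignments, 2 for the reset of the counter and 4 for the
  -- last test. 20 is made up of 13 for `parseCell` and 7 for the overhead of a round.
  parseRule-cost : ∀ q v σ → At (arrays σ inputᵃ) (regs σ readʳ) (q ∷ length v ∷ v) → cost parseRule σ ≡ 18 + length v * 20
  parseRule-cost q v σ (e , l , a) = cong (14 +_)
    (trans (iterCost-const (next tʳ parseCell) (cost parseCell) (λ _ → refl) (arrays σ inputᵃ (suc (regs σ readʳ))) _)
           (cong (λ r → 4 + r * 20) l))

  record Parsed (σ τ : State) (R : List (Rule n)) : Set where
    field
      table  : Table (regs σ jʳ) (regs σ nCells) (regs τ nCells) (arrays τ headᵃ) (arrays τ elemᵃ) (arrays τ ownᵃ) R
      headsˢ : ∀ {j} → j < regs σ jʳ → arrays τ headᵃ j ≡ arrays σ headᵃ j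
      elemsˢ : ∀ {k} → k < regs σ nCells → arrays τ elemᵃ k ≡ arrays σ elemᵃ k
      ownsˢ  : ∀ {k} → k < regs σ nCells → arrays τ ownᵃ k ≡ arrays σ ownᵃ k
      size   : regs τ nCells + length R ≤ regs σ nCells + inputSize R

  -- The inner loop is bounded by the length just read, so the syntactic bound would not apply;
  -- instead the lengths are added up. A rule costs 18 + 7 = 25 and each of its cells 20, hence at
  -- most 25 for each unit of input size.
  parseRules-ok : ∀ {R w} → EncodesRules R w → ∀ σ → At (arrays σ inputᵃ) (regs σ readʳ) w →
                  Parsed σ (iter (next jʳ parseRule) (length R) σ) R ×
                  iterCost (next jʳ parseRule) (cost parseRule) (length R) σ ≤ 4 + 25 * inputSize R
  parseRules-ok [] σ a = record
    { table = nil-table ; headsˢ = λ _ → refl ; elemsˢ = λ _ → refl ; ownsˢ = λ _ → refl ; size = ≤-refl } , ≤-refl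
  parseRules-ok {(A , q) ∷ R} (add {xs = xs} {w = w} en code) σ a = record
    { table = cons-table en
        (trans (P.headsˢ (n<1+n j)) (trans (cong-app heads j) (upd-eq (arrays σ headᵃ) refl)))
        (at-cong (map toℕ xs) (λ _ lt → sym (P.elemsˢ (≤-trans lt (≤-reflexive (sym count))))) elems)
        (λ le lt → let lt′ = ≤-trans lt (≤-reflexive (sym k₁)) in trans (P.ownsˢ lt′) (owners le lt′))
        (subst (λ k → Table (suc j) k (regs τ nCells) (arrays τ headᵃ) (arrays τ elemᵃ) (arrays τ ownᵃ) R) k₁ P.table)
    ; headsˢ = λ lt → trans (P.headsˢ (m<n⇒m<1+n lt)) (trans (cong-app heads _) (upd-neq (arrays σ headᵃ) (<⇒≢ lt)))
    ; elemsˢ = λ lt → trans (P.elemsˢ (up lt)) (elemsˢ lt)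
    ; ownsˢ = λ lt → trans (P.ownsˢ (up lt)) (ownsˢ lt)
    ; size = size } , paid
    where
    v = map toℕ xs
    len : length v ≡ length xs
    len = List.length-map toℕ xs
    split : At (arrays σ inputᵃ) (regs σ readʳ) (toℕ q ∷ length v ∷ v) × At (arrays σ inputᵃ) (suc (suc (regs σ readʳ)) + length v) w
    split = let e , l , b = a in (e , trans l (sym len) , proj₁ (at-++⁻ v b)) , proj₂ (at-++⁻ v b)
    σ₁ = next jʳ parseRule σ
    open RuleRead (parseRule-ok (toℕ q) v σ (proj₁ split))
    at₁ : At (arrays σ₁ inputᵃ) (regs σ₁ readʳ) w
    at₁ = subst₂ (λ f o → At f o w) (sym input) (sym read) (proj₂ split)
    rest = parseRules-ok code σ₁ at₁
    module P = Parsed (proj₁ rest)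
    τ = iter (next jʳ parseRule) (length R) σ₁
    j = regs σ jʳ
    k₁ : regs σ₁ nCells ≡ regs σ nCells + length xs
    k₁ = trans count (cong (regs σ nCells +_) len)
    up : ∀ {k} → k < regs σ nCells → k < regs σ₁ nCells
    up lt = ≤-trans lt (≤-trans (m≤m+n _ (length v)) (≤-reflexive (sym count)))
    fits : length xs ≤ ∣ A ∣
    fits = unique-length (proj₁ en) (λ {x} m → Equivalence.to (proj₂ en x) m)
    size : regs τ nCells + suc (length R) ≤ regs σ nCells + (∣ A ∣ + 1 + inputSize R)
    size = begin
      regs τ nCells + suc (length R)                      ≡⟨ +-suc _ _ ⟩
      suc (regs τ nCells + length R)                      ≤⟨ s≤s P.size ⟩
      suc (regs σ₁ nCells + inputSize R)                  ≡⟨ cong (λ k → suc (k + inputSize R)) k₁ ⟩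
      suc (regs σ nCells + length xs + inputSize R)       ≡⟨ move (regs σ nCells) (length xs) (inputSize R) ⟩
      regs σ nCells + (length xs + 1 + inputSize R)       ≤⟨ +-monoʳ-≤ (regs σ nCells) (+-monoˡ-≤ (inputSize R) (+-monoˡ-≤ 1 fits)) ⟩
      regs σ nCells + (∣ A ∣ + 1 + inputSize R)           ∎
      where
      open ≤-Reasoning
      move : ∀ a b c → suc (a + b + c) ≡ a + (b + 1 + c)
      move = solve-∀
    paid : 4 + ((cost parseRule σ + 3) + iterCost (next jʳ parseRule) (cost parseRule) (length R) σ₁) ≤
           4 + 25 * (∣ A ∣ + 1 + inputSize R)
    paid = begin
      4 + ((cost parseRule σ + 3) + iterCost (next jʳ parseRule) (cost parseRule) (length R) σ₁)
        ≤⟨ +-monoʳ-≤ 4 (+-mono-≤ (≤-reflexive (cong (_+ 3) (parseRule-cost (toℕ q) v σ (proj₁ split)))) (proj₂ rest)) ⟩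
      4 + ((18 + length v * 20 + 3) + (4 + 25 * inputSize R))
        ≡⟨ cong (λ l → 4 + ((18 + l * 20 + 3) + (4 + 25 * inputSize R))) len ⟩
      4 + ((18 + length xs * 20 + 3) + (4 + 25 * inputSize R))
        ≤⟨ m≤m+n _ (5 * length xs) ⟩
      4 + ((18 + length xs * 20 + 3) + (4 + 25 * inputSize R)) + 5 * length xs
        ≡⟨ move (length xs) (inputSize R) ⟩
      4 + 25 * (length xs + 1 + inputSize R)
        ≤⟨ +-monoʳ-≤ 4 (*-monoʳ-≤ 25 (+-monoˡ-≤ (inputSize R) (+-monoˡ-≤ 1 fits))) ⟩
      4 + 25 * (∣ A ∣ + 1 + inputSize R) ∎
      where
      open ≤-Reasoning
      move : ∀ x i → 4 + ((18 + x * 20 + 3) + (4 + 25 * i)) + 5 * x ≡ 4 + 25 * (x + 1 + i)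
      move = solve-∀

  record Input (σ : State) (R : List (Rule n)) : Set where
    field
      rules : regs σ nRules ≡ length R
      table : Table 0 0 (regs σ nCells) (arrays σ headᵃ) (arrays σ elemᵃ) (arrays σ ownᵃ) R
      size  : regs σ nCells + length R ≤ inputSize R

  -- 13 = 7 + 2 + 4: the three assignments, the reset of the loop counter and the last test.
  parse-ok : ∀ {R w} → Encodes R w → let σ = initial (n ∷ w) in
             Input (⟦ parse ⟧ σ) R × cost parse σ ≤ 13 + 25 * inputSize R
  parse-ok {R} (encodes {w} code) = record
    { rules = frameR (for jʳ nRules parseRule) nRules refl σ₀
    ; table = Parsed.table (proj₁ r)
    ; size = Parsed.size (proj₁ r) } , +-monoʳ-≤ 9 (proj₂ r)
    where
    σ₀ = ⟦ nRules := inputᵃ [ lit 1 ] ,, nCells := lit 0 ,, readʳ := lit 2 ⟧ (initial (n ∷ length R ∷ w))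
    r = parseRules-ok code (setReg jʳ 0 σ₀) (at-nth w (λ i → refl))

-- Critical rules

module _ {n : ℕ} where

  setOf : {P : Pred (Fin n) 0ℓ} → Decidable P → Subset n
  setOf P? = tabulate (λ x → does (P? x))

  ∈-setOf⁺ : ∀ {P : Pred (Fin n) 0ℓ} (P? : Decidable P) {x} → P x → x ∈ setOf P?
  ∈-setOf⁺ P? {x} p = Vec.lookup⇒[]= x _ (trans (Vec.lookup∘tabulate _ x) (dec-true (P? x) p))

  ∈-setOf⁻ : ∀ {P : Pred (Fin n) 0ℓ} (P? : Decidable P) {x} → x ∈ setOf P? → P x
  ∈-setOf⁻ P? {x} m with P? x | trans (sym (Vec.lookup∘tabulate (λ y → does (P? y)) x)) (Vec.[]=⇒lookup m)
  ... | yes p | _ = p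
  ... | no _  | ()

  ∉─ : ∀ (p q : Subset n) {x} → x ∈ p ─ q → x ∉ q
  ∉─ p q {x} m = go p q m
    where
    go : ∀ {k} (p q : Subset k) {x} → x ∈ p ─ q → x ∉ q
    go (_ ∷ p) (outside ∷ q) here ()
    go (_ ∷ p) (_ ∷ q) (there m) (there m′) = go p q m m′

  ∣p∣≡0⇒∉ : ∀ {k} {p : Subset k} {x} → ∣ p ∣ ≡ 0 → x ∉ p
  ∣p∣≡0⇒∉ {p = p} {x} e m = <⇒≱ (≤-trans (s≤s z≤n) (x∈p⇒∣p-x∣<∣p∣ m)) (≤-reflexive e)

  singleton-unique : ∀ {p : Subset n} {x y} → ∣ p ∣ ≡ 1 → x ∈ p → y ∈ p → x ≡ y
  singleton-unique {p} {x} {y} e mx my with x Fin.≟ y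
  ... | yes x≡y = x≡y
  ... | no x≢y = ⊥-elim (∣p∣≡0⇒∉ (n≤0⇒n≡0 (≤-pred (≤-trans (x∈p⇒∣p-x∣<∣p∣ mx) (≤-reflexive e))))
                          (x∈p∧x≢y⇒x∈p-y my (λ e → x≢y (sym e))))

  -- Feasible sets and the closure operator

  module _ (R : List (Rule n)) where

    Index : Set
    Index = Fin (length R)

    body : Index → Subset n
    body j = proj₁ (lookup R j)

    head : Index → Fin n
    head j = proj₂ (lookup R j)

    accepts : ∀ {X} → 𝓚 R X → ∀ j → head j ∈ X → Nonempty (X ∩ body j)
    accepts k j = All.lookup k (List.∈-lookup j)

    accepts⁺ : ∀ {X} → (∀ j → head j ∈ X → Nonempty (X ∩ body j)) → 𝓚 R X
    accepts⁺ {X} f = All.tabulate λ {ρ} m →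
      subst (λ ρ → Accepts ρ X) (sym (Any.lookup-index m)) (f (index m))

    -- The condition under which `x` can be added to a feasible set `S`. Rules whose body contains
    -- their head are left out, because they accept every set.
    Allows : (Fin n → Set) → Fin n → Set
    Allows S x = ∀ j → head j ≡ x → head j ∉ body j → ∃[ y ] y ∈ body j × S y

    extend : ∀ {X} → 𝓐 R X → ∀ {x} → Allows (_∈ X) x → 𝓐 R (X ∪ ⁅ x ⁆)
    extend {X} (kX , path) {x} allowed with x ∈? X
    ... | yes x∈X = subst (𝓐 R) (⊆-antisym (p⊆p∪q ⁅ x ⁆) absorb) (kX , path)
      where
      absorb : X ∪ ⁅ x ⁆ ⊆ X
      absorb m with x∈p∪q⁻ X ⁅ x ⁆ m
      ... | inj₁ m′ = m′
      ... | inj₂ m′ = subst (_∈ X) (sym (x∈⁅y⁆⇒x≡y x m′)) x∈X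
    ... | no x∉X = kZ , step path kZ (p⊆p∪q ⁅ x ⁆) (trans (cong ∣_∣ new) (∣⁅x⁆∣≡1 x))
      where
      Z = X ∪ ⁅ x ⁆
      x∈Z : x ∈ Z
      x∈Z = x∈p∪q⁺ (inj₂ (x∈⁅x⁆ x))
      acc : ∀ j → head j ∈ Z → Nonempty (Z ∩ body j)
      acc j m with x∈p∪q⁻ X ⁅ x ⁆ m
      ... | inj₁ m′ with accepts kX j m′
      ...   | y , my = y , x∈p∩q⁺ (p⊆p∪q ⁅ x ⁆ (proj₁ (x∈p∩q⁻ X (body j) my)) , proj₂ (x∈p∩q⁻ X (body j) my))
      acc j m | inj₂ m′ with head j ∈? body j
      ... | yes t = head j , x∈p∩q⁺ (m , t)
      ... | no ¬t with allowed j (x∈⁅y⁆⇒x≡y x m′) ¬t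
      ...   | y , y∈b , y∈X = y , x∈p∩q⁺ (p⊆p∪q ⁅ x ⁆ y∈X , y∈b)
      kZ : 𝓚 R Z
      kZ = accepts⁺ acc
      new : Z ─ X ≡ ⁅ x ⁆
      new = ⊆-antisym to from
        where
        to : Z ─ X ⊆ ⁅ x ⁆
        to m with x∈p∪q⁻ X ⁅ x ⁆ (p─q⊆p Z X m)
        ... | inj₁ m′ = ⊥-elim (∉─ Z X m m′)
        ... | inj₂ m′ = m′
        from : ⁅ x ⁆ ⊆ Z ─ X
        from {y} m rewrite x∈⁅y⁆⇒x≡y x m = x∈p∧x∉q⇒x∈p─q x∈Z x∉X

    Valid : (Fin n → Set) → Index → Set
    Valid T j = head j ∉ body j × (∀ {x} → x ∈ body j → T x)

    -- The first element of T along a tight path would violate the rule with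
    -- that head, because the body of the rule is still untouched.
    no-entry : ∀ {X} (T : Fin n → Set) → 𝓐 R X →
               (∀ {x} → x ∈ X → T x → ∃[ j ] head j ≡ x × Valid T j) →
               ∀ {x} → x ∈ X → ¬ T x
    no-entry {X} T (_ , path) = go path
      where
      go : ∀ {Z} → TightPath (𝓚 R) ⊥ Z →
           (∀ {x} → x ∈ Z → T x → ∃[ j ] head j ≡ x × Valid T j) →
           ∀ {x} → x ∈ Z → ¬ T x
      go (stay _) h m t = ∉⊥ m
      go (step {Y = Y} {Z} p kZ Y⊆Z one) h {x} m t
        with h m t
      ... | j , refl , nt , b⊆T with accepts kZ j m
      ...   | y , my = nt (subst (_∈ body j) (singleton-unique one (fresh y∈Z (b⊆T y∈b)) (fresh m t)) y∈b)
        where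
        y∈Z = proj₁ (x∈p∩q⁻ Z (body j) my)
        y∈b = proj₂ (x∈p∩q⁻ Z (body j) my)
        fresh : ∀ {z} → z ∈ Z → T z → z ∈ Z ─ Y
        fresh mz tz = x∈p∧x∉q⇒x∈p─q mz (λ mY → go p (λ m′ t′ → h (Y⊆Z m′) t′) mY tz)

    allows? : ∀ {S} → Decidable S → Decidable (Allows S)
    allows? S? x = Fin.all? λ j → (head j Fin.≟ x) →-dec (¬? (head j ∈? body j) →-dec
                     Fin.any? λ y → (y ∈? body j) ×-dec S? y)

    Closed : Subset n → (Fin n → Set) → Set
    Closed W S = ∀ {x} → x ∉ W → Allows S x → S x

    -- Greedy extension by single elements outside `W`. The size grows with each step and cannot
    -- exceed `n`, which bounds the fuel. That the result does not depend on the choices is a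
    -- consequence of `outside-hull`.
    grow : ∀ (W : Subset n) fuel {X} → 𝓐 R X → (∀ {x} → x ∈ X → x ∉ W) → n ≤ fuel + ∣ X ∣ →
           ∃[ X′ ] 𝓐 R X′ × (∀ {x} → x ∈ X′ → x ∉ W) × Closed W (_∈ X′)
    grow W fuel {X} a av le with Fin.any? (λ x → ¬? (x ∈? W) ×-dec (¬? (x ∈? X) ×-dec allows? (_∈? X) x))
    ... | no none = X , a , av , λ {x} x∉W al → decidable-stable (x ∈? X) (λ x∉X → none (x , x∉W , x∉X , al))
    grow W zero {X} a av le | yes (x , x∉W , x∉X , al) =
      ⊥-elim (<⇒≱ (p⊂q⇒∣p∣<∣q∣ {p = X} {X ∪ ⁅ x ⁆} (p⊆p∪q ⁅ x ⁆ , x , x∈p∪q⁺ (inj₂ (x∈⁅x⁆ x)) , x∉X))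
                    (≤-trans (∣p∣≤n (X ∪ ⁅ x ⁆)) le))
    grow W (suc fuel) {X} a av le | yes (x , x∉W , x∉X , al) =
      grow W fuel (extend a al) av′
        (≤-trans le (≤-trans (≤-reflexive (sym (+-suc fuel ∣ X ∣)))
          (+-monoʳ-≤ fuel (p⊂q⇒∣p∣<∣q∣ {p = X} {X ∪ ⁅ x ⁆} (p⊆p∪q ⁅ x ⁆ , x , x∈p∪q⁺ (inj₂ (x∈⁅x⁆ x)) , x∉X)))))
      where
      av′ : ∀ {y} → y ∈ X ∪ ⁅ x ⁆ → y ∉ W
      av′ m with x∈p∪q⁻ X ⁅ x ⁆ m
      ... | inj₁ m′ = av m′
      ... | inj₂ m′ = subst (_∉ W) (sym (x∈⁅y⁆⇒x≡y x m′)) x∉W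

    empty-feasible : 𝓐 R ⊥
    empty-feasible = k , stay k
      where
      k : 𝓚 R ⊥
      k = accepts⁺ (λ j m → ⊥-elim (∉⊥ m))

    -- The closure of `W` as the complement of a feasible set that avoids `W`. `closed` is
    -- maximality in local form: no single further element outside `W` can be added to that feasible
    -- set.
    record Hull (W : Subset n) : Set where
      field
        set      : Subset n
        feasible : 𝓐 R (∁ set)
        contains : W ⊆ set
        closed   : Closed W (_∉ set)

    ∁∁ : ∀ (p : Subset n) → ∁ (∁ p) ≡ p
    ∁∁ p = ⊆-antisym (λ m → x∉∁p⇒x∈p (x∈∁p⇒x∉p m)) (λ m → x∉p⇒x∈∁p (x∈p⇒x∉∁p m))

    opaque
      hull : ∀ W → Hull W
      hull W with grow W n empty-feasible (λ m _ → ∉⊥ m) (m≤m+n n _)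
      ... | X , a , av , cl = record
        { set = ∁ X
        ; feasible = subst (𝓐 R) (sym (∁∁ X)) a
        ; contains = λ m → x∉p⇒x∈∁p (λ m′ → av m′ m)
        ; closed = λ x∉W al m → x∈∁p⇒x∉p m
            (cl x∉W (λ j e nt → let y , b , y∉ = al j e nt in y , b , decidable-stable (y ∈? X) (λ z → y∉ (x∉p⇒x∈∁p z))))
        }

    Convex : Subset n → Set
    Convex T = 𝓐 R (∁ T)

    *⇒convex : ∀ {Y} → ((𝓐 R) *) Y → Convex Y
    *⇒convex (X , a , refl) = subst (𝓐 R) (sym (∁∁ X)) a

    convex⇒* : ∀ {Y} → Convex Y → ((𝓐 R) *) Y
    convex⇒* {Y} c = ∁ Y , c , sym (∁∁ Y)

    module _ {W} (H : Hull W) where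
      open Hull H

      -- Each element of the hull outside `W` is the head of a valid rule with body in the hull,
      -- since otherwise `closed` would put it outside. So `no-entry` applies to the hull, and local
      -- maximality turns out to be global.
      outside-hull : ∀ {X} → 𝓐 R X → (∀ {x} → x ∈ X → x ∉ W) → ∀ {x} → x ∈ X → x ∉ set
      outside-hull {X} a av = no-entry (_∈ set) a blocked
        where
        blocked : ∀ {x} → x ∈ X → x ∈ set → ∃[ j ] head j ≡ x × Valid (_∈ set) j
        blocked {x} m t with Fin.any? (λ j → (head j Fin.≟ x) ×-dec (¬? (head j ∈? body j) ×-dec
                                             (body j ⊆? set)))
        ... | yes (j , e , nt , b) = j , e , nt , λ {y} → b {y}
        ... | no none = ⊥-elim (closed (av m) al t)
          where
          al : Allows (_∉ set) x
          al j e nt with Fin.any? (λ y → (y ∈? body j) ×-dec ¬? (y ∈? set))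
          ... | yes p = p
          ... | no ¬p = ⊥-elim (none (j , e , nt , λ {y} b → decidable-stable (y ∈? set) (λ q → ¬p (y , b , q))))

      hull-least : ∀ {Y} → Convex Y → W ⊆ Y → set ⊆ Y
      hull-least {Y} cY W⊆Y m = x∉∁p⇒x∈p (λ m′ → outside-hull cY (λ q w → x∈∁p⇒x∉p q (W⊆Y w)) m′ m)

      hull-closure : IsClosure (𝓐 R) W set
      hull-closure x = mk⇔ (λ m Y cY (W⊆Y : W ⊆ Y) → hull-least (*⇒convex cY) (λ {y} → W⊆Y {y}) m)
                           (λ f → f set (∁ set , feasible , sym (∁∁ set)) contains)

    closure-unique : ∀ {W T T′} → IsClosure (𝓐 R) W T → IsClosure (𝓐 R) W T′ → T ≡ T′
    closure-unique c c′ = ⊆-antisym (λ {x} m → Equivalence.from (c′ x) (Equivalence.to (c x) m))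
                                    (λ {x} m → Equivalence.from (c x) (Equivalence.to (c′ x) m))

    least-closure : ∀ {W T} → Convex T → W ⊆ T → (∀ {Y} → Convex Y → W ⊆ Y → T ⊆ Y) → IsClosure (𝓐 R) W T
    least-closure {W} {T} cT W⊆T least x =
      mk⇔ (λ m Y cY (W⊆Y : W ⊆ Y) → least {Y} (*⇒convex cY) W⊆Y m) (λ f → f T (convex⇒* cT) W⊆T)

    -- Extreme points

    Extreme : Subset n → Fin n → Set
    Extreme T s = ∀ j → head j ≡ s → ¬ Valid (_∈ T) j

    valid? : ∀ T → Decidable (Valid (_∈ T))
    valid? T j with (¬? (head j ∈? body j)) ×-dec (body j ⊆? T)
    ... | yes (nt , b) = yes (nt , λ {x} → b {x})
    ... | no ¬p = no (λ (nt , b) → ¬p (nt , λ {x} → b {x}))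

    extreme? : ∀ T → Decidable (Extreme T)
    extreme? T s = Fin.all? (λ j → (head j Fin.≟ s) →-dec ¬? (valid? T j))

    invalid⇒exit : ∀ {T j} → head j ∉ body j → ¬ Valid (_∈ T) j → ∃[ y ] y ∈ body j × y ∉ T
    invalid⇒exit {T} {j} nt ¬v with Fin.any? (λ y → (y ∈? body j) ×-dec ¬? (y ∈? T))
    ... | yes p = p
    ... | no ¬p = ⊥-elim (¬v (nt , λ {y} b → decidable-stable (y ∈? T) (λ q → ¬p (y , b , q))))

    -- With `convex⇒extreme` this shows that, for convex `T`, the condition on rules in `Extreme`
    -- characterises the elements whose removal leaves a convex set.
    extreme⇒convex : ∀ {T s} → Convex T → Extreme T s → Convex (T - s)
    extreme⇒convex {T} {s} cT ex = subst (𝓐 R) eq (extend cT al)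
      where
      al : Allows (_∈ ∁ T) s
      al j e nt with invalid⇒exit {T} nt (ex j e)
      ... | y , b , y∉ = y , b , x∉p⇒x∈∁p y∉
      eq : ∁ T ∪ ⁅ s ⁆ ≡ ∁ (T - s)
      eq = ⊆-antisym to from
        where
        to : ∁ T ∪ ⁅ s ⁆ ⊆ ∁ (T - s)
        to m with x∈p∪q⁻ (∁ T) ⁅ s ⁆ m
        ... | inj₁ m′ = x∉p⇒x∈∁p (λ d → x∈∁p⇒x∉p m′ (p─q⊆p T ⁅ s ⁆ d))
        ... | inj₂ m′ = x∉p⇒x∈∁p (λ d → ∉─ T ⁅ s ⁆ d m′)
        from : ∁ (T - s) ⊆ ∁ T ∪ ⁅ s ⁆
        from {x} m with x ∈? T | x ∈? ⁅ s ⁆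
        ... | _      | yes q = x∈p∪q⁺ (inj₂ q)
        ... | no q   | _     = x∈p∪q⁺ (inj₁ (x∉p⇒x∈∁p q))
        ... | yes q  | no q′ = ⊥-elim (x∈∁p⇒x∉p m (x∈p∧x∉q⇒x∈p─q q q′))

    convex-exit : ∀ {Y} → Convex Y → ∀ j → head j ∉ Y → ∃[ y ] y ∈ body j × y ∉ Y
    convex-exit {Y} cY j q∉Y with accepts (proj₁ cY) j (x∉p⇒x∈∁p q∉Y)
    ... | y , m = y , proj₂ (x∈p∩q⁻ (∁ Y) (body j) m) , x∈∁p⇒x∉p (proj₁ (x∈p∩q⁻ (∁ Y) (body j) m))

    convex⇒extreme : ∀ {T s} → Convex (T - s) → Extreme T s
    convex⇒extreme {T} {s} c j refl (nt , b⊆T) with convex-exit c j (λ m → ∉─ T ⁅ s ⁆ m (x∈⁅x⁆ s))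
    ... | y , b , y∉ = y∉ (x∈p∧x≢y⇒x∈p-y (b⊆T b) (λ e → nt (subst (_∈ body j) e b)))

    -- Critical rules as selected rules

    span : Index → Subset n
    span i = Hull.set (hull (body i))

    Misses : Index → Fin n → Set
    Misses i s = Extreme (span i) s × ∃[ j ] Valid (_∈ span i) j × head j ≡ head i × s ∉ body j

    Precedes : Index → Set
    Precedes i = ∃[ j ] Valid (_∈ span i) j × head j ≡ head i × j Fin.< i

    Selected : Index → Set
    Selected i = Valid (_∈ span i) i × (∀ {s} → s ∈ body i → ¬ Misses i s) × ¬ Precedes i

    tip? : ∀ i → Decidable (λ s → s ∈ body i × Extreme (span i) s)
    tip? i s = (s ∈? body i) ×-dec extreme? (span i) s

    opaque
      tips : Index → Subset n
      tips i = setOf (tip? i)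

      tips⁺ : ∀ {i s} → s ∈ body i → Extreme (span i) s → s ∈ tips i
      tips⁺ {i} b e = ∈-setOf⁺ (tip? i) (b , e)

      tips⁻ : ∀ {i s} → s ∈ tips i → s ∈ body i × Extreme (span i) s
      tips⁻ {i} = ∈-setOf⁻ (tip? i)

    span-convex : ∀ i → Convex (span i)
    span-convex i = Hull.feasible (hull (body i))

    body⊆span : ∀ {i} → body i ⊆ span i
    body⊆span {i} = Hull.contains (hull (body i))

    head∈span : ∀ {i} → head i ∉ body i → head i ∈ span i
    head∈span {i} nt with head i ∈? span i
    ... | yes m = m
    ... | no ¬m with convex-exit (span-convex i) i ¬m
    ...   | y , b , y∉ = ⊥-elim (y∉ (body⊆span b))

    module _ {i : Index} (nt : head i ∉ body i) where

      self-valid : Valid (_∈ span i) i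
      self-valid = nt , body⊆span

      -- The analogue of the Krein-Milman theorem for convex geometries. An element of the span that
      -- is not a tip is the head of a valid rule inside the span: otherwise it would be a tip if it
      -- lies in the body, and `Hull.closed` would expel it if it does not. By `no-entry` it
      -- therefore cannot be missing from a convex set that contains the tips.
      tips-closure : IsClosure (𝓐 R) (tips i ∪ ⁅ head i ⁆) (span i)
      tips-closure = least-closure (span-convex i) inside-span least
        where
        inside-span : tips i ∪ ⁅ head i ⁆ ⊆ span i
        inside-span m with x∈p∪q⁻ (tips i) ⁅ head i ⁆ m
        ... | inj₁ m′ = body⊆span (proj₁ (tips⁻ {i} m′))
        ... | inj₂ m′ = subst (_∈ span i) (sym (x∈⁅y⁆⇒x≡y _ m′)) (head∈span nt)
        least : ∀ {Y} → Convex Y → tips i ∪ ⁅ head i ⁆ ⊆ Y → span i ⊆ Y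
        least {Y} cY sub {x} m = x∉∁p⇒x∈p (λ m′ → no-entry (_∈ span i) cY blocked m′ m)
          where
          blocked : ∀ {z} → z ∈ ∁ Y → z ∈ span i → ∃[ j ] head j ≡ z × Valid (_∈ span i) j
          blocked {z} mz tz with Fin.any? (λ j → (head j Fin.≟ z) ×-dec valid? (span i) j)
          ... | yes p = p
          ... | no ¬p with z ∈? body i
          ...   | yes b = ⊥-elim (x∈∁p⇒x∉p mz (sub (x∈p∪q⁺ (inj₁ (tips⁺ b (λ j e v → ¬p (j , e , v)))))))
          ...   | no ¬b = ⊥-elim (Hull.closed (hull (body i)) ¬b
                            (λ j e nt′ → invalid⇒exit {span i} nt′ (λ v → ¬p (j , e , v))) tz)

    -- Rule `i` itself keeps `q` from being extreme in the span. Removing a tip `s` destroys every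
    -- valid rule with head `q`, as each contains `s`; then `q` is extreme in what remains and can
    -- be removed as well.
    selected⇒critical : ∀ {i} → Selected i → Critical (𝓐 R) (tips i , head i)
    selected⇒critical {i} ((nt , _) , hits , _) =
      (λ m → nt (proj₁ (tips⁻ {i} m))) , span i , tips-closure nt ,
      (λ c → convex⇒extreme {span i} (*⇒convex c) i refl (self-valid nt)) ,
      λ s m → let b , ex = tips⁻ {i} m in convex⇒* (subst Convex (eq s) (cv s b ex))
      where
      T = span i
      q = head i
      cv : ∀ s → s ∈ body i → Extreme T s → Convex ((T - s) - q)
      cv s b ex = extreme⇒convex (extreme⇒convex (span-convex i) ex) ex′
        where
        ex′ : Extreme (T - s) q
        ex′ j e (nt′ , sub) = hits b (ex , j , (nt′ , λ m → p─q⊆p T ⁅ s ⁆ (sub m)) , e , λ m → ∉─ T ⁅ s ⁆ (sub m) (x∈⁅x⁆ s))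
      eq : ∀ s → (T - s) - q ≡ T ─ (⁅ q ⁆ ∪ ⁅ s ⁆)
      eq s = trans (p─q─r≡p─r─q T ⁅ s ⁆ ⁅ q ⁆) (p─q─r≡p─q∪r T ⁅ q ⁆ ⁅ s ⁆)

    -- By `tips-closure` the span can be recovered from the tips and the head alone.
    spans-agree : ∀ {i j} → Selected i → Selected j → tips i ≡ tips j → head i ≡ head j → span i ≡ span j
    spans-agree {i} {j} (vi , _) (vj , _) et eh =
      closure-unique (tips-closure (proj₁ vi))
        (subst (λ W → IsClosure (𝓐 R) W (span j)) (sym (cong₂ (λ A q → A ∪ ⁅ q ⁆) et eh)) (tips-closure (proj₁ vj)))

    selected-unique : ∀ {i j} → Selected i → Selected j → tips i ≡ tips j → head i ≡ head j → i ≡ j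
    selected-unique {i} {j} si sj et eh with Fin.<-cmp i j
    ... | tri≈ _ e _ = e
    ... | tri< lt _ _ = ⊥-elim (proj₂ (proj₂ sj)
          (i , subst (λ T → Valid (_∈ T) i) (spans-agree si sj et eh) (proj₁ si) , eh , lt))
    ... | tri> _ _ gt = ⊥-elim (proj₂ (proj₂ si)
          (j , subst (λ T → Valid (_∈ T) j) (sym (spans-agree si sj et eh)) (proj₁ sj) , sym eh , gt))

    -- Since `T - q` is not convex, some rule with head `q` is valid in `T`; the first of them is
    -- chosen. Since removing both `q` and `s` leaves a convex set, every such rule contains `s`.
    -- Thus the chosen body lies between `A` and `T`, and its closure is `T`.
    critical⇒selected : ∀ {A q} → Critical (𝓐 R) (A , q) → ∃[ i ] Selected i × tips i ≡ A × head i ≡ q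
    critical⇒selected {A} {q} (q∉A , T , cl , nq , qs) = from-first
      where
      W = A ∪ ⁅ q ⁆
      cT : Convex T
      cT = subst Convex (closure-unique (hull-closure (hull W)) cl) (Hull.feasible (hull W))
      W⊆T : W ⊆ T
      W⊆T {x} m = Equivalence.from (cl x) (λ Y _ sub → sub m)
      least : ∀ {Y} → Convex Y → W ⊆ Y → T ⊆ Y
      least cY sub {x} m = Equivalence.to (cl x) m _ (convex⇒* cY) sub
      cs : ∀ {s} → s ∈ A → Convex (T ─ (⁅ q ⁆ ∪ ⁅ s ⁆))
      cs {s} m = *⇒convex (qs s m)
      all-contain : ∀ {s} → s ∈ A → ∀ j → head j ≡ q → Valid (_∈ T) j → s ∈ body j
      all-contain {s} m j refl (nt , sub) with convex-exit (cs m) j (λ d → ∉─ T _ d (x∈p∪q⁺ (inj₁ (x∈⁅x⁆ q))))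
      ... | y , b , y∉ with y Fin.≟ s
      ...   | yes refl = b
      ...   | no y≢s = ⊥-elim (y∉ (x∈p∧x∉q⇒x∈p─q (sub b) λ d → y∉′ (x∈p∪q⁻ ⁅ q ⁆ ⁅ s ⁆ d)))
        where
        y∉′ : ¬ (y ∈ ⁅ q ⁆ ⊎ y ∈ ⁅ s ⁆)
        y∉′ (inj₁ d) = nt (subst (_∈ body j) (x∈⁅y⁆⇒x≡y q d) b)
        y∉′ (inj₂ d) = y≢s (x∈⁅y⁆⇒x≡y s d)
      IsFirst : Index → Set
      IsFirst i = head i ≡ q × Valid (_∈ T) i
      first? : Decidable IsFirst
      first? i = (head i Fin.≟ q) ×-dec valid? T i
      some : ¬ (∀ i → ¬ IsFirst i)
      some none = nq (convex⇒* (extreme⇒convex cT (λ j e v → none j (e , v))))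
      from-first : ∃[ i ] Selected i × tips i ≡ A × head i ≡ q
      from-first with Fin.¬∀⟶∃¬-smallest _ (λ i → ¬ IsFirst i) (λ i → ¬? (first? i)) some
      ... | i , ¬¬fi , before = i , (self-valid nt , hits , none-before) , ⊆-antisym tips⊆A A⊆tips , eq
        where
        fi = decidable-stable (first? i) ¬¬fi
        eq = proj₁ fi
        vi = proj₂ fi
        nt = proj₁ vi
        q∈span : q ∈ span i
        q∈span = subst (_∈ span i) eq (head∈span nt)
        -- If a valid rule had head `s`, then together with rule `i` it would block both `q` and
        -- `s`, the only elements of `T` in the complement of `T ─ D`; but that complement is
        -- feasible and contains `q`.
        ex-A : ∀ {s} → s ∈ A → Extreme T s
        ex-A {s} m j e v = no-entry (_∈ T) (cs m) blocked q∈X (W⊆T (x∈p∪q⁺ (inj₂ (x∈⁅x⁆ q))))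
          where
          D = ⁅ q ⁆ ∪ ⁅ s ⁆
          q∈X : q ∈ ∁ (T ─ D)
          q∈X = x∉p⇒x∈∁p (λ d → ∉─ T D d (x∈p∪q⁺ (inj₁ (x∈⁅x⁆ q))))
          blocked : ∀ {x} → x ∈ ∁ (T ─ D) → x ∈ T → ∃[ j ] head j ≡ x × Valid (_∈ T) j
          blocked {x} mx tx with x ∈? D
          ... | no ¬d = ⊥-elim (x∈∁p⇒x∉p mx (x∈p∧x∉q⇒x∈p─q tx ¬d))
          ... | yes d with x∈p∪q⁻ ⁅ q ⁆ ⁅ s ⁆ d
          ...   | inj₁ d′ = i , trans eq (sym (x∈⁅y⁆⇒x≡y q d′)) , vi
          ...   | inj₂ d′ = j , trans e (sym (x∈⁅y⁆⇒x≡y s d′)) , v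
        T≡span : T ≡ span i
        T≡span = ⊆-antisym (least (span-convex i) sub) (hull-least (hull (body i)) cT (proj₂ vi))
          where
          sub : W ⊆ span i
          sub m with x∈p∪q⁻ A ⁅ q ⁆ m
          ... | inj₁ m′ = body⊆span (all-contain m′ i eq vi)
          ... | inj₂ m′ = subst (_∈ span i) (sym (x∈⁅y⁆⇒x≡y q m′)) q∈span
        A⊆tips : A ⊆ tips i
        A⊆tips {s} m = tips⁺ (all-contain m i eq vi) (subst (λ T → Extreme T s) T≡span (ex-A m))
        -- A tip outside `A` could be removed from `T`, leaving a smaller convex set that contains
        -- `A` and `q`, although `T` is the least one.
        tips⊆A : tips i ⊆ A
        tips⊆A {s} m with s ∈? A
        ... | yes p = p
        ... | no s∉A = ⊥-elim (∉─ T ⁅ s ⁆ (least (extreme⇒convex cT ex) sub (proj₂ vi b)) (x∈⁅x⁆ s))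
          where
          b = proj₁ (tips⁻ {i} m)
          ex : Extreme T s
          ex = subst (λ T → Extreme T s) (sym T≡span) (proj₂ (tips⁻ {i} m))
          sub : W ⊆ T - s
          sub {x} m′ = x∈p∧x≢y⇒x∈p-y (W⊆T m′) x≢s
            where
            x≢s : x ≢ s
            x≢s refl with x∈p∪q⁻ A ⁅ q ⁆ m′
            ... | inj₁ a = s∉A a
            ... | inj₂ a = nt (subst (_∈ body i) (trans (x∈⁅y⁆⇒x≡y q a) (sym eq)) b)
        hits : ∀ {s} → s ∈ body i → ¬ Misses i s
        hits {s} b (ex , j , v , e , s∉) =
          s∉ (all-contain (tips⊆A (tips⁺ b ex)) j (trans e eq) (subst (λ T → Valid (_∈ T) j) (sym T≡span) v))
        none-before : ¬ Precedes i
        none-before (j , v , e , lt) =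
          subst (λ j → ¬ IsFirst j) inj≡j (before (Fin.fromℕ< lt)) (trans e eq , subst (λ T → Valid (_∈ T) j) (sym T≡span) v)
          where
          inj≡j : Fin.inject (Fin.fromℕ< lt) ≡ j
          inj≡j = Fin.toℕ-injective (trans (Fin.toℕ-inject (Fin.fromℕ< lt)) (Fin.toℕ-fromℕ< lt))

-- The algorithm

cursorʳ outʳ countʳ writeʳ badᵃ hasᵃ : ℕ
cursorʳ  = 15
outʳ   = 16
countʳ = 17
writeʳ = 18
badᵃ   = 12
hasᵃ   = 13

-- For rule i = (B , q), badᵃ[i] is set if a rule (C , q) with q ∉ C ⊆ τ(B) either
-- lacks an extreme point of τ(B) or precedes rule i.  The closure is recomputed
-- for every cell, which keeps all loop nests two deep and still is quadratic.
clearHas markHas flagMiss checks judge checkCell : Code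
clearHas  = hasᵃ [ reg jʳ ]:= lit 0
markHas   = cond (elemᵃ [ reg kʳ ] ≐ elemᵃ [ reg cursorʳ ]) (hasᵃ [ ownᵃ [ reg kʳ ] ]:= lit 1) nop
flagMiss  = cond (hitᵃ [ reg jʳ ] ≐ lit 0)
              (cond (headᵃ [ reg jʳ ] ≐ headᵃ [ reg iʳ ])
                (cond (hasᵃ [ reg jʳ ] ≐ lit 0) (badᵃ [ reg iʳ ]:= lit 1) nop) nop) nop
checks    = for jʳ nRules clearHas ,, for kʳ nCells markHas ,, for jʳ nRules flagMiss
judge     = cond (cntᵃ [ elemᵃ [ reg cursorʳ ] ] ≐ lit 0) checks nop
checkCell = iʳ := ownᵃ [ reg cursorʳ ] ,, closure ,, judge

flagEarlier reject emitCell emit select emitRule main : Code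
flagEarlier = cond (hitᵃ [ reg jʳ ] ≐ lit 0)
                (cond (headᵃ [ reg jʳ ] ≐ headᵃ [ reg iʳ ])
                  (cond (reg jʳ ≺ reg iʳ) (badᵃ [ reg iʳ ]:= lit 1) nop) nop) nop
reject      = for jʳ nRules flagEarlier
emitCell    = cond (ownᵃ [ reg kʳ ] ≐ reg iʳ)
                (cond (cntᵃ [ elemᵃ [ reg kʳ ] ] ≐ lit 0)
                  (outputᵃ [ reg writeʳ ]:= elemᵃ [ reg kʳ ] ,, writeʳ := succ′ (reg writeʳ) ,,
                   outputᵃ [ reg countʳ ]:= succ′ (outputᵃ [ reg countʳ ])) nop) nop
-- The length of the body is not known in advance: its entry starts at 0 and is incremented while
-- the elements are written behind it. Address 0 counts the rules in the same way.
emit        = (outputᵃ [ reg outʳ ]:= headᵃ [ reg iʳ ] ,, countʳ := succ′ (reg outʳ) ,,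
               outputᵃ [ reg countʳ ]:= lit 0 ,, writeʳ := succ′ (reg countʳ)) ,,
              for kʳ nCells emitCell ,,
              (outputᵃ [ lit 0 ]:= succ′ (outputᵃ [ lit 0 ]) ,, outʳ := reg writeʳ)
-- The body of rule `i` lies in its own closure, so the hit entry of `i` is zero exactly if the head
-- is not in the body.
select      = cond (badᵃ [ reg iʳ ] ≐ lit 0) (cond (hitᵃ [ reg iʳ ] ≐ lit 0) emit nop) nop
emitRule    = closure ,, reject ,, select
main        = for cursorʳ nCells checkCell ,, outʳ := lit 1 ,, for iʳ nRules emitRule

opaque
  unfolding search closure

  closure-keepsR : All (λ r → writesR r closure ≡ false) (nRules ∷ nCells ∷ iʳ ∷ cursorʳ ∷ outʳ ∷ [])
  closure-keepsR = refl ∷ refl ∷ refl ∷ refl ∷ refl ∷ []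

  closure-keepsA : All (λ a → writesA a closure ≡ false) (outputᵃ ∷ headᵃ ∷ elemᵃ ∷ ownᵃ ∷ badᵃ ∷ [])
  closure-keepsA = refl ∷ refl ∷ refl ∷ refl ∷ refl ∷ []

  checkCell-keepsR : All (λ r → writesR r checkCell ≡ false) (nRules ∷ nCells ∷ cursorʳ ∷ [])
  checkCell-keepsR = refl ∷ refl ∷ refl ∷ []

  checkCell-keepsA : All (λ a → writesA a checkCell ≡ false) (outputᵃ ∷ headᵃ ∷ elemᵃ ∷ ownᵃ ∷ [])
  checkCell-keepsA = refl ∷ refl ∷ refl ∷ refl ∷ []

  emitRule-keepsR : All (λ r → writesR r emitRule ≡ false) (nRules ∷ nCells ∷ iʳ ∷ [])
  emitRule-keepsR = refl ∷ refl ∷ refl ∷ []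

  emitRule-keepsA : All (λ a → writesA a emitRule ≡ false) (headᵃ ∷ elemᵃ ∷ ownᵃ ∷ [])
  emitRule-keepsA = refl ∷ refl ∷ refl ∷ []

  main-uniform : uniform main ≡ true
  main-uniform = refl

  main-degree : degree main ≡ 2
  main-degree = refl

  program-safe : safe (parse ,, main) ≡ true
  program-safe = refl

  main-keepsR : All (λ r → writesR r main ≡ false) (nRules ∷ nCells ∷ [])
  main-keepsR = refl ∷ refl ∷ []

-- What the computed tables mean

module _ {n : ℕ} (R : List (Rule n)) where

  record Loaded (m N : ℕ) (H E O : ℕ → ℕ) : Set where
    field
      rules : m ≡ length R
      table : Table 0 0 N H E O R

    open Table table public

    rule< : ∀ {j} → j < m → ∃[ j′ ] toℕ {length R} j′ ≡ j
    rule< lt = fromℕ< (subst (_ <_) rules lt) , Fin.toℕ-fromℕ< _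

    <rule : ∀ (j : Index R) → toℕ j < m
    <rule j = subst (toℕ j <_) (sym rules) (Fin.toℕ<n j)

    cell : ∀ {k} → k < N → ∃[ j ] O k ≡ toℕ j × (∃[ x ] E k ≡ toℕ x × x ∈ body R j)
    cell lt = cells⁻ z≤n lt

    cell∈ : ∀ {k j x} → k < N → O k ≡ toℕ {length R} j → E k ≡ toℕ x → x ∈ body R j
    cell∈ lt o e with cell lt
    ... | j , o′ , x , e′ , m with Fin.toℕ-injective (trans (sym o) o′) | Fin.toℕ-injective (trans (sym e) e′)
    ...   | refl | refl = m

    cell⁺ : ∀ j {x} → x ∈ body R j → ∃[ k ] k < N × O k ≡ toℕ j × E k ≡ toℕ x
    cell⁺ j m = let k , _ , r = cells⁺ j m in k , r

    head≡ : ∀ j → H (toℕ j) ≡ toℕ (head R j)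
    head≡ = heads

    head-≡ : ∀ {i j} → H (toℕ i) ≡ H (toℕ j) → head R i ≡ head R j
    head-≡ {i} {j} e = Fin.toℕ-injective (trans (sym (head≡ i)) (trans e (head≡ j)))

    ≡-head : ∀ {i j} → head R i ≡ head R j → H (toℕ i) ≡ H (toℕ j)
    ≡-head {i} {j} e = trans (head≡ i) (trans (cong toℕ e) (sym (head≡ j)))

  LoadedOf : State → Set
  LoadedOf σ = Loaded (regs σ nRules) (regs σ nCells) (arrays σ headᵃ) (arrays σ elemᵃ) (arrays σ ownᵃ)

  loaded-frame : ∀ {m m′ N N′ H H′ E E′ O O′} → m′ ≡ m → N′ ≡ N → H′ ≡ H → E′ ≡ E → O′ ≡ O →
                 Loaded m N H E O → Loaded m′ N′ H′ E′ O′
  loaded-frame refl refl refl refl refl l = l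

  Outside : Index R → ℕ → Set
  Outside i v = ∃[ x ] toℕ x ≡ v × x ∉ span R i

  -- The abstract `S` is instantiated by the complement of the span; its closure property is
  -- `Hull.closed` read through the table.
  tables : ∀ σ (i : Index R) → LoadedOf σ → regs σ iʳ ≡ toℕ i → TablesOf (Outside i) σ
  tables σ i l iv = record
    { own< = λ lt → let j , o , _ = cell lt in subst (_< regs σ nRules) (sym o) (<rule j)
    ; closed = closed }
    where
    open Loaded l
    H = arrays σ headᵃ
    E = arrays σ elemᵃ
    O = arrays σ ownᵃ
    element : ∀ {v} → OccOf (Outside i) σ v → ∃[ x ] toℕ {n} x ≡ v
    element (inj₁ (k , lt , refl)) = let j , _ , x , e , _ = cell lt in x , sym e
    element (inj₂ (j , lt , refl)) with rule< lt
    ... | j′ , refl = head R j′ , sym (head≡ j′)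
    closed : ∀ {v} → OccOf (Outside i) σ v → ¬ Body (regs σ nCells) (regs σ iʳ) E O v →
             (∀ {j} → j < regs σ nRules → H j ≡ v → (∀ {k} → k < regs σ nCells → O k ≡ j → E k ≢ H j) →
              ∃[ k ] k < regs σ nCells × O k ≡ j × Outside i (E k)) → Outside i v
    closed o nb f with element o
    ... | x , refl = x , refl , Hull.closed (hull R (body R i)) x∉ allowed
      where
      x∉ : x ∉ body R i
      x∉ m = let k , lt , ok , e = cell⁺ i m in nb (k , lt , trans ok (sym iv) , e)
      allowed : Allows R (_∉ span R i) x
      allowed j e nt with f (<rule j) (trans (head≡ j) (cong toℕ e))
                            (λ lt ok ek → nt (cell∈ lt ok (trans ek (head≡ j))))
      ... | k , lt , ok , y , ey , y∉ = y , cell∈ lt ok (sym ey) , y∉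

  record Meaning (i : Index R) (N : ℕ) (E cnt hit : ℕ → ℕ) : Set where
    field
      hit⇒valid   : ∀ j → hit (toℕ j) ≡ 0 → Valid R (_∈ span R i) j
      valid⇒hit   : ∀ j → Valid R (_∈ span R i) j → hit (toℕ j) ≡ 0
      cnt⇒extreme : ∀ {k s} → k < N → E k ≡ toℕ s → cnt (E k) ≡ 0 → Extreme R (span R i) s
      extreme⇒cnt : ∀ {k s} → k < N → E k ≡ toℕ s → Extreme R (span R i) s → cnt (E k) ≡ 0

  MeaningOf : Index R → State → Set
  MeaningOf i σ = Meaning i (regs σ nCells) (arrays σ elemᵃ) (arrays σ cntᵃ) (arrays σ hitᵃ)

  meaning : ∀ σ (i : Index R) → LoadedOf σ → regs σ iʳ ≡ toℕ i → SaturatedOf (Outside i) σ → MeaningOf i σ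
  meaning σ i l iv sat = record
    { hit⇒valid = hit⇒valid ; valid⇒hit = valid⇒hit ; cnt⇒extreme = cnt⇒extreme ; extreme⇒cnt = extreme⇒cnt }
    where
    open Loaded l
    open Saturated sat
    hit = arrays σ hitᵃ
    -- By saturation every intact rule is valid for this `T`, so `no-entry` shows that no element of
    -- `T` can leave the span. This is the completeness of the search, obtained without following
    -- its steps.
    T : Fin n → Set
    T x = x ∈ body R i ⊎ (∃[ j ] hit (toℕ j) ≡ 0 × head R j ≡ x)
    valid-T : ∀ j → hit (toℕ j) ≡ 0 → Valid R T j
    valid-T j h0 = (λ m → let k , lt , ok , e = cell⁺ j m in unhit-nontrivial lt ok h0 (trans e (sym (head≡ j)))) , within
      where
      within : ∀ {x} → x ∈ body R j → T x
      within {x} m with cell⁺ j m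
      ... | k , lt , ok , e with unhit-blocked lt ok h0
      ...   | inj₁ (k′ , lt′ , ok′ , e′) = inj₁ (cell∈ lt′ (trans ok′ iv) (trans e′ e))
      ...   | inj₂ (j′ , lt′ , hj , h0′) with rule< lt′
      ...     | j″ , refl = inj₂ (j″ , h0′ , Fin.toℕ-injective (trans (sym (head≡ j″)) (trans hj e)))
    T⊆span : ∀ {x} → T x → x ∈ span R i
    T⊆span {x} t with x ∈? span R i
    ... | yes m = m
    ... | no ¬m = ⊥-elim (no-entry R T (span-convex R i) blocked (x∉p⇒x∈∁p ¬m) t)
      where
      blocked : ∀ {y} → y ∈ ∁ (span R i) → T y → ∃[ j ] head R j ≡ y × Valid R T j
      blocked m (inj₁ b) = ⊥-elim (x∈∁p⇒x∉p m (body⊆span R b))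
      blocked m (inj₂ (j , h0 , e)) = j , e , valid-T j h0
    hit⇒valid : ∀ j → hit (toℕ j) ≡ 0 → Valid R (_∈ span R i) j
    hit⇒valid j h0 = proj₁ (valid-T j h0) , λ m → T⊆span (proj₂ (valid-T j h0) m)
    valid⇒hit : ∀ j → Valid R (_∈ span R i) j → hit (toℕ j) ≡ 0
    valid⇒hit j (nt , sub) with hit (toℕ j) ≟ 0
    ... | yes z = z
    ... | no nz with hit-cause (<rule j) nz
    ...   | k , lt , ok , inj₁ e = ⊥-elim (nt (cell∈ lt ok (trans e (head≡ j))))
    ...   | k , lt , ok , inj₂ (y , ey , y∉) = ⊥-elim (y∉ (sub (cell∈ lt ok (sym ey))))
    cnt⇒extreme : ∀ {k s} → k < regs σ nCells → arrays σ elemᵃ k ≡ toℕ s → arrays σ cntᵃ (arrays σ elemᵃ k) ≡ 0 → Extreme R (span R i) s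
    cnt⇒extreme lt e c0 j hj v = cnt-zero lt c0 (<rule j) (trans (head≡ j) (trans (cong toℕ hj) (sym e))) (valid⇒hit j v)
    extreme⇒cnt : ∀ {k s} → k < regs σ nCells → arrays σ elemᵃ k ≡ toℕ s → Extreme R (span R i) s → arrays σ cntᵃ (arrays σ elemᵃ k) ≡ 0
    extreme⇒cnt {k} lt e ex with arrays σ cntᵃ (arrays σ elemᵃ k) ≟ 0
    ... | yes z = z
    ... | no nz with cnt-nonzero lt nz
    ...   | j , lt′ , hj , h0 with rule< lt′
    ...     | j′ , refl = ⊥-elim (ex j′ (Fin.toℕ-injective (trans (sym (head≡ j′)) (trans hj e))) (hit⇒valid j′ h0))

  record Analysed (i : Index R) (σ τ : State) : Set where
    field
      loaded   : LoadedOf τ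
      indexed  : regs τ iʳ ≡ toℕ i
      meant    : MeaningOf i τ
      same-1   : regs τ nCells ≡ regs σ nCells
      same-15  : regs τ cursorʳ ≡ regs σ cursorʳ
      same-16  : regs τ outʳ ≡ regs σ outʳ
      same-out : arrays τ outputᵃ ≡ arrays σ outputᵃ
      same-E   : arrays τ elemᵃ ≡ arrays σ elemᵃ
      same-O   : arrays τ ownᵃ ≡ arrays σ ownᵃ
      same-bad : arrays τ badᵃ ≡ arrays σ badᵃ

  analyse : ∀ σ i → LoadedOf σ → regs σ iʳ ≡ toℕ i → Analysed i σ (⟦ closure ⟧ σ)
  analyse σ i l iv with closure-keepsR | closure-keepsA
  ... | r0 ∷ r1 ∷ r4 ∷ r15 ∷ r16 ∷ [] | a1 ∷ a2 ∷ a3 ∷ a4 ∷ a12 ∷ [] = record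
    { loaded = loaded ; indexed = indexed
    ; meant = meaning (⟦ closure ⟧ σ) i loaded indexed (closure-ok (Outside i) σ (tables σ i l iv))
    ; same-1 = frameR closure nCells r1 σ ; same-15 = frameR closure cursorʳ r15 σ ; same-16 = frameR closure outʳ r16 σ
    ; same-out = frameA closure outputᵃ a1 σ
    ; same-E = frameA closure elemᵃ a3 σ ; same-O = frameA closure ownᵃ a4 σ ; same-bad = frameA closure badᵃ a12 σ }
    where
    loaded = loaded-frame (frameR closure nRules r0 σ) (frameR closure nCells r1 σ) (frameA closure headᵃ a2 σ)
                          (frameA closure elemᵃ a3 σ) (frameA closure ownᵃ a4 σ) l
    indexed = trans (frameR closure iʳ r4 σ) iv

-- Flags raised by the two tests

<suc : ∀ {k′ k} → k′ < suc k → k′ ≢ k → k′ < k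
<suc lt ne = ≤∧≢⇒< (≤-pred lt) ne

-- Flags are never lowered, and a loop concerned with rule `i` touches only entry `i`. Hence the
-- flags of both tests can share one array, with `old` as its content before the loop.
record Flags (P : ℕ → Set) (b i : ℕ) (old bad : ℕ → ℕ) : Set where
  field
    kept    : ∀ {v} → old v ≢ 0 → bad v ≢ 0
    reason  : ∀ {v} → bad v ≢ 0 → old v ≢ 0 ⊎ (v ≡ i × (∃[ j ] j < b × P j))
    flagged : ∀ {j} → j < b → P j → bad i ≢ 0

flags-start : ∀ {P i old} → Flags P 0 i old old
flags-start = record { kept = λ o → o ; reason = inj₁ ; flagged = λ () }

flags-set : ∀ {P b i old bad} → P b → Flags P b i old bad → Flags P (suc b) i old (bad [ i ↦ 1 ])
flags-set {P} {b} {i} {old} {bad} p f = record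
  { kept = λ {v} o → upd (_≢ 0) bad i v (λ _ ()) (λ _ → kept o)
  ; reason = λ {v} → upd (λ w → w ≢ 0 → old v ≢ 0 ⊎ (v ≡ i × (∃[ j ] j < suc b × P j))) bad i v
      (λ e _ → inj₂ (e , b , n<1+n b , p)) (λ _ ne → weaken (reason ne))
  ; flagged = λ _ _ → upd (_≢ 0) bad i i (λ _ ()) (λ ne → ⊥-elim (ne refl)) }
  where
  open Flags f
  weaken : ∀ {v} → old v ≢ 0 ⊎ (v ≡ i × (∃[ j ] j < b × P j)) → old v ≢ 0 ⊎ (v ≡ i × (∃[ j ] j < suc b × P j))
  weaken (inj₁ o) = inj₁ o
  weaken (inj₂ (e , j , lt , p)) = inj₂ (e , j , m<n⇒m<1+n lt , p)

flags-skip : ∀ {P b i old bad} → ¬ P b → Flags P b i old bad → Flags P (suc b) i old bad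
flags-skip {P} {b} {i} {old} {bad} np f = record
  { kept = kept ; reason = λ ne → weaken (reason ne)
  ; flagged = λ lt p → flagged (<suc lt (λ { refl → np p })) p }
  where
  open Flags f
  weaken : ∀ {v} → old v ≢ 0 ⊎ (v ≡ i × (∃[ j ] j < b × P j)) → old v ≢ 0 ⊎ (v ≡ i × (∃[ j ] j < suc b × P j))
  weaken (inj₁ o) = inj₁ o
  weaken (inj₂ (e , j , lt , p)) = inj₂ (e , j , m<n⇒m<1+n lt , p)

flags-map : ∀ {P Q b i old bad} → (∀ {j} → j < b → P j → Q j) → (∀ {j} → j < b → Q j → P j) →
            Flags P b i old bad → Flags Q b i old bad
flags-map {P} {Q} {b} {i} {old} to from f = record
  { kept = kept ; reason = λ ne → there′ (reason ne) ; flagged = λ lt q → flagged lt (from lt q) }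
  where
  open Flags f
  there′ : ∀ {v} → old v ≢ 0 ⊎ (v ≡ i × (∃[ j ] j < b × P j)) → old v ≢ 0 ⊎ (v ≡ i × (∃[ j ] j < b × Q j))
  there′ (inj₁ o) = inj₁ o
  there′ (inj₂ (e , j , lt , p)) = inj₂ (e , j , lt , to lt p)

record Has (m K s : ℕ) (E O has : ℕ → ℕ) : Set where
  field
    has⁻ : ∀ {j} → j < m → has j ≢ 0 → ∃[ k ] k < K × O k ≡ j × E k ≡ s
    has⁺ : ∀ {k} → k < K → E k ≡ s → has (O k) ≢ 0

HasOf : ℕ → State → Set
HasOf K σ = Has (regs σ nRules) K (arrays σ elemᵃ (regs σ cursorʳ)) (arrays σ elemᵃ) (arrays σ ownᵃ) (arrays σ hasᵃ)

clearHas-ok : ∀ σ → let τ = ⟦ for jʳ nRules clearHas ⟧ σ in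
              (∀ {j} → j < regs τ jʳ → arrays τ hasᵃ j ≡ 0) × regs τ jʳ ≡ regs τ nRules
clearHas-ok σ = for-wp jʳ nRules clearHas (λ τ → ∀ {j} → j < regs τ jʳ → arrays τ hasᵃ j ≡ 0) refl refl
  (λ τ _ z {j} lt → upd (_≡ 0) (arrays τ hasᵃ) (regs τ jʳ) j (λ _ → refl) (λ ne → z (<suc lt ne))) σ (λ ())

markHas-ok : ∀ σ → HasOf 0 σ → let τ = ⟦ for kʳ nCells markHas ⟧ σ in
             HasOf (regs τ kʳ) τ × regs τ kʳ ≡ regs τ nCells
markHas-ok σ h = for-wp kʳ nCells markHas (λ τ → HasOf (regs τ kʳ) τ) refl refl
  (λ τ _ h → (λ e → record { has⁻ = set⁻ τ h e ; has⁺ = set⁺ τ h }) ,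
             (λ ne → record { has⁻ = λ lt b → weaken τ (Has.has⁻ h lt b)
                            ; has⁺ = λ lt e → Has.has⁺ h (<suc lt (λ { refl → ne e })) e })) σ h
  where
  module _ (τ : State) where
    k = regs τ kʳ
    E = arrays τ elemᵃ
    O = arrays τ ownᵃ
    s = E (regs τ cursorʳ)
    weaken : ∀ {j} → (∃[ k′ ] k′ < k × O k′ ≡ j × E k′ ≡ s) → ∃[ k′ ] k′ < suc k × O k′ ≡ j × E k′ ≡ s
    weaken (k′ , lt , r) = k′ , m<n⇒m<1+n lt , r
    set⁻ : HasOf k τ → E k ≡ s → ∀ {j} → j < regs τ nRules → (arrays τ hasᵃ [ O k ↦ 1 ]) j ≢ 0 →
           ∃[ k′ ] k′ < suc k × O k′ ≡ j × E k′ ≡ s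
    set⁻ h e {j} lt = upd (λ v → v ≢ 0 → ∃[ k′ ] k′ < suc k × O k′ ≡ j × E k′ ≡ s) (arrays τ hasᵃ) (O k) j
      (λ { refl _ → k , n<1+n k , refl , e }) (λ _ b → weaken (Has.has⁻ h lt b))
    set⁺ : HasOf k τ → ∀ {k′} → k′ < suc k → E k′ ≡ s → (arrays τ hasᵃ [ O k ↦ 1 ]) (O k′) ≢ 0
    set⁺ h {k′} lt e = upd (_≢ 0) (arrays τ hasᵃ) (O k) (O k′) (λ _ ())
      (λ ne → Has.has⁺ h (<suc lt (λ e → ne (cong O e))) e)

MissTest : (i : ℕ) (H hit has : ℕ → ℕ) → ℕ → Set
MissTest i H hit has j = hit j ≡ 0 × H j ≡ H i × has j ≡ 0

flagMiss-ok : ∀ σ → let τ = ⟦ for jʳ nRules flagMiss ⟧ σ in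
              Flags (MissTest (regs τ iʳ) (arrays τ headᵃ) (arrays τ hitᵃ) (arrays τ hasᵃ)) (regs τ jʳ) (regs τ iʳ)
                    (arrays σ badᵃ) (arrays τ badᵃ) × regs τ jʳ ≡ regs τ nRules
flagMiss-ok σ = for-wp jʳ nRules flagMiss
  (λ τ → Flags (MissTest (regs τ iʳ) (arrays τ headᵃ) (arrays τ hitᵃ) (arrays τ hasᵃ)) (regs τ jʳ) (regs τ iʳ)
               (arrays σ badᵃ) (arrays τ badᵃ)) refl refl
  (λ τ _ f → (λ a → (λ b → (λ c → flags-set (a , b , c) f) ,
                           (λ nc → flags-skip (λ (_ , _ , c) → nc c) f)) ,
                    (λ nb → flags-skip (λ (_ , b , _) → nb b) f)) ,
             (λ na → flags-skip (λ (a , _ , _) → na a) f)) σ flags-start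

EarlierTest : (i : ℕ) (H hit : ℕ → ℕ) → ℕ → Set
EarlierTest i H hit j = hit j ≡ 0 × H j ≡ H i × j < i

reject-ok : ∀ σ → let τ = ⟦ reject ⟧ σ in
            Flags (EarlierTest (regs τ iʳ) (arrays τ headᵃ) (arrays τ hitᵃ)) (regs τ jʳ) (regs τ iʳ)
                  (arrays σ badᵃ) (arrays τ badᵃ) × regs τ jʳ ≡ regs τ nRules
reject-ok σ = for-wp jʳ nRules flagEarlier
  (λ τ → Flags (EarlierTest (regs τ iʳ) (arrays τ headᵃ) (arrays τ hitᵃ)) (regs τ jʳ) (regs τ iʳ)
               (arrays σ badᵃ) (arrays τ badᵃ)) refl refl
  (λ τ _ f → (λ a → (λ b → (λ c → flags-set (a , b , c) f) ,
                           (λ nc → flags-skip (λ (_ , _ , c) → nc c) f)) ,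
                    (λ nb → flags-skip (λ (_ , b , _) → nb b) f)) ,
             (λ na → flags-skip (λ (a , _ , _) → na a) f)) σ flags-start

-- `MissTest` freed from the scratch array `hasᵃ`, whose content changes with the next cell.
Missing : (N s : ℕ) (H E O hit : ℕ → ℕ) → ℕ → ℕ → Set
Missing N s H E O hit i j = hit j ≡ 0 × H j ≡ H i × (∀ {k} → k < N → O k ≡ j → E k ≢ s)

checks-ok : ∀ σ → Flags (Missing (regs σ nCells) (arrays σ elemᵃ (regs σ cursorʳ)) (arrays σ headᵃ) (arrays σ elemᵃ) (arrays σ ownᵃ) (arrays σ hitᵃ) (regs σ iʳ))
                        (regs σ nRules) (regs σ iʳ) (arrays σ badᵃ) (arrays (⟦ checks ⟧ σ) badᵃ)
checks-ok σ = go (proj₁ r₃) (proj₂ r₃)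
  where
  c₁ = for jʳ nRules clearHas
  c₂ = for kʳ nCells markHas
  c₃ = for jʳ nRules flagMiss
  σ₁ = ⟦ c₁ ⟧ σ
  σ₂ = ⟦ c₂ ⟧ σ₁
  σ₃ = ⟦ c₃ ⟧ σ₂
  r₁ = clearHas-ok σ
  zero-has : ∀ {j} → j < regs σ₁ nRules → arrays σ₁ hasᵃ j ≡ 0
  zero-has lt = proj₁ r₁ (subst (_ <_) (sym (proj₂ r₁)) lt)
  r₂ = markHas-ok σ₁ (record { has⁻ = λ lt ne → ⊥-elim (ne (zero-has lt)) ; has⁺ = λ () })
  has : HasOf (regs σ₂ nCells) σ₂
  has = subst (λ K → HasOf K σ₂) (proj₂ r₂) (proj₁ r₂)
  r₃ = flagMiss-ok σ₂
  missing : ∀ {m N i k H E O hit bad} (h : ℕ → ℕ) → Has m N (E k) E O h →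
            Flags (MissTest i H hit h) m i bad (arrays σ₃ badᵃ) →
            Flags (Missing N (E k) H E O hit i) m i bad (arrays σ₃ badᵃ)
  missing {m} {N} {i} {k} {H} {E} {O} {hit} h hs = flags-map to from
    where
    to : ∀ {j} → j < m → MissTest i H hit h j → Missing N (E k) H E O hit i j
    to lt (a , b , c) = a , b , λ kl o e → Has.has⁺ hs kl e (trans (cong h o) c)
    from : ∀ {j} → j < m → Missing N (E k) H E O hit i j → MissTest i H hit h j
    from {j} lt (a , b , c) = a , b , z
      where
      z : h j ≡ 0
      z with h j ≟ 0
      ... | yes z = z
      ... | no nz = let k , kl , o , e = Has.has⁻ hs lt nz in ⊥-elim (c kl o e)
  go : Flags (MissTest (regs σ₃ iʳ) (arrays σ₃ headᵃ) (arrays σ₃ hitᵃ) (arrays σ₃ hasᵃ)) (regs σ₃ jʳ) (regs σ₃ iʳ)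
             (arrays σ₂ badᵃ) (arrays σ₃ badᵃ) → regs σ₃ jʳ ≡ regs σ₃ nRules → _
  go f e rewrite e
    | frameR c₃ nRules refl σ₂ | frameR c₃ iʳ refl σ₂ | frameA c₃ headᵃ refl σ₂ | frameA c₃ hitᵃ refl σ₂ | frameA c₃ hasᵃ refl σ₂
    = go₂ has f
    where
    go₂ : HasOf (regs σ₂ nCells) σ₂ →
          Flags (MissTest (regs σ₂ iʳ) (arrays σ₂ headᵃ) (arrays σ₂ hitᵃ) (arrays σ₂ hasᵃ)) (regs σ₂ nRules) (regs σ₂ iʳ)
                (arrays σ₂ badᵃ) (arrays σ₃ badᵃ) → _
    go₂ h f = moved (keepR nRules refl refl) (keepR nCells refl refl) (keepR iʳ refl refl) (keepR cursorʳ refl refl)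
                (keepA headᵃ refl refl) (keepA elemᵃ refl refl) (keepA ownᵃ refl refl) (keepA hitᵃ refl refl) (keepA badᵃ refl refl)
                (missing (arrays σ₂ hasᵃ) h f)
      where
      keepR : ∀ r → writesR r c₁ ≡ false → writesR r c₂ ≡ false → regs σ₂ r ≡ regs σ r
      keepR r w₁ w₂ = trans (frameR c₂ r w₂ σ₁) (frameR c₁ r w₁ σ)
      keepA : ∀ a → writesA a c₁ ≡ false → writesA a c₂ ≡ false → arrays σ₂ a ≡ arrays σ a
      keepA a w₁ w₂ = trans (frameA c₂ a w₂ σ₁) (frameA c₁ a w₁ σ)
      moved : ∀ {m m′ N N′ i i′ k k′ H H′ E E′ O O′ hit hit′ bad bad′ new} →
              m ≡ m′ → N ≡ N′ → i ≡ i′ → k ≡ k′ → H ≡ H′ → E ≡ E′ → O ≡ O′ → hit ≡ hit′ → bad ≡ bad′ →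
              Flags (Missing N (E k) H E O hit i) m i bad new → Flags (Missing N′ (E′ k′) H′ E′ O′ hit′ i′) m′ i′ bad′ new
      moved refl refl refl refl refl refl refl refl refl f = f

-- Appending to encodings and lists

encodes-++ : ∀ {n} {R S : List (Rule n)} {u v} → EncodesRules R u → EncodesRules S v → EncodesRules (R ++ S) (u ++ v)
encodes-++ [] d = d
encodes-++ {S = S} {v = v} (add {A = A} {q} {xs} {R} {w} en c) d =
  subst (λ t → EncodesRules ((A , q) ∷ R ++ S) (toℕ q ∷ length xs ∷ t)) (sym (List.++-assoc (map toℕ xs) w v))
        (add en (encodes-++ c d))

unique-snoc : ∀ {A : Set} {xs : List A} {x} → Unique xs → ¬ (x List.∈ xs) → Unique (xs ++ x ∷ [])
unique-snoc u x∉ = Unique.++⁺ u ([] ∷ []) (λ { (m , here refl) → x∉ m })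

length-snoc : ∀ {A : Set} (xs : List A) x → length (xs ++ x ∷ []) ≡ suc (length xs)
length-snoc xs x = trans (List.length-++ xs) (+-comm (length xs) 1)

-- Marking rules that miss an extreme point

module _ {n : ℕ} (R : List (Rule n)) where

  -- A flag is justified by some body element of its rule, whichever cell raised it; the bound `K`
  -- on the cells already judged matters only for the converse.
  record Judged (K : ℕ) (E O bad : ℕ → ℕ) : Set where
    field
      bad⁻ : ∀ {v} → bad v ≢ 0 → ∃[ i ] toℕ i ≡ v × (∃[ s ] s ∈ body R i × Misses R i s)
      bad⁺ : ∀ {k i s} → k < K → O k ≡ toℕ i → E k ≡ toℕ s → Misses R i s → bad (toℕ i) ≢ 0

  JudgedOf : ℕ → State → Set
  JudgedOf K σ = Judged K (arrays σ elemᵃ) (arrays σ ownᵃ) (arrays σ badᵃ)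

  judge-ok : ∀ σ (i : Index R) s → LoadedOf R σ → MeaningOf R i σ → regs σ iʳ ≡ toℕ i →
             regs σ cursorʳ < regs σ nCells → arrays σ ownᵃ (regs σ cursorʳ) ≡ toℕ i → arrays σ elemᵃ (regs σ cursorʳ) ≡ toℕ s →
             JudgedOf (regs σ cursorʳ) σ →
             Judged (suc (regs σ cursorʳ)) (arrays σ elemᵃ) (arrays σ ownᵃ) (arrays (⟦ judge ⟧ σ) badᵃ)
  judge-ok σ i s l mn iv k<N ok ek j =
    wp-sound judge (λ τ → Judged (suc k) E O (arrays τ badᵃ)) σ (extreme , ordinary)
    where
    open Loaded l
    open Meaning mn
    open Judged j
    k = regs σ cursorʳ
    H = arrays σ headᵃ
    E = arrays σ elemᵃ
    O = arrays σ ownᵃ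
    same : ∀ {i′ s′} → O k ≡ toℕ {length R} i′ → E k ≡ toℕ {n} s′ → i ≡ i′ × s ≡ s′
    same o e = Fin.toℕ-injective (trans (sym ok) o) , Fin.toℕ-injective (trans (sym ek) e)
    -- `Misses` requires an extreme point, and a nonzero count shows that the element of this cell
    -- is not one.
    ordinary : arrays σ cntᵃ (E k) ≢ 0 → Judged (suc k) E O (arrays σ badᵃ)
    ordinary c≢0 = record { bad⁻ = bad⁻ ; bad⁺ = new }
      where
      new : ∀ {k′ i′ s′} → k′ < suc k → O k′ ≡ toℕ i′ → E k′ ≡ toℕ s′ → Misses R i′ s′ → arrays σ badᵃ (toℕ i′) ≢ 0
      new {k′} lt o e ms with k′ ≟ k
      ... | no ne = bad⁺ (<suc lt ne) o e ms
      ... | yes refl with same o e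
      ...   | refl , refl = ⊥-elim (c≢0 (extreme⇒cnt k<N ek (proj₁ ms)))
    extreme : arrays σ cntᵃ (E k) ≡ 0 → Judged (suc k) E O (arrays (⟦ checks ⟧ σ) badᵃ)
    extreme c0 = record { bad⁻ = old ; bad⁺ = new }
      where
      module F = Flags (checks-ok σ)
      bad′ = arrays (⟦ checks ⟧ σ) badᵃ
      old : ∀ {v} → bad′ v ≢ 0 → ∃[ i ] toℕ i ≡ v × (∃[ s ] s ∈ body R i × Misses R i s)
      old b with F.reason b
      ... | inj₁ o = bad⁻ o
      ... | inj₂ (refl , j , lt , h0 , hj , missing) with rule< lt
      ...   | j′ , refl = i , sym iv , s , cell∈ k<N ok ek ,
                cnt⇒extreme k<N ek c0 , j′ , hit⇒valid j′ h0 , head-≡ (trans hj (cong H iv)) ,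
                λ m → let k′ , lt′ , o , e = cell⁺ j′ m in missing lt′ o (trans e (sym ek))
      new : ∀ {k′ i′ s′} → k′ < suc k → O k′ ≡ toℕ i′ → E k′ ≡ toℕ s′ → Misses R i′ s′ → bad′ (toℕ i′) ≢ 0
      new {k′} lt o e ms with k′ ≟ k
      ... | no ne = F.kept (bad⁺ (<suc lt ne) o e ms)
      ... | yes refl with same o e
      ...   | refl , refl with ms
      ...     | _ , j , v , hd , s∉ = subst (λ i → bad′ i ≢ 0) iv
                (F.flagged (<rule j) (valid⇒hit j v , trans (≡-head hd) (cong H (sym iv)) ,
                  λ lt′ o′ e′ → s∉ (cell∈ lt′ o′ (trans e′ ek))))

  judged-move : ∀ {K K′ E E′ O O′ bad bad′} → K ≡ K′ → E ≡ E′ → O ≡ O′ → bad ≡ bad′ →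
                Judged K E O bad → Judged K′ E′ O′ bad′
  judged-move refl refl refl refl j = j

  Checking : State → Set
  Checking σ = LoadedOf R σ × JudgedOf (regs σ cursorʳ) σ

  checkCell-ok : ∀ σ → regs σ cursorʳ < regs σ nCells → Checking σ → Checking (next cursorʳ checkCell σ)
  checkCell-ok σ k<N (l , j) with Loaded.cell l k<N
  ... | i , ok , s , ek , _ = loaded′ checkCell-keepsR checkCell-keepsA ,
    judged-move (cong suc A.same-15) (sym (frameA judge elemᵃ refl σ₂)) (sym (frameA judge ownᵃ refl σ₂)) refl
      (judge-ok σ₂ i s A.loaded A.meant A.indexed
        (subst₂ _<_ (sym A.same-15) (sym A.same-1) k<N)
        (trans (cong-app A.same-O _) (trans (cong (arrays σ ownᵃ) A.same-15) ok))
        (trans (cong-app A.same-E _) (trans (cong (arrays σ elemᵃ) A.same-15) ek))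
        (judged-move (sym A.same-15) (sym A.same-E) (sym A.same-O) (sym A.same-bad) j))
    where
    σ₁ = setReg iʳ (arrays σ ownᵃ (regs σ cursorʳ)) σ
    σ₂ = ⟦ closure ⟧ σ₁
    module A = Analysed (analyse R σ₁ i l ok)
    loaded′ : All (λ r → writesR r checkCell ≡ false) (nRules ∷ nCells ∷ cursorʳ ∷ []) →
              All (λ a → writesA a checkCell ≡ false) (outputᵃ ∷ headᵃ ∷ elemᵃ ∷ ownᵃ ∷ []) → LoadedOf R (next cursorʳ checkCell σ)
    loaded′ (r0 ∷ r1 ∷ _) (_ ∷ a2 ∷ a3 ∷ a4 ∷ []) =
      loaded-frame R (frameR checkCell nRules r0 σ) (frameR checkCell nCells r1 σ)
        (frameA checkCell headᵃ a2 σ) (frameA checkCell elemᵃ a3 σ) (frameA checkCell ownᵃ a4 σ) l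

  phaseA-ok : ∀ σ → LoadedOf R σ → (∀ v → arrays σ badᵃ v ≡ 0) →
              let τ = ⟦ for cursorʳ nCells checkCell ⟧ σ in
              LoadedOf R τ × JudgedOf (regs τ nCells) τ × arrays τ outputᵃ ≡ arrays σ outputᵃ
  phaseA-ok σ l z = go checkCell-keepsR checkCell-keepsA
    where
    go : All (λ r → writesR r checkCell ≡ false) (nRules ∷ nCells ∷ cursorʳ ∷ []) →
         All (λ a → writesA a checkCell ≡ false) (outputᵃ ∷ headᵃ ∷ elemᵃ ∷ ownᵃ ∷ []) → _
    go (_ ∷ r1 ∷ _) (a1 ∷ _) = proj₁ (proj₁ r) , subst (λ K → JudgedOf K τ) (proj₂ r) (proj₂ (proj₁ r)) ,
                               frameA (for cursorʳ nCells checkCell) outputᵃ a1 σ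
      where
      τ = ⟦ for cursorʳ nCells checkCell ⟧ σ
      r = for-inv cursorʳ nCells checkCell refl r1 Checking checkCell-ok σ
            (l , record { bad⁻ = λ b → ⊥-elim (b (z _)) ; bad⁺ = λ () })

  -- Writing the critical rules

  record Emitted (K i c w : ℕ) (E O cnt out₀ out : ℕ → ℕ) : Set where
    field
      xs       : List (Fin n)
      unique   : Unique xs
      sound    : ∀ {x} → x List.∈ xs → ∃[ k ] k < K × O k ≡ i × cnt (E k) ≡ 0 × E k ≡ toℕ x
      complete : ∀ {k} → k < K → O k ≡ i → cnt (E k) ≡ 0 → ∃[ x ] x List.∈ xs × E k ≡ toℕ x
      written  : At out (suc c) (map toℕ xs)
      pointer  : w ≡ suc c + length xs
      counted  : out c ≡ length xs
      below    : ∀ {a} → a < c → out a ≡ out₀ a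

  emitted-skip : ∀ {K i c w E O cnt out₀ out} → ¬ (O K ≡ i × cnt (E K) ≡ 0) →
                 Emitted K i c w E O cnt out₀ out → Emitted (suc K) i c w E O cnt out₀ out
  emitted-skip ns e = record
    { xs = xs ; unique = unique
    ; sound = λ m → let k , lt , r = sound m in k , m<n⇒m<1+n lt , r
    ; complete = λ lt o c → complete (<suc lt (λ { refl → ns (o , c) })) o c
    ; written = written ; pointer = pointer ; counted = counted ; below = below }
    where open Emitted e

  emitted-snoc : ∀ {m N H K i c w E O cnt out₀ out} → Loaded R m N H E O → K < N →
                 O K ≡ i → cnt (E K) ≡ 0 → Emitted K i c w E O cnt out₀ out →
                 let out′ = out [ w ↦ E K ] in
                 Emitted (suc K) i c (suc w) E O cnt out₀ (out′ [ c ↦ suc (out′ c) ])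
  emitted-snoc {K = K} {i} {c} {w} {E} {O} {cnt} {out₀} {out} l K<N o c0 e with Loaded.cell l K<N
  ... | j , oj , x , ex , _ = record
    { xs = xs ++ x ∷ []
    -- A repetition would come from two different cells of one rule with the same element.
    ; unique = unique-snoc unique (λ m → let k , lt , ok , _ , ek = sound m in
        <⇒≢ lt (Loaded.separated l z≤n (<-trans lt K<N) z≤n K<N (trans ok (sym o)) (trans ek (sym ex))))
    ; sound = sound′
    ; complete = complete′
    ; written = subst (At out″ (suc c)) (sym (List.map-++ toℕ xs (x ∷ [])))
        (at-++⁺ (map toℕ xs) (at-cong (map toℕ xs) (λ le lt → sym (elsewhere (<⇒≢ (≤-trans lt (≤-reflexive end)))
                                                              (λ e → <⇒≢ le (sym e)))) written)
          (subst (λ a → out″ a ≡ toℕ x) (sym end) (trans at-w ex) , tt))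
    ; pointer = trans (cong suc pointer) (trans (sym (+-suc (suc c) (length xs))) (cong (suc c +_) (sym (length-snoc xs x))))
    ; counted = trans (upd-eq out′ {c} {suc (out′ c)} {c} refl) (trans (cong suc (trans (upd-neq out c≢w) counted)) (sym (length-snoc xs x)))
    ; below = λ lt → trans (elsewhere (λ e → <⇒≢ (<-trans lt c<w) e) (<⇒≢ lt)) (below lt) }
    where
    open Emitted e
    out′ = out [ w ↦ E K ]
    out″ = out′ [ c ↦ suc (out′ c) ]
    end : suc c + length (map toℕ xs) ≡ w
    end = trans (cong (suc c +_) (List.length-map toℕ xs)) (sym pointer)
    c<w : c < w
    c<w = ≤-trans (m≤m+n (suc c) (length xs)) (≤-reflexive (sym pointer))
    c≢w : c ≢ w
    c≢w = <⇒≢ c<w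
    elsewhere : ∀ {a} → a ≢ w → a ≢ c → out″ a ≡ out a
    elsewhere a≢w a≢c = trans (upd-neq out′ a≢c) (upd-neq out a≢w)
    at-w : out″ w ≡ E K
    at-w = trans (upd-neq out′ (λ e → c≢w (sym e))) (upd-eq out refl)
    sound′ : ∀ {y} → y List.∈ xs ++ x ∷ [] → ∃[ k ] k < suc K × O k ≡ i × cnt (E k) ≡ 0 × E k ≡ toℕ y
    sound′ m with List.∈-++⁻ xs m
    ... | inj₁ m′ = let k , lt , r = sound m′ in k , m<n⇒m<1+n lt , r
    ... | inj₂ (here refl) = K , n<1+n K , o , c0 , ex
    complete′ : ∀ {k} → k < suc K → O k ≡ i → cnt (E k) ≡ 0 → ∃[ y ] y List.∈ xs ++ x ∷ [] × E k ≡ toℕ y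
    complete′ {k} lt ok ck with k ≟ K
    ... | yes refl = x , List.∈-++⁺ʳ xs (here refl) , ex
    ... | no ne = let y , m , r = complete (<suc lt ne) ok ck in y , List.∈-++⁺ˡ m , r

  EmittedOf : ℕ → (ℕ → ℕ) → State → Set
  EmittedOf K out₀ σ = Emitted K (regs σ iʳ) (regs σ countʳ) (regs σ writeʳ) (arrays σ elemᵃ) (arrays σ ownᵃ) (arrays σ cntᵃ) out₀ (arrays σ outputᵃ)

  emitCells-ok : ∀ out₀ σ → LoadedOf R σ → EmittedOf 0 out₀ σ →
                 let τ = ⟦ for kʳ nCells emitCell ⟧ σ in
                 (LoadedOf R τ × EmittedOf (regs τ kʳ) out₀ τ) × regs τ kʳ ≡ regs τ nCells
  emitCells-ok out₀ σ l e = for-wp kʳ nCells emitCell (λ τ → LoadedOf R τ × EmittedOf (regs τ kʳ) out₀ τ) refl refl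
    (λ { τ lt (l , e) → (λ o → (λ c0 → l , emitted-snoc l lt o c0 e) , (λ c≢0 → l , emitted-skip (λ (_ , c0) → c≢0 c0) e)) ,
                        (λ no → l , emitted-skip (λ (o , _) → no o) e) }) σ (l , e)

  record EmittedRule (i : Index R) (σ τ : State) : Set where
    field
      ys      : List (Fin n)
      members : Enumerates ys (_∈ tips R i)
      row     : At (arrays τ outputᵃ) (regs σ outʳ) (toℕ (head R i) ∷ length ys ∷ map toℕ ys)
      end     : regs τ outʳ ≡ suc (suc (regs σ outʳ)) + length ys
      -- Address 0 is exempt because it holds the number of rules written so far.
      before  : ∀ {a} → a ≢ 0 → a < regs σ outʳ → arrays τ outputᵃ a ≡ arrays σ outputᵃ a
      number  : arrays τ outputᵃ 0 ≡ suc (arrays σ outputᵃ 0)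

  emit-ok : ∀ σ i → LoadedOf R σ → MeaningOf R i σ → regs σ iʳ ≡ toℕ i → 1 ≤ regs σ outʳ → EmittedRule i σ (⟦ emit ⟧ σ)
  emit-ok σ i l mn iv 1≤o = finish (moved (proj₂ r) (frameR loop iʳ refl σ₁) (frameR loop countʳ refl σ₁) (frameR loop nCells refl σ₁)
                                      (frameA loop elemᵃ refl σ₁) (frameA loop ownᵃ refl σ₁) (frameA loop cntᵃ refl σ₁) (proj₂ (proj₁ r)))
    where
    o = regs σ outʳ
    E = arrays σ elemᵃ
    O = arrays σ ownᵃ
    loop = for kʳ nCells emitCell
    σ₁ = ⟦ outputᵃ [ reg outʳ ]:= headᵃ [ reg iʳ ] ,, countʳ := succ′ (reg outʳ) ,,
           outputᵃ [ reg countʳ ]:= lit 0 ,, writeʳ := succ′ (reg countʳ) ⟧ σ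
    σ₂ = ⟦ loop ⟧ σ₁
    out₁ = (arrays σ outputᵃ [ o ↦ arrays σ headᵃ (regs σ iʳ) ])
    out₀ = out₁ [ suc o ↦ 0 ]
    r = emitCells-ok out₀ σ₁ l (record
      { xs = [] ; unique = [] ; sound = λ () ; complete = λ () ; written = tt ; pointer = sym (+-identityʳ _)
      ; counted = upd-eq out₁ {suc o} {0} {suc o} refl ; below = λ _ → refl })
    moved : ∀ {K N N′ i i′ c c′ E E′ O O′ cnt cnt′} → K ≡ N → i ≡ i′ → c ≡ c′ → N ≡ N′ → E ≡ E′ → O ≡ O′ → cnt ≡ cnt′ →
            Emitted K i c (regs σ₂ writeʳ) E O cnt out₀ (arrays σ₂ outputᵃ) →
            Emitted N′ i′ c′ (regs σ₂ writeʳ) E′ O′ cnt′ out₀ (arrays σ₂ outputᵃ)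
    moved refl refl refl refl refl refl refl e = e
    finish : Emitted (regs σ nCells) (regs σ iʳ) (suc o) (regs σ₂ writeʳ) E O (arrays σ cntᵃ) out₀ (arrays σ₂ outputᵃ) →
             EmittedRule i σ (⟦ outputᵃ [ lit 0 ]:= succ′ (outputᵃ [ lit 0 ]) ,, outʳ := reg writeʳ ⟧ σ₂)
    finish e = record
      { ys = X.xs
      ; members = X.unique , λ x → mk⇔ to (from x)
      ; row = at-cong (toℕ (head R i) ∷ length X.xs ∷ map toℕ X.xs) {f = out₂}
                (λ le _ → sym (upd-neq out₂ (λ { refl → <⇒≱ 1≤o le })))
                (trans (X.below (n<1+n o)) (trans (upd-neq out₁ (<⇒≢ (n<1+n o)))
                  (trans (upd-eq (arrays σ outputᵃ) refl) (trans (cong (arrays σ headᵃ) iv) (head≡ i)))) ,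
                 X.counted , X.written)
      ; end = X.pointer
      ; before = λ a≢0 lt → trans (upd-neq out₂ a≢0) (old lt)
      ; number = trans (upd-eq out₂ {0} {suc (out₂ 0)} {0} refl) (cong suc (old 1≤o)) }
      where
      open Loaded l
      open Meaning mn
      module X = Emitted e
      out₂ = arrays σ₂ outputᵃ
      old : ∀ {a} → a < o → out₂ a ≡ arrays σ outputᵃ a
      old lt = trans (X.below (m<n⇒m<1+n lt)) (trans (upd-neq out₁ (<⇒≢ (m<n⇒m<1+n lt))) (upd-neq (arrays σ outputᵃ) (<⇒≢ lt)))
      to : ∀ {x} → x List.∈ X.xs → x ∈ tips R i
      to m = let k , lt , ok , c0 , ek = X.sound m in
        tips⁺ R (cell∈ lt (trans ok iv) ek) (cnt⇒extreme lt ek c0)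
      from : ∀ x → x ∈ tips R i → x List.∈ X.xs
      from x m with tips⁻ R {i} m
      ... | b , ex with cell⁺ i b
      ...   | k , lt , ok , ek with X.complete lt (trans ok (sym iv)) (extreme⇒cnt lt ek ex)
      ...     | y , my , ey = subst (List._∈ X.xs) (Fin.toℕ-injective (trans (sym ey) ek)) my

  chosen : Index R → Rule n
  chosen i = tips R i , head R i

  -- The rules with index below `I` have been decided, and `o` is the first free address of the
  -- output.
  record Written (I o : ℕ) (out : ℕ → ℕ) : Set where
    field
      rs       : List (Rule n)
      word     : List ℕ
      code     : EncodesRules rs word
      placed   : At out 1 word
      end      : o ≡ suc (length word)
      number   : out 0 ≡ length rs
      unique   : Unique rs
      sound    : ∀ {ρ} → ρ List.∈ rs → ∃[ j ] toℕ j < I × Selected R j × chosen j ≡ ρ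
      complete : ∀ {j} → toℕ j < I → Selected R j → chosen j List.∈ rs

  written-skip : ∀ {i o out} → ¬ Selected R i → Written (toℕ i) o out → Written (suc (toℕ i)) o out
  written-skip {i} ns w = record
    { rs = rs ; word = word ; code = code ; placed = placed ; end = end ; number = number ; unique = unique
    ; sound = λ m → let j , lt , r = sound m in j , m<n⇒m<1+n lt , r
    ; complete = λ lt s → complete (<suc lt (λ e → ns (subst (Selected R) (Fin.toℕ-injective e) s))) s }
    where open Written w

  written-snoc : ∀ {i σ τ} → Selected R i → EmittedRule i σ τ → Written (toℕ i) (regs σ outʳ) (arrays σ outputᵃ) →
                 Written (suc (toℕ i)) (regs τ outʳ) (arrays τ outputᵃ)
  written-snoc {i} {σ} {τ} sel em w = record
    { rs = rs ++ chosen i ∷ []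
    ; word = word ++ row′
    ; code = encodes-++ code (add members [])
    ; placed = at-++⁺ word (at-cong word (λ le lt → sym (before (λ { refl → <⇒≱ le z≤n })
                                                        (≤-trans lt (≤-reflexive (sym end))))) placed)
                 (subst₂ (At (arrays τ outputᵃ)) end (cong (λ t → toℕ (head R i) ∷ length ys ∷ t) (sym (List.++-identityʳ _))) row)
    ; end = trans X.end (trans (cong (λ o → suc (suc o) + length ys) end)
              (trans (regroup (length word) (length ys))
                (cong suc (sym (trans (List.length-++ word) (cong (λ t → length word + suc (suc t)) len))))))
    ; number = trans X.number (trans (cong suc number) (sym (length-snoc rs (chosen i))))
    -- Equal output means equal tips and heads, and so, by `selected-unique`, the same index; but
    -- the earlier rules have smaller indices.
    ; unique = unique-snoc unique (λ m → let j , lt , s , e = sound m in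
        <⇒≢ lt (cong toℕ (selected-unique R s sel (cong proj₁ e) (cong proj₂ e))))
    ; sound = sound′
    ; complete = complete′ }
    where
    open Written w
    module X = EmittedRule em
    open X using (ys; members; row; before)
    row′ = toℕ (head R i) ∷ length ys ∷ map toℕ ys ++ []
    len : length (map toℕ ys ++ []) ≡ length ys
    len = trans (cong length (List.++-identityʳ (map toℕ ys))) (List.length-map toℕ ys)
    regroup : ∀ a b → suc (suc (suc a)) + b ≡ suc (a + suc (suc b))
    regroup = solve-∀
    sound′ : ∀ {ρ} → ρ List.∈ rs ++ chosen i ∷ [] → ∃[ j ] toℕ j < suc (toℕ i) × Selected R j × chosen j ≡ ρ
    sound′ m with List.∈-++⁻ rs m
    ... | inj₁ m′ = let j , lt , r = sound m′ in j , m<n⇒m<1+n lt , r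
    ... | inj₂ (here refl) = i , n<1+n (toℕ i) , sel , refl
    complete′ : ∀ {j} → toℕ j < suc (toℕ i) → Selected R j → chosen j List.∈ rs ++ chosen i ∷ []
    complete′ {j} lt s with toℕ j ≟ toℕ i
    ... | no ne = List.∈-++⁺ˡ (complete (<suc lt ne) s)
    ... | yes e with Fin.toℕ-injective e
    ...   | refl = List.∈-++⁺ʳ rs (here refl)

  -- While rules are written, `reject` raises further flags for another reason. A flag therefore has
  -- its meaning from the first phase only at the rules from `I` on, which `reject` has not yet
  -- reached.
  record Verdict (I : ℕ) (bad : ℕ → ℕ) : Set where
    field
      bad⇒miss : ∀ {j} → I ≤ toℕ j → bad (toℕ j) ≢ 0 → ∃[ s ] s ∈ body R j × Misses R j s
      miss⇒bad : ∀ {j s} → I ≤ toℕ j → s ∈ body R j → Misses R j s → bad (toℕ j) ≢ 0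

  judged⇒verdict : ∀ {m N H E O bad} → Loaded R m N H E O → Judged N E O bad → Verdict 0 bad
  judged⇒verdict {bad = bad} l j = record
    { bad⇒miss = λ {j} _ b → why (bad⁻ b)
    ; miss⇒bad = λ {j} _ m ms → let k , lt , o , e = cell⁺ j m in bad⁺ lt o e ms }
    where
    open Loaded l
    open Judged j
    why : ∀ {j} → (∃[ i ] toℕ i ≡ toℕ j × (∃[ s ] s ∈ body R i × Misses R i s)) → ∃[ s ] s ∈ body R j × Misses R j s
    why (i , e , r) with Fin.toℕ-injective e
    ... | refl = r

  select-ok : ∀ σ i → LoadedOf R σ → MeaningOf R i σ → regs σ iʳ ≡ toℕ i →
              (arrays σ badᵃ (regs σ iʳ) ≡ 0 → arrays σ hitᵃ (regs σ iʳ) ≡ 0 → Selected R i) →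
              (Selected R i → arrays σ badᵃ (regs σ iʳ) ≡ 0 × arrays σ hitᵃ (regs σ iʳ) ≡ 0) →
              1 ≤ regs σ outʳ → Written (toℕ i) (regs σ outʳ) (arrays σ outputᵃ) →
              let τ = ⟦ select ⟧ σ in Written (suc (toℕ i)) (regs τ outʳ) (arrays τ outputᵃ)
  select-ok σ i l mn iv yes′ no′ 1≤o w =
    wp-sound select Done σ
      ((λ b0 → (λ h0 → emitted b0 h0) ,
               (λ h≢0 → written-skip (λ s → h≢0 (proj₂ (no′ s))) w)) ,
       (λ b≢0 → written-skip (λ s → b≢0 (proj₁ (no′ s))) w))
    where
    Done : State → Set
    Done τ = Written (suc (toℕ i)) (regs τ outʳ) (arrays τ outputᵃ)
    emitted : arrays σ badᵃ (regs σ iʳ) ≡ 0 → arrays σ hitᵃ (regs σ iʳ) ≡ 0 → Done (⟦ emit ⟧ σ)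
    emitted b0 h0 = written-snoc (yes′ b0 h0) (emit-ok σ i l mn iv 1≤o) w

  Emitting : State → Set
  Emitting σ = LoadedOf R σ × Verdict (regs σ iʳ) (arrays σ badᵃ) × Written (regs σ iʳ) (regs σ outʳ) (arrays σ outputᵃ)

  emitRule-ok : ∀ σ → regs σ iʳ < regs σ nRules → Emitting σ → Emitting (next iʳ emitRule σ)
  emitRule-ok σ i<m (l , vd , w) with Loaded.rule< l i<m
  ... | i , iv = loaded′ emitRule-keepsR emitRule-keepsA , verdict′ ,
    subst (λ I → Written (suc I) (regs σ₃ outʳ) (arrays σ₃ outputᵃ)) iv
      (select-ok σ₂ i (loaded-frame R refl refl (frameA reject headᵃ refl σ₁) (frameA reject elemᵃ refl σ₁) (frameA reject ownᵃ refl σ₁)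
                         (loaded-frame R (frameR reject nRules refl σ₁) (frameR reject nCells refl σ₁) refl refl refl A.loaded))
        (meant (frameR reject nCells refl σ₁) (frameA reject elemᵃ refl σ₁) (frameA reject cntᵃ refl σ₁) (frameA reject hitᵃ refl σ₁) A.meant)
        iv₂ accept refuse
        (subst (1 ≤_) (sym out-reg) (≤-trans (s≤s z≤n) (≤-reflexive (sym (Written.end w)))))
        (subst₂ (Written (toℕ i)) (sym out-reg) (sym out-array) (subst (λ I → Written I (regs σ outʳ) (arrays σ outputᵃ)) (sym iv) w)))
    where
    σ₁ = ⟦ closure ⟧ σ
    σ₂ = ⟦ reject ⟧ σ₁
    σ₃ = ⟦ select ⟧ σ₂
    module A = Analysed (analyse R σ i l (sym iv))
    open Loaded A.loaded
    open Meaning A.meant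
    open Verdict vd
    iv₂ : regs σ₂ iʳ ≡ toℕ i
    iv₂ = trans (frameR reject iʳ refl σ₁) A.indexed
    out-reg : regs σ₂ outʳ ≡ regs σ outʳ
    out-reg = trans (frameR reject outʳ refl σ₁) A.same-16
    out-array : arrays σ₂ outputᵃ ≡ arrays σ outputᵃ
    out-array = trans (frameA reject outputᵃ refl σ₁) A.same-out
    meant : ∀ {N N′ E E′ cnt cnt′ hit hit′} → N′ ≡ N → E′ ≡ E → cnt′ ≡ cnt → hit′ ≡ hit →
            Meaning R i N E cnt hit → Meaning R i N′ E′ cnt′ hit′
    meant refl refl refl refl mn = mn
    hit = arrays σ₁ hitᵃ
    moved : ∀ {b b′ r r′ H H′ h h′ bad bad′ new} → b ≡ b′ → r ≡ r′ → H ≡ H′ → h ≡ h′ → bad ≡ bad′ →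
            Flags (EarlierTest r H h) b r bad new → Flags (EarlierTest r′ H′ h′) b′ r′ bad′ new
    moved refl refl refl refl refl f = f
    flags : Flags (EarlierTest (toℕ i) (arrays σ₁ headᵃ) hit) (regs σ₁ nRules) (toℕ i) (arrays σ badᵃ) (arrays σ₂ badᵃ)
    flags = moved (trans (proj₂ (reject-ok σ₁)) (frameR reject nRules refl σ₁)) iv₂ (frameA reject headᵃ refl σ₁)
              (frameA reject hitᵃ refl σ₁) A.same-bad (proj₁ (reject-ok σ₁))
    module F = Flags flags
    hit-i : arrays σ₂ hitᵃ (regs σ₂ iʳ) ≡ hit (toℕ i)
    hit-i = trans (cong-app (frameA reject hitᵃ refl σ₁) _) (cong hit iv₂)
    bad-i : arrays σ₂ badᵃ (regs σ₂ iʳ) ≡ arrays σ₂ badᵃ (toℕ i)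
    bad-i = cong (arrays σ₂ badᵃ) iv₂
    start : regs σ iʳ ≤ toℕ i
    start = ≤-reflexive (sym iv)
    accept : arrays σ₂ badᵃ (regs σ₂ iʳ) ≡ 0 → arrays σ₂ hitᵃ (regs σ₂ iʳ) ≡ 0 → Selected R i
    accept b0 h0 = hit⇒valid i (trans (sym hit-i) h0) ,
      (λ m ms → F.kept (miss⇒bad start m ms) b0′) ,
      (λ (j , v , e , lt) → F.flagged (<rule j) (valid⇒hit j v , ≡-head e , lt) b0′)
      where
      b0′ : arrays σ₂ badᵃ (toℕ i) ≡ 0
      b0′ = trans (sym bad-i) b0
    refuse : Selected R i → arrays σ₂ badᵃ (regs σ₂ iʳ) ≡ 0 × arrays σ₂ hitᵃ (regs σ₂ iʳ) ≡ 0
    refuse (v , hits , first) = clean , trans hit-i (valid⇒hit i v)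
      where
      innocent : ¬ (arrays σ₂ badᵃ (toℕ i) ≢ 0)
      innocent b with F.reason b
      ... | inj₁ o = let s , m , ms = bad⇒miss start o in hits m ms
      ... | inj₂ (_ , j , lt , h0 , hj , j<i) with rule< lt
      ...   | j′ , refl = first (j′ , hit⇒valid j′ h0 , head-≡ hj , j<i)
      clean : arrays σ₂ badᵃ (regs σ₂ iʳ) ≡ 0
      clean with arrays σ₂ badᵃ (toℕ i) ≟ 0
      ... | yes z = trans bad-i z
      ... | no nz = ⊥-elim (innocent nz)
    verdict′ : Verdict (suc (regs σ iʳ)) (arrays σ₃ badᵃ)
    verdict′ = subst (Verdict (suc (regs σ iʳ))) (sym (frameA select badᵃ refl σ₂)) (record
      { bad⇒miss = later
      ; miss⇒bad = λ le m ms → F.kept (miss⇒bad (<⇒≤ le) m ms) })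
      where
      later : ∀ {j} → suc (regs σ iʳ) ≤ toℕ j → arrays σ₂ badᵃ (toℕ j) ≢ 0 → ∃[ s ] s ∈ body R j × Misses R j s
      later le b with F.reason b
      ... | inj₁ o = bad⇒miss (<⇒≤ le) o
      ... | inj₂ (e , _) = ⊥-elim (<⇒≢ le (trans (sym iv) (sym e)))
    loaded′ : All (λ r → writesR r emitRule ≡ false) (nRules ∷ nCells ∷ iʳ ∷ []) →
              All (λ a → writesA a emitRule ≡ false) (headᵃ ∷ elemᵃ ∷ ownᵃ ∷ []) → LoadedOf R (next iʳ emitRule σ)
    loaded′ (r0 ∷ r1 ∷ _) (a2 ∷ a3 ∷ a4 ∷ []) =
      loaded-frame R (frameR emitRule nRules r0 σ) (frameR emitRule nCells r1 σ)
        (frameA emitRule headᵃ a2 σ) (frameA emitRule elemᵃ a3 σ) (frameA emitRule ownᵃ a4 σ) l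

  phaseB-ok : ∀ σ → LoadedOf R σ → JudgedOf (regs σ nCells) σ → regs σ outʳ ≡ 1 → arrays σ outputᵃ 0 ≡ 0 →
              let τ = ⟦ for iʳ nRules emitRule ⟧ σ in Written (length R) (regs τ outʳ) (arrays τ outputᵃ)
  phaseB-ok σ l j o z = go emitRule-keepsR
    where
    go : All (λ r → writesR r emitRule ≡ false) (nRules ∷ nCells ∷ iʳ ∷ []) → _
    go (r0 ∷ _) = subst (λ I → Written I (regs τ outʳ) (arrays τ outputᵃ)) (trans (proj₂ r) (Loaded.rules (proj₁ (proj₁ r))))
                        (proj₂ (proj₂ (proj₁ r)))
      where
      τ = ⟦ for iʳ nRules emitRule ⟧ σ
      r = for-inv iʳ nRules emitRule refl r0 Emitting emitRule-ok σ
        (l , judged⇒verdict l j , record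
          { rs = [] ; word = [] ; code = [] ; placed = tt ; end = o ; number = z ; unique = []
          ; sound = λ () ; complete = λ () })

  main-ok : ∀ σ → LoadedOf R σ → (∀ v → arrays σ badᵃ v ≡ 0) → arrays σ outputᵃ 0 ≡ 0 →
            Written (length R) (regs (⟦ main ⟧ σ) outʳ) (arrays (⟦ main ⟧ σ) outputᵃ)
  main-ok σ l bad out = phaseB-ok σ₂ (proj₁ r) (proj₁ (proj₂ r)) refl (trans (cong-app (proj₂ (proj₂ r)) 0) out)
    where
    σ₁ = ⟦ for cursorʳ nCells checkCell ⟧ σ
    σ₂ = setReg outʳ 1 σ₁
    r = phaseA-ok σ l bad

  -- Enumeration and total running time

  chosen-enumerate : ∀ {o out} (w : Written (length R) o out) → Enumerates (Written.rs w) (Critical (𝓐 R))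
  chosen-enumerate w = unique , λ ρ → mk⇔ to from
    where
    open Written w
    to : ∀ {ρ} → ρ List.∈ rs → Critical (𝓐 R) ρ
    to m = let j , _ , s , e = sound m in subst (Critical (𝓐 R)) e (selected⇒critical R s)
    from : ∀ {ρ} → Critical (𝓐 R) ρ → ρ List.∈ rs
    from c = let i , s , t , h = critical⇒selected R c in
      subst (List._∈ rs) (cong₂ _,_ t h) (complete (Fin.toℕ<n i) s)

  at-get : ∀ v {f o} → At f o v → ∀ i → f (o + toℕ i) ≡ lookup v i
  at-get v a i = at-lookup⁺ (λ x → x) v (subst (At _ _) (sym (List.map-id v)) a) i

  main-cost : ∀ σ s → regs σ nRules ≤ s → regs σ nCells ≤ s → cost main σ ≤ coeff main * suc s ^ 2
  main-cost σ s b0 b1 with main-keepsR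
  ... | r0 ∷ r1 ∷ [] = subst (λ d → cost main σ ≤ coeff main * suc s ^ d) main-degree
    (cost-bound s main main-uniform r0 r1 σ b0 b1)

-- Expanding the square of `suc l` and absorbing linear terms by `l ≤ l * l` gives 25 + 3K for the
-- quadratic and 13 + K for the constant coefficient; 38 + 3K, with 38 = 13 + 25, dominates both.
total-cost : ∀ K l {a b} → a ≤ 13 + 25 * l → b ≤ K * suc l ^ 2 → a + b ≤ (38 + 3 * K) * l ^ 2 + (38 + 3 * K)
total-cost K l {a} {b} pa pb = begin
  a + b                                              ≤⟨ +-mono-≤ pa pb ⟩
  13 + 25 * l + K * suc l ^ 2                        ≡⟨ expand K l ⟩
  13 + K + K * (l * l) + (25 + 2 * K) * l            ≤⟨ +-monoʳ-≤ (13 + K + K * (l * l)) (*-monoʳ-≤ (25 + 2 * K) (square l)) ⟩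
  13 + K + K * (l * l) + (25 + 2 * K) * (l * l)      ≤⟨ m≤m+n _ (13 * (l * l) + (25 + 2 * K)) ⟩
  13 + K + K * (l * l) + (25 + 2 * K) * (l * l) + (13 * (l * l) + (25 + 2 * K)) ≡⟨ collect K l ⟩
  (38 + 3 * K) * l ^ 2 + (38 + 3 * K)                ∎
  where
  open ≤-Reasoning
  square : ∀ l → l ≤ l * l
  square zero    = z≤n
  square (suc l) = m≤m*n (suc l) (suc l)
  expand : ∀ K l → 13 + 25 * l + K * (suc l * (suc l * 1)) ≡ 13 + K + K * (l * l) + (25 + 2 * K) * l
  expand = solve-∀
  collect : ∀ K l → 13 + K + K * (l * l) + (25 + 2 * K) * (l * l) + (13 * (l * l) + (25 + 2 * K)) ≡
            (38 + 3 * K) * (l * (l * 1)) + (38 + 3 * K)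
  collect = solve-∀

theorem1p4 : ∃[ p ] ∃[ c ] ∀ (n : ℕ) (R : List (Rule n)) (w : List ℕ) →
    Unique R → Encodes R w →
    ComputesWithin p R w (Critical (𝓐 R)) (c * inputSize R ^ 2 + c)
theorem1p4 = compile (parse ,, main) , 38 + 3 * coeff main , correct
  where
  correct : ∀ (n : ℕ) (R : List (Rule n)) (w : List ℕ) → Unique R → Encodes R w →
          ComputesWithin (compile (parse ,, main)) R w (Critical (𝓐 R))
            ((38 + 3 * coeff main) * inputSize R ^ 2 + (38 + 3 * coeff main))
  correct n R w _ en = computes (run (parse ,, main) program-safe σ)
    (total-cost (coeff main) (inputSize R) (proj₂ parsed)
      (main-cost R σ₁ (inputSize R)
        (≤-trans (≤-reflexive I.rules) (≤-trans (m≤n+m (length R) (regs σ₁ nCells)) I.size))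
        (≤-trans (m≤m+n (regs σ₁ nCells) (length R)) I.size)))
    (at-get R (length W.rs ∷ W.word) (W.number , W.placed))
    (encodes W.code)
    (chosen-enumerate R written)
    where
    σ  = initial (n ∷ w)
    σ₁ = ⟦ parse ⟧ σ
    parsed = parse-ok en
    module I = Input (proj₁ parsed)
    written : Written R (length R) (regs (⟦ main ⟧ σ₁) outʳ) (arrays (⟦ main ⟧ σ₁) outputᵃ)
    written = main-ok R σ₁ (record { rules = I.rules ; table = I.table })
      (λ v → cong-app (frameA parse badᵃ refl σ) v) (cong-app (frameA parse outputᵃ refl σ) 0)
    module W = Written written
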